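{- For $b\geq0$ the formal power series $\hat R^{(b)}(\hat x_b,\hat x_{b+1},\ldots)$ is the unique solution (with zero constant term) to $\hat Z^{(b)}(\hat R^{(b)};\hat x_b,\hat x_{b+1},\ldots)=0$, where $$\hat Z^{(b)}(r;\hat x_b,\hat x_{b+1},\ldots)=J(b;r)-\sum_{\ell=b}^\infty I(b,\ell;r)\,\hat x_\ell.$$
   Context: With $\mathrm{Cat}(\ell)=\frac1{\ell+1}\binom{2\ell}\ell$, let $$Z^{(b)}(r;x_{b+1},\ldots)=r\mathbf 1_{\{b=0\}}-\sum_{\ell=0}^b(-1)^{b-\ell}\binom{b+\ell}{2\ell}\mathrm{Cat}(\ell)r^{b-\ell}-\sum_{j=b+1}^\infty\binom{2j-1}{j+b}x_jr^{b+j},$$ and let $R^{(b)}(x_b,x_{b+1},\ldots)$ be the unique formal power series with constant term $1$ satisfying $Z^{(b)}(R^{(b)};x_{b+1},\ldots)=x_b$. The series $\hat R^{(b)}$ is defined by substitution: $$\hat R^{(b)}(\hat x_b,\hat x_{b+1},\ldots)=R^{(b)}(x_b,x_{b+1},\ldots)-1\Big|_{x_\ell=\sum_{p=\ell}^\infty\hat x_pB^{(b)}_{p,\ell}},\qquad B^{(b)}_{p,\ell}=\mathbf 1_{\{p=\ell=b\}}+(-1)^{p-\ell}\binom{p+\ell-1}{p-\ell}\mathbf 1_{\{p\geq\ell>b\}}.$$ The formal power series $I$ and $J$ in $r$ are $$I(b,\ell;r)=\sum_{p=0}^\infty\frac{r^p}{(p!)^2}\prod_{m=0}^{p-1}(\ell^2-(b-m)^2),\qquad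 J(b;r)=\sum_{p=1}^\infty\frac{(-1)^{p+1}r^p}{p!(p-1)!}\prod_{m=0}^{p-2}(b-m)(b-m-1).$$ -}

module Defs where

open import Data.Bool.Base using (if_then_else_)
open import Data.Integer.Base as ℤ using (ℤ; +_; 0ℤ; 1ℤ; -1ℤ)
open import Data.List.Base using (List; []; _∷_; _∷ʳ_; length; replicate)
open import Data.List.Properties using (≡-dec)
open import Data.Nat.Base as ℕ using (ℕ; zero; suc; _∸_; _!)
open import Data.Nat.Combinatorics using (_C_)
open import Data.Nat.ListAction using (sum)
open import Data.Nat.Properties using (_≟_; _≤?_; _<?_; _!*_!≢0)
open import Data.Product.Base using (_×_)
open import Data.Rational.Base as ℚ using (ℚ; 0ℚ; 1ℚ; _/_)
open import Relation.Binary.PropositionalEquality using (_≡_; _≗_)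
open import Relation.Nullary.Decidable using (Dec; does; _×-dec_)

∑< : ℕ → (ℕ → ℚ) → ℚ
∑< zero    f = 0ℚ
∑< (suc n) f = ∑< n f ℚ.+ f n

∑≤ : ℕ → (ℕ → ℚ) → ℚ
∑≤ n = ∑< (suc n)

∏< : ℕ → (ℕ → ℤ) → ℤ
∏< zero    f = 1ℤ
∏< (suc n) f = ∏< n f ℤ.* f n

𝟙[_] : {P : Set} → Dec P → ℤ
𝟙[ P? ] = if does P? then 1ℤ else 0ℤ

⟨_⟩ : ℤ → ℚ
⟨ i ⟩ = i / 1

------------------------------------------------------------------------
-- Monomials in countably many variables X₀, X₁, …

-- Exponent lists without trailing zeros:  𝟏  is the empty one, and
-- top α e  is the list  α ∷ʳ suc e.  Hence each monomial has exactly
-- one representation and _≡_ is the right equality.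

data Monomial : Set where
  𝟏   : Monomial
  top : (α : List ℕ) (e : ℕ) → Monomial

exps : Monomial → List ℕ
exps 𝟏         = []
exps (top α e) = α ∷ʳ suc e

cons : ℕ → Monomial → Monomial
cons zero    𝟏         = 𝟏
cons (suc e) 𝟏         = top [] e
cons n       (top α e) = top (n ∷ α) e

-- The monomial of an arbitrary exponent list (drops trailing zeros).
mono : List ℕ → Monomial
mono []      = 𝟏
mono (n ∷ α) = cons n (mono α)

deg : Monomial → ℕ
deg m = sum (exps m)

-- Only the variables X_k with k < width m can occur in m.
width : Monomial → ℕ
width m = length (exps m)

------------------------------------------------------------------------
-- Formal power series over ℚ in X₀, X₁, …, compared with _≗_.

-- For given b, the variable X_k plays the role of x_{b+k} (or of
-- x̂_{b+k}), so that X₀, X₁, … are precisely x_b, x_{b+1}, ….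

FPS : Set
FPS = Monomial → ℚ

infixl 6 _⊕_ _⊖_
infixl 7 _⊗_
infixr 7 _•_
infixr 8 _^_ _^^_
infix  9 _∘ˢ_

const : ℚ → FPS
const c 𝟏         = c
const c (top _ _) = 0ℚ

X : ℕ → FPS
X k 𝟏               = 0ℚ
X k (top α zero)    = ⟨ 𝟙[ ≡-dec _≟_ α (replicate k 0) ] ⟩
X k (top α (suc _)) = 0ℚ

_⊕_ _⊖_ : FPS → FPS → FPS
(f ⊕ g) m = f m ℚ.+ g m
(f ⊖ g) m = f m ℚ.- g m

_•_ : ℚ → FPS → FPS
(c • f) m = c ℚ.* f m

-- Cauchy product: the sum of  f β * g γ  over all  β + γ = α, with the
-- exponents split one variable at a time.
convolve : (f g : List ℕ → ℚ) → List ℕ → ℚ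
convolve f g []      = f [] ℚ.* g []
convolve f g (n ∷ α) =
  ∑≤ n λ i → convolve (λ β → f (i ∷ β)) (λ γ → g (n ∸ i ∷ γ)) α

_⊗_ : FPS → FPS → FPS
(f ⊗ g) m = convolve (λ β → f (mono β)) (λ γ → g (mono γ)) (exps m)

_^_ : FPS → ℕ → FPS
f ^ zero  = const 1ℚ
f ^ suc n = f ⊗ f ^ n

∑≤ˢ : ℕ → (ℕ → FPS) → FPS
∑≤ˢ n F m = ∑≤ n λ i → F i m

-- The infinite sum  ∑_{k ≥ s} X_k F_k.  The terms with k ≥ width m do
-- not contribute to the coefficient of m.
∑X≥ : ℕ → (ℕ → FPS) → FPS
∑X≥ s F m = ∑< (width m ∸ s) λ i → (X (s ℕ.+ i) ⊗ F (s ℕ.+ i)) m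

-- c ∘ˢ f  is the composite  ∑_{p ≥ 0} c_p f^p  of the univariate series
-- c(r) = ∑_p c_p r^p  with a series f of zero constant term (and is
-- meaningful only for such f):  f^p has no terms of degree below p.
_∘ˢ_ : (ℕ → ℚ) → FPS → FPS
(c ∘ˢ f) m = ∑≤ (deg m) λ p → c p ℚ.* (f ^ p) m

-- ∏_k L_k^{α_k}
_^^_ : (ℕ → FPS) → List ℕ → FPS
L ^^ []      = const 1ℚ
L ^^ (n ∷ α) = L 0 ^ n ⊗ (λ k → L (suc k)) ^^ α

-- The sum of h over all exponent lists of length w with entries ≤ d.
∑Box : (w d : ℕ) → (List ℕ → ℚ) → ℚ
∑Box zero    d h = h []
∑Box (suc w) d h = ∑≤ d λ n → ∑Box w d (λ α → h (n ∷ α))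

-- The substitution X_ℓ := L_ℓ in f, that is ∑_α f_α L^α, for linear
-- forms L_ℓ in the variables X_p with p ≥ ℓ (and meaningful only for
-- such L).  Then L^α is homogeneous of degree |α|, and if X_ℓ occurs in
-- X^α then every monomial of L^α contains some X_p with p ≥ ℓ; so only
-- the α in the box below contribute to the coefficient of m.
substitute : (ℕ → FPS) → FPS → FPS
substitute L f m = ∑Box (width m) (deg m) λ α → f (mono α) ℚ.* (L ^^ α) m

------------------------------------------------------------------------
-- The series R^{(b)}

Cat : ℕ → ℚ
Cat ℓ = + ((2 ℕ.* ℓ) C ℓ) / suc ℓ

-- The index j of the last sum is written b + k with k ≥ 1.
Z : ℕ → FPS → FPS
Z b r =
    ⟨ 𝟙[ b ≟ 0 ] ⟩ • r
  ⊖ ∑≤ˢ b (λ ℓ →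
      (⟨ -1ℤ ℤ.^ (b ∸ ℓ) ℤ.* + ((b ℕ.+ ℓ) C (2 ℕ.* ℓ)) ⟩ ℚ.* Cat ℓ) • r ^ (b ∸ ℓ))
  ⊖ ∑X≥ 1 (λ k → let j = b ℕ.+ k in
      ⟨ + ((2 ℕ.* j ∸ 1) C (j ℕ.+ b)) ⟩ • r ^ (b ℕ.+ j))

IsR : ℕ → FPS → Set
IsR b R = R 𝟏 ≡ 1ℚ × Z b R ≗ X 0

------------------------------------------------------------------------
-- The series R̂^{(b)}

B : (b p ℓ : ℕ) → ℤ
B b p ℓ =
  𝟙[ (p ≟ ℓ) ×-dec (ℓ ≟ b) ]
  ℤ.+ -1ℤ ℤ.^ (p ∸ ℓ) ℤ.* + ((p ℕ.+ ℓ ∸ 1) C (p ∸ ℓ))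
      ℤ.* 𝟙[ (ℓ ≤? p) ×-dec (b <? ℓ) ]

-- x_{b+k} = ∑_p x̂_p B_{p,b+k}; the terms with p < b + k are zero.
x-hat : (b k : ℕ) → FPS
x-hat b k = ∑X≥ 0 λ i → const ⟨ B b (b ℕ.+ i) (b ℕ.+ k) ⟩

-- R̂^{(b)} in terms of R = R^{(b)}.
hat : ℕ → FPS → FPS
hat b R = substitute (x-hat b) R ⊖ const 1ℚ

-- Coefficients of r^p in I(b,ℓ;r) and J(b;r).

I : (b ℓ : ℕ) → ℕ → ℚ
I b ℓ p =
  (∏< p λ m → (+ ℓ) ℤ.^ 2 ℤ.- (+ b ℤ.- + m) ℤ.^ 2) / (p ! ℕ.* p !)
  where instance _ = p !* p !≢0

J : (b : ℕ) → ℕ → ℚ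
J b zero        = 0ℚ
J b p@(suc p-1) =
  (-1ℤ ℤ.^ (p ℕ.+ 1) ℤ.* ∏< p-1 λ m → (+ b ℤ.- + m) ℤ.* (+ b ℤ.- + m ℤ.- 1ℤ))
    / (p ! ℕ.* p-1 !)
  where instance _ = p !* p-1 !≢0

Ẑ : ℕ → FPS → FPS
Ẑ b r = J b ∘ˢ r ⊖ ∑X≥ 0 λ k → I b (b ℕ.+ k) ∘ˢ r

IsẐRoot : ℕ → FPS → Set
IsẐRoot b S = S 𝟏 ≡ 0ℚ × Ẑ b S ≗ const 0ℚ

{-# OPTIONS --safe #-}

-- Write R = 1 + s.  By the binomial theorem both Z(R) = x_b and Ẑ(S) = 0
-- have the shape  c(s) = ∑_k X_k F_k(s)  with the same left-hand side
-- c = J(b; ·), the Taylor expansion at r = 1 of the x-free part of Z.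
-- Since c(s) = s + O(s²), such an equation is a fixed point problem which is
-- contracting for the degree and so has exactly one solution without
-- constant term.  The substitution is a ring homomorphism which turns the
-- coefficients F_k into ∑_k B_{ik} F_k, and these are I(b, b+i; ·).  The two
-- coefficient identities (for I and for J) are evaluations of iterated finite
-- differences of binomial coefficients, Δⁿ C(y, n+k) = C(y, k).

module Submission where

open import Defs
open import Algebra.Bundles using (CommutativeMonoid)
open import Data.Bool.Base using (if_then_else_)
open import Data.Empty using (⊥-elim)
open import Data.Integer.Base as ℤ using (ℤ; +_; -1ℤ; 0ℤ; 1ℤ)
import Data.Integer.Properties as ℤ
open import Data.List.Base using (List; []; _∷_; length; replicate)
open import Data.List.Properties using (≡-dec; length-replicate; length-++)
open import Data.Nat.Base as ℕ using (ℕ; zero; suc; _∸_; _≤_; _<_; z≤n; s≤s; _!; NonZero)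
open import Data.Nat.Combinatorics using (_C_; nCk+nC[k+1]≡[n+1]C[k+1]; nCk≡n!/k![n-k]!; k![n∸k]!∣n!; k>n⇒nCk≡0; nC1≡n)
open import Data.Nat.DivMod using (m/n*n≡m)
open import Data.Nat.ListAction using (sum)
import Data.Nat.Properties as ℕ
open import Data.Nat.Tactic.RingSolver using (solve-∀)
open import Data.Product using (_×_; _,_; ∃!)
open import Data.Rational.Base using (ℚ; 0ℚ; 1ℚ; _+_; _*_; _-_; -_; _/_; toℚᵘ)
open import Data.Rational.Properties
  using (+-assoc; +-comm; +-identityˡ; +-identityʳ; *-assoc; *-comm; *-identityˡ; *-identityʳ;
         *-zeroˡ; *-zeroʳ; *-distribˡ-+; *-distribʳ-+; neg-distribˡ-*; +-0-commutativeMonoid; 0/n≡0;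
         toℚᵘ-injective; toℚᵘ-homo-+; toℚᵘ-homo-*; toℚᵘ-homo‿-; toℚᵘ-fromℚᵘ)
open import Data.Rational.Solver using (module +-*-Solver)
import Data.Rational.Unnormalised.Base as ℚᵘ
import Data.Rational.Unnormalised.Properties as ℚᵘ
open import Data.Sum.Base using (_⊎_; inj₁; inj₂; [_,_]′)
open import Level using (0ℓ)
open import Relation.Binary.Bundles using (Setoid)
open import Relation.Binary.PropositionalEquality hiding (J)
import Relation.Binary.Reasoning.Setoid as ≈-Reasoning
open import Relation.Nullary using (¬_; Dec; yes; no)
open import Relation.Nullary.Decidable using (dec-true; dec-false; _×-dec_)
open import Algebra.Properties.CommutativeSemigroup (CommutativeMonoid.commutativeSemigroup +-0-commutativeMonoid)
  using (interchange)
open import Algebra.Properties.CommutativeSemigroup ℕ.+-commutativeSemigroup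
  using () renaming (interchange to ℕ-interchange)

-- Finite sums

-- The infinite sums `∑X≥` and `substitute` are cut off by bounds read from the monomial whose
-- coefficient is asked for. Such bounds vary inside a product and obstruct every exchange of sums.
-- Manipulations are therefore carried out modulo high degrees and late variables, with one pair of
-- bounds for all monomials, and equality of series is recovered by letting the bounds vary. The
-- expansion point r = 1 is forced: composition needs a series without constant term, and R has
-- constant term 1. With ℓ = b + n + 1, the factors of I are ℓ² - (b - m)² = (2b + 1 + n - m)(n + 1
-- + m), so its coefficient of r^q is C(2b+1+n, q) C(n+q, q). The second binomial is independent of
-- the summation index and comes out of the difference; the first is the value of the difference at
-- y = 2b + 1 + n. For b > 0, b times the coefficient of r^(p+1) in J is (-1)^p C(b, p+1) C(b, p), a
-- signed Narayana number times b. The polynomial part of Z acquires the form of a finite difference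
-- only after the same multiplication by b, so b = 0 is treated apart.

∑-cong : ∀ n {f g} → (∀ i → i < n → f i ≡ g i) → ∑< n f ≡ ∑< n g
∑-cong zero    e = refl
∑-cong (suc n) e = cong₂ _+_ (∑-cong n λ i i<n → e i (ℕ.m<n⇒m<1+n i<n)) (e n ℕ.≤-refl)

∑-zero : ∀ n {f} → (∀ i → i < n → f i ≡ 0ℚ) → ∑< n f ≡ 0ℚ
∑-zero zero    e = refl
∑-zero (suc n) e = cong₂ _+_ (∑-zero n λ i i<n → e i (ℕ.m<n⇒m<1+n i<n)) (e n ℕ.≤-refl)

∑-+ : ∀ n f g → ∑< n (λ i → f i + g i) ≡ ∑< n f + ∑< n g
∑-+ zero    f g = refl
∑-+ (suc n) f g = trans (cong (_+ (f n + g n)) (∑-+ n f g)) (interchange (∑< n f) (∑< n g) (f n) (g n))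

∑-*ˡ : ∀ n c f → c * ∑< n f ≡ ∑< n (λ i → c * f i)
∑-*ˡ zero    c f = *-zeroʳ c
∑-*ˡ (suc n) c f = trans (*-distribˡ-+ c (∑< n f) (f n)) (cong (_+ c * f n) (∑-*ˡ n c f))

∑-*ʳ : ∀ n c f → ∑< n f * c ≡ ∑< n (λ i → f i * c)
∑-*ʳ zero    c f = *-zeroˡ c
∑-*ʳ (suc n) c f = trans (*-distribʳ-+ c (∑< n f) (f n)) (cong (_+ f n * c) (∑-*ʳ n c f))

∑-swap : ∀ m n (h : ℕ → ℕ → ℚ) → ∑< m (λ i → ∑< n (h i)) ≡ ∑< n (λ j → ∑< m (λ i → h i j))
∑-swap zero    n h = sym (∑-zero n λ _ _ → refl)
∑-swap (suc m) n h = trans (cong (_+ ∑< n (h m)) (∑-swap m n h)) (sym (∑-+ n (λ j → ∑< m λ i → h i j) (h m)))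

∑-first : ∀ n f → ∑< (suc n) f ≡ f 0 + ∑< n (λ i → f (suc i))
∑-first zero    f = +-comm 0ℚ (f 0)
∑-first (suc n) f = trans (cong (_+ f (suc n)) (∑-first n f)) (+-assoc (f 0) (∑< n λ i → f (suc i)) (f (suc n)))

∑-reverse : ∀ n f → ∑≤ n f ≡ ∑≤ n (λ i → f (n ∸ i))
∑-reverse zero    f = refl
∑-reverse (suc n) f = begin
  ∑≤ n f + f (suc n)                    ≡⟨ +-comm (∑≤ n f) (f (suc n)) ⟩
  f (suc n) + ∑≤ n f                    ≡⟨ cong (λ t → f (suc n) + t) (∑-reverse n f) ⟩
  f (suc n) + ∑≤ n (λ i → f (n ∸ i))    ≡⟨ ∑-first (suc n) (λ i → f (suc n ∸ i)) ⟨
  ∑≤ (suc n) (λ i → f (suc n ∸ i))      ∎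
  where open ≡-Reasoning

∑-extend : ∀ {m n f} → m ≤ n → (∀ i → m ≤ i → i < n → f i ≡ 0ℚ) → ∑< n f ≡ ∑< m f
∑-extend {m} {n} m≤n e = go (ℕ.≤⇒≤′ m≤n) e
  where
  go : ∀ {n f} → m ℕ.≤′ n → (∀ i → m ≤ i → i < n → f i ≡ 0ℚ) → ∑< n f ≡ ∑< m f
  go ℕ.≤′-refl e = refl
  go {suc n} (ℕ.≤′-step p) e =
    trans (cong₂ _+_ (go p λ i m≤i i<n → e i m≤i (ℕ.m<n⇒m<1+n i<n)) (e n (ℕ.≤′⇒≤ p) ℕ.≤-refl)) (+-identityʳ _)

∑-single : ∀ {n k f} → k < n → (∀ i → i < n → i ≢ k → f i ≡ 0ℚ) → ∑< n f ≡ f k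
∑-single {n} {k} {f} k<n e = begin
  ∑< n f        ≡⟨ ∑-extend k<n (λ i k<i i<n → e i i<n (ℕ.>⇒≢ k<i)) ⟩
  ∑< k f + f k  ≡⟨ cong (_+ f k) (∑-zero k λ i i<k → e i (ℕ.<-trans i<k k<n) (ℕ.<⇒≢ i<k)) ⟩
  0ℚ + f k      ≡⟨ +-identityˡ _ ⟩
  f k           ∎
  where open ≡-Reasoning

-- Both sides run over the pairs with j + k ≤ n, by antidiagonals on the left and by rows on the
-- right. Passing from n to n + 1 adds the antidiagonal j + k = n + 1, which lengthens each row by
-- one entry.
∑-triangle : ∀ n (h : ℕ → ℕ → ℚ) →
  ∑≤ n (λ i → ∑≤ i λ j → h j (i ∸ j)) ≡ ∑≤ n (λ j → ∑≤ (n ∸ j) (h j))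
∑-triangle zero    h = refl
∑-triangle (suc n) h = begin
  lhs + (diag + h (suc n) (n ∸ n))
    ≡⟨ +-assoc lhs diag (h (suc n) (n ∸ n)) ⟨
  lhs + diag + h (suc n) (n ∸ n)
    ≡⟨ cong (λ t → t + diag + h (suc n) (n ∸ n)) (∑-triangle n h) ⟩
  ∑≤ n (λ j → ∑≤ (n ∸ j) (h j)) + diag + h (suc n) (n ∸ n)
    ≡⟨ cong₂ _+_ (∑-+ (suc n) (λ j → ∑≤ (n ∸ j) (h j)) (λ j → h j (suc n ∸ j))) last ⟨
  ∑≤ n (λ j → ∑≤ (n ∸ j) (h j) + h j (suc n ∸ j)) + ∑≤ (n ∸ n) (h (suc n))
    ≡⟨ cong (_+ ∑≤ (n ∸ n) (h (suc n))) (∑-cong (suc n) inner) ⟩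
  ∑≤ n (λ j → ∑≤ (suc n ∸ j) (h j)) + ∑≤ (n ∸ n) (h (suc n)) ∎
  where
  open ≡-Reasoning
  lhs diag : ℚ
  lhs  = ∑≤ n (λ i → ∑≤ i λ j → h j (i ∸ j))
  diag = ∑≤ n (λ j → h j (suc n ∸ j))
  inner : ∀ j → j < suc n → ∑≤ (n ∸ j) (h j) + h j (suc n ∸ j) ≡ ∑≤ (suc n ∸ j) (h j)
  inner j (s≤s j≤n) rewrite ℕ.+-∸-assoc 1 j≤n = refl
  last : ∑≤ (n ∸ n) (h (suc n)) ≡ h (suc n) (n ∸ n)
  last rewrite ℕ.n∸n≡0 n = +-identityˡ _

-- The square [0,d]² may be summed along its antidiagonals when the part
-- above the main antidiagonal vanishes.
∑-square : ∀ d (h : ℕ → ℕ → ℚ) → (∀ i j → d < i ℕ.+ j → h i j ≡ 0ℚ) →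
  ∑≤ d (λ n → ∑≤ n λ i → h i (n ∸ i)) ≡ ∑≤ d (λ i → ∑≤ d (h i))
∑-square d h z = trans (∑-triangle d h) (∑-cong (suc d) λ i i<1+d →
  sym (∑-extend (s≤s (ℕ.m∸n≤m d i)) λ j d∸i<j _ → z i j (lem i j d∸i<j)))
  where
  lem : ∀ i j → d ∸ i < j → d < i ℕ.+ j
  lem i j p = ℕ.≤-<-trans (ℕ.m≤n+m∸n d i) (ℕ.+-monoʳ-< i p)

-- The Cauchy product

-- `convolve` runs over the pairs β + γ = α without naming them. `Split` names them, so that
-- arguments about a single product of coefficients can use that degrees add up and that the three
-- lists have the same length.
data Split : (β γ α : List ℕ) → Set where
  []  : Split [] [] []
  _∷_ : ∀ {i n β γ α} → i ≤ n → Split β γ α → Split (i ∷ β) (n ∸ i ∷ γ) (n ∷ α)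

split-sum : ∀ {β γ α} → Split β γ α → sum β ℕ.+ sum γ ≡ sum α
split-sum []                        = refl
split-sum (_∷_ {i} {n} {β} {γ} p s) =
  trans (ℕ-interchange i (sum β) (n ∸ i) (sum γ)) (cong₂ ℕ._+_ (ℕ.m+[n∸m]≡n p) (split-sum s))

split-lengthˡ : ∀ {β γ α} → Split β γ α → length β ≡ length α
split-lengthˡ []      = refl
split-lengthˡ (_ ∷ s) = cong suc (split-lengthˡ s)

split-lengthʳ : ∀ {β γ α} → Split β γ α → length γ ≡ length α
split-lengthʳ []      = refl
split-lengthʳ (_ ∷ s) = cong suc (split-lengthʳ s)

convolve-cong : ∀ α {F F′ G G′ : List ℕ → ℚ} →
  (∀ {β γ} → Split β γ α → F β * G γ ≡ F′ β * G′ γ) → convolve F G α ≡ convolve F′ G′ α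
convolve-cong []      e = e []
convolve-cong (n ∷ α) e = ∑-cong (suc n) λ { i (s≤s i≤n) → convolve-cong α λ s → e (i≤n ∷ s) }

convolve-congˡ : ∀ α {F F′ : List ℕ → ℚ} G → F ≗ F′ → convolve F G α ≡ convolve F′ G α
convolve-congˡ α G e = convolve-cong α λ {β} {γ} _ → cong (_* G γ) (e β)

convolve-congʳ : ∀ α F {G G′ : List ℕ → ℚ} → G ≗ G′ → convolve F G α ≡ convolve F G′ α
convolve-congʳ α F e = convolve-cong α λ {β} {γ} _ → cong (F β *_) (e γ)

convolve-zero : ∀ α {F G : List ℕ → ℚ} →
  (∀ {β γ} → Split β γ α → F β * G γ ≡ 0ℚ) → convolve F G α ≡ 0ℚ
convolve-zero []      e = e []
convolve-zero (n ∷ α) e = ∑-zero (suc n) λ { i (s≤s i≤n) → convolve-zero α λ s → e (i≤n ∷ s) }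

convolve-comm : ∀ α F G → convolve F G α ≡ convolve G F α
convolve-comm []      F G = *-comm (F []) (G [])
convolve-comm (n ∷ α) F G = begin
  ∑≤ n (λ i → convolve (F ∘∷ i) (G ∘∷ (n ∸ i)) α)
    ≡⟨ ∑-reverse n (λ i → convolve (F ∘∷ i) (G ∘∷ (n ∸ i)) α) ⟩
  ∑≤ n (λ i → convolve (F ∘∷ (n ∸ i)) (G ∘∷ (n ∸ (n ∸ i))) α)
    ≡⟨ ∑-cong (suc n) (λ { i (s≤s i≤n) →
         trans (cong (λ j → convolve (F ∘∷ (n ∸ i)) (G ∘∷ j) α) (ℕ.m∸[m∸n]≡n i≤n))
               (convolve-comm α (F ∘∷ (n ∸ i)) (G ∘∷ i)) }) ⟩
  ∑≤ n (λ i → convolve (G ∘∷ i) (F ∘∷ (n ∸ i)) α) ∎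
  where
  open ≡-Reasoning
  _∘∷_ : (List ℕ → ℚ) → ℕ → List ℕ → ℚ
  (H ∘∷ i) β = H (i ∷ β)

convolve-+ʳ : ∀ α F G H → convolve F (λ γ → G γ + H γ) α ≡ convolve F G α + convolve F H α
convolve-+ʳ []      F G H = *-distribˡ-+ (F []) (G []) (H [])
convolve-+ʳ (n ∷ α) F G H = trans
  (∑-cong (suc n) λ i _ →
    convolve-+ʳ α (λ β → F (i ∷ β)) (λ γ → G (n ∸ i ∷ γ)) (λ γ → H (n ∸ i ∷ γ)))
  (∑-+ (suc n) (λ i → convolve (λ β → F (i ∷ β)) (λ γ → G (n ∸ i ∷ γ)) α)
               (λ i → convolve (λ β → F (i ∷ β)) (λ γ → H (n ∸ i ∷ γ)) α))

convolve-*ʳ : ∀ α c F G → convolve F (λ γ → c * G γ) α ≡ c * convolve F G α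
convolve-*ʳ []      c F G = begin
  F [] * (c * G [])  ≡⟨ *-assoc (F []) c (G []) ⟨
  F [] * c * G []    ≡⟨ cong (_* G []) (*-comm (F []) c) ⟩
  c * F [] * G []    ≡⟨ *-assoc c (F []) (G []) ⟩
  c * (F [] * G [])  ∎
  where open ≡-Reasoning
convolve-*ʳ (n ∷ α) c F G = trans
  (∑-cong (suc n) λ i _ → convolve-*ʳ α c (λ β → F (i ∷ β)) (λ γ → G (n ∸ i ∷ γ)))
  (sym (∑-*ˡ (suc n) c λ i → convolve (λ β → F (i ∷ β)) (λ γ → G (n ∸ i ∷ γ)) α))

convolve-∑ʳ : ∀ α n F (H : ℕ → List ℕ → ℚ) →
  convolve F (λ γ → ∑< n λ i → H i γ) α ≡ ∑< n (λ i → convolve F (H i) α)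
convolve-∑ʳ α zero    F H = convolve-zero α λ {β} _ → *-zeroʳ (F β)
convolve-∑ʳ α (suc n) F H = trans
  (convolve-+ʳ α F (λ γ → ∑< n λ i → H i γ) (H n))
  (cong (_+ convolve F (H n) α) (convolve-∑ʳ α n F H))

convolve-∑ˡ : ∀ α n (H : ℕ → List ℕ → ℚ) G →
  convolve (λ γ → ∑< n λ i → H i γ) G α ≡ ∑< n (λ i → convolve (H i) G α)
convolve-∑ˡ α n H G = begin
  convolve (λ γ → ∑< n λ i → H i γ) G α  ≡⟨ convolve-comm α (λ γ → ∑< n λ i → H i γ) G ⟩
  convolve G (λ γ → ∑< n λ i → H i γ) α  ≡⟨ convolve-∑ʳ α n G H ⟩
  ∑< n (λ i → convolve G (H i) α)        ≡⟨ ∑-cong n (λ i _ → convolve-comm α G (H i)) ⟩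
  ∑< n (λ i → convolve (H i) G α)        ∎
  where open ≡-Reasoning

convolve-assoc : ∀ α F G H → convolve (convolve F G) H α ≡ convolve F (convolve G H) α
convolve-assoc []      F G H = *-assoc (F []) (G []) (H [])
convolve-assoc (n ∷ α) F G H = begin
  ∑≤ n (λ i → convolve (λ β → ∑≤ i λ j → convolve (F ∘∷ j) (G ∘∷ (i ∸ j)) β) (H ∘∷ (n ∸ i)) α)
    ≡⟨ ∑-cong (suc n) (λ i _ →
         convolve-∑ˡ α (suc i) (λ j → convolve (F ∘∷ j) (G ∘∷ (i ∸ j))) (H ∘∷ (n ∸ i))) ⟩
  ∑≤ n (λ i → ∑≤ i λ j → convolve (convolve (F ∘∷ j) (G ∘∷ (i ∸ j))) (H ∘∷ (n ∸ i)) α)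
    ≡⟨ ∑-cong (suc n) (λ { i (s≤s i≤n) → ∑-cong (suc i) λ { j (s≤s j≤i) → step i j j≤i } }) ⟩
  ∑≤ n (λ i → ∑≤ i λ j → h j (i ∸ j))
    ≡⟨ ∑-triangle n h ⟩
  ∑≤ n (λ j → ∑≤ (n ∸ j) (h j))
    ≡⟨ ∑-cong (suc n) (λ j _ →
         convolve-∑ʳ α (suc (n ∸ j)) (F ∘∷ j) (λ k → convolve (G ∘∷ k) (H ∘∷ (n ∸ j ∸ k)))) ⟨
  ∑≤ n (λ j → convolve (F ∘∷ j) (λ γ → ∑≤ (n ∸ j) λ k → convolve (G ∘∷ k) (H ∘∷ (n ∸ j ∸ k)) γ) α) ∎
  where
  open ≡-Reasoning
  _∘∷_ : (List ℕ → ℚ) → ℕ → List ℕ → ℚ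
  (K ∘∷ i) β = K (i ∷ β)
  h : ℕ → ℕ → ℚ
  h j k = convolve (F ∘∷ j) (convolve (G ∘∷ k) (H ∘∷ (n ∸ j ∸ k))) α
  step : ∀ i j → j ≤ i → convolve (convolve (F ∘∷ j) (G ∘∷ (i ∸ j))) (H ∘∷ (n ∸ i)) α ≡ h j (i ∸ j)
  step i j j≤i = trans
    (convolve-assoc α (F ∘∷ j) (G ∘∷ (i ∸ j)) (H ∘∷ (n ∸ i)))
    (cong (λ k → convolve (F ∘∷ j) (convolve (G ∘∷ (i ∸ j)) (H ∘∷ k)) α)
      (sym (trans (ℕ.∸-+-assoc n j (i ∸ j)) (cong (n ∸_) (ℕ.m+[n∸m]≡n j≤i)))))

-- Monomials and exponent lists with trailing zeros

exps-cons-top : ∀ n α e → exps (cons n (top α e)) ≡ n ∷ exps (top α e)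
exps-cons-top zero    α e = refl
exps-cons-top (suc n) α e = refl

cons-top : ∀ n α e → cons n (top α e) ≡ top (n ∷ α) e
cons-top zero    α e = refl
cons-top (suc n) α e = refl

deg-cons : ∀ n m → deg (cons n m) ≡ n ℕ.+ deg m
deg-cons zero    𝟏         = refl
deg-cons (suc n) 𝟏         = refl
deg-cons n       (top α e) = cong sum (exps-cons-top n α e)

deg-mono : ∀ α → deg (mono α) ≡ sum α
deg-mono []      = refl
deg-mono (n ∷ α) = trans (deg-cons n (mono α)) (cong (n ℕ.+_) (deg-mono α))

width-cons : ∀ n m → width (cons n m) ≤ suc (width m)
width-cons zero    𝟏         = z≤n
width-cons (suc n) 𝟏         = ℕ.≤-refl
width-cons n       (top α e) = ℕ.≤-reflexive (cong length (exps-cons-top n α e))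

width-mono : ∀ α → width (mono α) ≤ length α
width-mono []      = z≤n
width-mono (n ∷ α) = ℕ.≤-trans (width-cons n (mono α)) (s≤s (width-mono α))

mono-exps : ∀ m → mono (exps m) ≡ m
mono-exps 𝟏         = refl
mono-exps (top α e) = go α
  where
  go : ∀ α → mono (exps (top α e)) ≡ top α e
  go []      = refl
  go (n ∷ α) = trans (cong (cons n) (go α)) (cons-top n α e)

mono-zeros : ∀ α → sum α ≡ 0 → mono α ≡ 𝟏
mono-zeros []         _ = refl
mono-zeros (zero ∷ α) e = cong (cons 0) (mono-zeros α e)

-- Reading a series on all exponent lists, trailing zeros included, gives functions on which the
-- laws of `convolve` hold by recursion on the list; they are then transported to `_⊗_`.
⌊_⌋ : FPS → List ℕ → ℚ
⌊ f ⌋ α = f (mono α)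

-- Trailing zeros do not affect the Cauchy product.
⊗-mono : ∀ f g α → (f ⊗ g) (mono α) ≡ convolve ⌊ f ⌋ ⌊ g ⌋ α
⊗-mono f g []      = refl
⊗-mono f g (n ∷ α) = trans (exps-cons n (mono α))
  (∑-cong (suc n) λ i _ → ⊗-mono (λ m → f (cons i m)) (λ m → g (cons (n ∸ i) m)) α)
  where
  exps-cons : ∀ n m → (f ⊗ g) (cons n m) ≡ convolve ⌊ f ⌋ ⌊ g ⌋ (n ∷ exps m)
  -- The one case in which a trailing zero is dropped: the extra exponent 0 adds a sum with the
  -- single term i = 0.
  exps-cons zero    𝟏         = sym (+-identityˡ _)
  exps-cons (suc n) 𝟏         = refl
  exps-cons n       (top α e) = cong (convolve ⌊ f ⌋ ⌊ g ⌋) (exps-cons-top n α e)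

⊗-cons : ∀ f g n m → (f ⊗ g) (cons n m) ≡ ∑≤ n (λ i → ((λ k → f (cons i k)) ⊗ (λ k → g (cons (n ∸ i) k))) m)
⊗-cons f g n m = begin
  (f ⊗ g) (cons n m)                         ≡⟨ cong (λ k → (f ⊗ g) (cons n k)) (mono-exps m) ⟨
  (f ⊗ g) (mono (n ∷ exps m))                ≡⟨ ⊗-mono f g (n ∷ exps m) ⟩
  convolve ⌊ f ⌋ ⌊ g ⌋ (n ∷ exps m)          ∎
  where open ≡-Reasoning

-- Truncation

∑<ˢ : ℕ → (ℕ → FPS) → FPS
∑<ˢ n F m = ∑< n λ i → F i m

const-cons-zero : ∀ c m → const c (cons 0 m) ≡ const c m
const-cons-zero c 𝟏         = refl
const-cons-zero c (top α e) = refl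

const-cons-suc : ∀ c n m → const c (cons (suc n) m) ≡ 0ℚ
const-cons-suc c n 𝟏         = refl
const-cons-suc c n (top α e) = refl

const-zero : ∀ m → const 0ℚ m ≡ 0ℚ
const-zero 𝟏         = refl
const-zero (top α e) = refl

convolve-const : ∀ c α G → convolve ⌊ const c ⌋ G α ≡ c * G α
convolve-const c []      G = refl
convolve-const c (n ∷ α) G = begin
  ∑≤ n term              ≡⟨ ∑-first n term ⟩
  term 0 + ∑< n (λ i → term (suc i))
    ≡⟨ cong₂ _+_ head (∑-zero n λ i _ → convolve-zero α λ {β} {γ} _ →
         trans (cong (_* G (n ∸ suc i ∷ γ)) (const-cons-suc c i (mono β))) (*-zeroˡ (G (n ∸ suc i ∷ γ)))) ⟩
  c * G (n ∷ α) + 0ℚ     ≡⟨ +-identityʳ _ ⟩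
  c * G (n ∷ α)          ∎
  where
  open ≡-Reasoning
  term : ℕ → ℚ
  term i = convolve (λ β → const c (mono (i ∷ β))) (λ γ → G (n ∸ i ∷ γ)) α
  head : term 0 ≡ c * G (n ∷ α)
  head = trans (convolve-congˡ α (λ γ → G (n ∷ γ)) (λ β → const-cons-zero c (mono β)))
               (convolve-const c α (λ γ → G (n ∷ γ)))

Order≥ : ℕ → FPS → Set
Order≥ p f = ∀ α → sum α < p → f (mono α) ≡ 0ℚ

order-1 : ∀ {f} → f 𝟏 ≡ 0ℚ → Order≥ 1 f
order-1 {f} e α (s≤s s≤0) = trans (cong f (mono-zeros α (ℕ.n≤0⇒n≡0 s≤0))) e

+-<-split : ∀ {a b p q} → a ℕ.+ b < p ℕ.+ q → a < p ⊎ b < q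
+-<-split {a} {b} {p} {q} lt with a ℕ.<? p
... | yes a<p = inj₁ a<p
... | no  a≮p = inj₂ (ℕ.+-cancelˡ-< p b q (ℕ.≤-<-trans (ℕ.+-monoˡ-≤ b (ℕ.≮⇒≥ a≮p)) lt))

order-⊗ : ∀ {p q} f g → Order≥ p f → Order≥ q g → Order≥ (p ℕ.+ q) (f ⊗ g)
order-⊗ {p} {q} f g of og α lt = trans (⊗-mono f g α) (convolve-zero α vanish)
  where
  vanish : ∀ {β γ} → Split β γ α → f (mono β) * g (mono γ) ≡ 0ℚ
  vanish {β} {γ} s with +-<-split {sum β} {sum γ} {p} {q} (subst (_< p ℕ.+ q) (sym (split-sum s)) lt)
  ... | inj₁ lt = trans (cong (_* g (mono γ)) (of β lt)) (*-zeroˡ (g (mono γ)))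
  ... | inj₂ lt = trans (cong (f (mono β) *_) (og γ lt)) (*-zeroʳ (f (mono β)))

order-^ : ∀ {f} p → f 𝟏 ≡ 0ℚ → Order≥ p (f ^ p)
order-^ zero    e α ()
order-^ {f} (suc p) e = order-⊗ {1} {p} f (f ^ p) (order-1 {f} e) (order-^ p e)

X-width : ∀ k m → width m ≤ k → X k m ≡ 0ℚ
X-width k 𝟏               _ = refl
X-width k (top α (suc e)) _ = refl
X-width k (top α zero)    p with ≡-dec ℕ._≟_ α (replicate k 0)
... | no  _    = refl
... | yes refl = ⊥-elim (ℕ.<-irrefl refl (subst (_≤ k) width-top p))
  where
  width-top : width (top (replicate k 0) 0) ≡ suc k
  width-top = trans (length-++ (replicate k 0))
                    (trans (ℕ.+-comm (length (replicate k 0)) 1) (cong suc (length-replicate k)))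

X-zero-cons-zero : ∀ m → X 0 (cons 0 m) ≡ 0ℚ
X-zero-cons-zero 𝟏               = refl
X-zero-cons-zero (top α zero)    = refl
X-zero-cons-zero (top α (suc e)) = refl

X-zero-cons-one : ∀ m → X 0 (cons 1 m) ≡ const 1ℚ m
X-zero-cons-one 𝟏               = refl
X-zero-cons-one (top α zero)    = refl
X-zero-cons-one (top α (suc e)) = refl

X-zero-cons-2+ : ∀ n m → X 0 (cons (suc (suc n)) m) ≡ 0ℚ
X-zero-cons-2+ n 𝟏               = refl
X-zero-cons-2+ n (top α zero)    = refl
X-zero-cons-2+ n (top α (suc e)) = refl

X-suc-cons-zero : ∀ k m → X (suc k) (cons 0 m) ≡ X k m
X-suc-cons-zero k 𝟏               = refl
X-suc-cons-zero k (top α zero)    with ≡-dec ℕ._≟_ α (replicate k 0)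
... | yes _ = refl
... | no  _ = refl
X-suc-cons-zero k (top α (suc e)) = refl

X-suc-cons-suc : ∀ k n m → X (suc k) (cons (suc n) m) ≡ 0ℚ
X-suc-cons-suc k zero    𝟏               = refl
X-suc-cons-suc k (suc n) 𝟏               = refl
X-suc-cons-suc k n       (top α zero)    = refl
X-suc-cons-suc k n       (top α (suc e)) = refl

X⊗-width : ∀ k f m → width m ≤ k → (X k ⊗ f) m ≡ 0ℚ
X⊗-width k f m p = convolve-zero (exps m) λ {β} {γ} s →
  trans (cong (_* f (mono γ)) (X-width k (mono β)
          (ℕ.≤-trans (width-mono β) (ℕ.≤-trans (ℕ.≤-reflexive (split-lengthˡ s)) p))))
        (*-zeroˡ (f (mono γ)))

-- Equality modulo the ideal generated by the monomials of degree > d and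
-- the variables X_k with k ≥ w; all infinite sums become finite modulo it.
module Truncated (w d : ℕ) where

  infix 4 _≈_
  record _≈_ (f g : FPS) : Set where
    constructor ≈-by
    -- Since trailing zeros are allowed, the lists of length exactly w represent all monomials in
    -- X_0, ..., X_{w-1}.
    field at : ∀ α → length α ≡ w → sum α ≤ d → f (mono α) ≡ g (mono α)
  open _≈_ public

  ≈-refl : ∀ {f} → f ≈ f
  ≈-refl .at _ _ _ = refl

  ≈-sym : ∀ {f g} → f ≈ g → g ≈ f
  ≈-sym e .at α l s = sym (at e α l s)

  ≈-trans : ∀ {f g h} → f ≈ g → g ≈ h → f ≈ h
  ≈-trans e e′ .at α l s = trans (at e α l s) (at e′ α l s)

  ≈-setoid : Setoid 0ℓ 0ℓ
  ≈-setoid = record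
    { Carrier = FPS ; _≈_ = _≈_
    ; isEquivalence = record { refl = ≈-refl ; sym = ≈-sym ; trans = ≈-trans } }

  ≗⇒≈ : ∀ {f g} → f ≗ g → f ≈ g
  ≗⇒≈ e .at α _ _ = e (mono α)

  ⊕-cong : ∀ {f f′ g g′} → f ≈ f′ → g ≈ g′ → f ⊕ g ≈ f′ ⊕ g′
  ⊕-cong e e′ .at α l s = cong₂ _+_ (at e α l s) (at e′ α l s)

  •-cong : ∀ c {f f′} → f ≈ f′ → c • f ≈ c • f′
  •-cong c e .at α l s = cong (c *_) (at e α l s)

  ∑ˢ-cong : ∀ n {F G} → (∀ i → i < n → F i ≈ G i) → ∑<ˢ n F ≈ ∑<ˢ n G
  ∑ˢ-cong n e .at α l s = ∑-cong n λ i i<n → at (e i i<n) α l s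

  ⊗-cong : ∀ {f f′ g g′} → f ≈ f′ → g ≈ g′ → f ⊗ g ≈ f′ ⊗ g′
  ⊗-cong {f} {f′} {g} {g′} e e′ .at α l s =
    trans (⊗-mono f g α) (trans (convolve-cong α step) (sym (⊗-mono f′ g′ α)))
    where
    step : ∀ {β γ} → Split β γ α → f (mono β) * g (mono γ) ≡ f′ (mono β) * g′ (mono γ)
    step {β} {γ} p = cong₂ _*_
      (at e  β (trans (split-lengthˡ p) l) (ℕ.≤-trans (ℕ.m≤m+n (sum β) (sum γ)) le))
      (at e′ γ (trans (split-lengthʳ p) l) (ℕ.≤-trans (ℕ.m≤n+m (sum γ) (sum β)) le))
      where
      le : sum β ℕ.+ sum γ ≤ d
      le = subst (_≤ d) (sym (split-sum p)) s

  ⊗-congˡ : ∀ f {g g′} → g ≈ g′ → f ⊗ g ≈ f ⊗ g′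
  ⊗-congˡ f = ⊗-cong (≈-refl {f})

  ⊗-congʳ : ∀ g {f f′} → f ≈ f′ → f ⊗ g ≈ f′ ⊗ g
  ⊗-congʳ g e = ⊗-cong e (≈-refl {g})

  ^-cong : ∀ {f g} n → f ≈ g → f ^ n ≈ g ^ n
  ^-cong zero    e = ≈-refl {const 1ℚ}
  ^-cong (suc n) e = ⊗-cong e (^-cong n e)

  ⊗-comm : ∀ f g → f ⊗ g ≈ g ⊗ f
  ⊗-comm f g .at α _ _ =
    trans (⊗-mono f g α) (trans (convolve-comm α ⌊ f ⌋ ⌊ g ⌋) (sym (⊗-mono g f α)))

  ⊗-assoc : ∀ f g h → (f ⊗ g) ⊗ h ≈ f ⊗ (g ⊗ h)
  ⊗-assoc f g h .at α _ _ = begin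
    ((f ⊗ g) ⊗ h) (mono α)                        ≡⟨ ⊗-mono (f ⊗ g) h α ⟩
    convolve ⌊ f ⊗ g ⌋ ⌊ h ⌋ α                    ≡⟨ convolve-congˡ α ⌊ h ⌋ (⊗-mono f g) ⟩
    convolve (convolve ⌊ f ⌋ ⌊ g ⌋) ⌊ h ⌋ α       ≡⟨ convolve-assoc α ⌊ f ⌋ ⌊ g ⌋ ⌊ h ⌋ ⟩
    convolve ⌊ f ⌋ (convolve ⌊ g ⌋ ⌊ h ⌋) α       ≡⟨ convolve-congʳ α ⌊ f ⌋ (⊗-mono g h) ⟨
    convolve ⌊ f ⌋ ⌊ g ⊗ h ⌋ α                    ≡⟨ ⊗-mono f (g ⊗ h) α ⟨
    (f ⊗ (g ⊗ h)) (mono α)                        ∎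
    where open ≡-Reasoning

  ⊗-distribˡ-⊕ : ∀ f g h → f ⊗ (g ⊕ h) ≈ f ⊗ g ⊕ f ⊗ h
  ⊗-distribˡ-⊕ f g h .at α _ _ = trans (⊗-mono f (g ⊕ h) α)
    (trans (convolve-+ʳ α ⌊ f ⌋ ⌊ g ⌋ ⌊ h ⌋) (cong₂ _+_ (sym (⊗-mono f g α)) (sym (⊗-mono f h α))))

  ⊗-distribʳ-⊕ : ∀ f g h → (g ⊕ h) ⊗ f ≈ g ⊗ f ⊕ h ⊗ f
  ⊗-distribʳ-⊕ f g h = ≈-trans (⊗-comm (g ⊕ h) f)
    (≈-trans (⊗-distribˡ-⊕ f g h) (⊕-cong (⊗-comm f g) (⊗-comm f h)))

  ⊗-•ʳ : ∀ c f g → f ⊗ (c • g) ≈ c • (f ⊗ g)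
  ⊗-•ʳ c f g .at α _ _ = trans (⊗-mono f (c • g) α)
    (trans (convolve-*ʳ α c ⌊ f ⌋ ⌊ g ⌋) (cong (c *_) (sym (⊗-mono f g α))))

  ⊗-•ˡ : ∀ c f g → (c • f) ⊗ g ≈ c • (f ⊗ g)
  ⊗-•ˡ c f g = ≈-trans (⊗-comm (c • f) g) (≈-trans (⊗-•ʳ c g f) (•-cong c (⊗-comm g f)))

  ⊗-∑ʳ : ∀ n f H → f ⊗ ∑<ˢ n H ≈ ∑<ˢ n (λ i → f ⊗ H i)
  ⊗-∑ʳ n f H .at α _ _ = trans (⊗-mono f (∑<ˢ n H) α)
    (trans (convolve-∑ʳ α n ⌊ f ⌋ (λ i → ⌊ H i ⌋)) (∑-cong n λ i _ → sym (⊗-mono f (H i) α)))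

  ⊗-∑ˡ : ∀ n H g → ∑<ˢ n H ⊗ g ≈ ∑<ˢ n (λ i → H i ⊗ g)
  ⊗-∑ˡ n H g = ≈-trans (⊗-comm (∑<ˢ n H) g)
    (≈-trans (⊗-∑ʳ n g H) (∑ˢ-cong n λ i _ → ⊗-comm g (H i)))

  const-⊗ : ∀ c g → const c ⊗ g ≈ c • g
  const-⊗ c g .at α _ _ = trans (⊗-mono (const c) g α) (convolve-const c α ⌊ g ⌋)

  ⊗-const : ∀ c g → g ⊗ const c ≈ c • g
  ⊗-const c g = ≈-trans (⊗-comm g (const c)) (const-⊗ c g)

  •-identity : ∀ f → 1ℚ • f ≈ f
  •-identity f .at α _ _ = *-identityˡ (f (mono α))

  ⊗-identityˡ : ∀ g → const 1ℚ ⊗ g ≈ g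
  ⊗-identityˡ g = ≈-trans (const-⊗ 1ℚ g) (•-identity g)

  ⊗-zeroˡ : ∀ {f} g → f ≈ const 0ℚ → f ⊗ g ≈ const 0ℚ
  ⊗-zeroˡ g e = ≈-trans (⊗-congʳ g e) (≈-trans (const-⊗ 0ℚ g)
    (≗⇒≈ λ m → trans (*-zeroˡ (g m)) (sym (const-zero m))))

  ⊗-zeroʳ : ∀ {g} f → g ≈ const 0ℚ → f ⊗ g ≈ const 0ℚ
  ⊗-zeroʳ {g} f e = ≈-trans (⊗-comm f g) (⊗-zeroˡ f e)

  ⊗-interchange : ∀ f g h k → (f ⊗ g) ⊗ (h ⊗ k) ≈ (f ⊗ h) ⊗ (g ⊗ k)
  ⊗-interchange f g h k = begin
    (f ⊗ g) ⊗ (h ⊗ k)  ≈⟨ ⊗-assoc f g (h ⊗ k) ⟩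
    f ⊗ (g ⊗ (h ⊗ k))  ≈⟨ ⊗-congˡ f (⊗-assoc g h k) ⟨
    f ⊗ ((g ⊗ h) ⊗ k)  ≈⟨ ⊗-congˡ f (⊗-congʳ k (⊗-comm g h)) ⟩
    f ⊗ ((h ⊗ g) ⊗ k)  ≈⟨ ⊗-congˡ f (⊗-assoc h g k) ⟩
    f ⊗ (h ⊗ (g ⊗ k))  ≈⟨ ⊗-assoc f h (g ⊗ k) ⟨
    (f ⊗ h) ⊗ (g ⊗ k)  ∎
    where open import Relation.Binary.Reasoning.Setoid ≈-setoid

  ^-+ : ∀ f i j → f ^ (i ℕ.+ j) ≈ f ^ i ⊗ f ^ j
  ^-+ f zero    j = ≈-sym (⊗-identityˡ (f ^ j))
  ^-+ f (suc i) j = ≈-trans (⊗-congˡ f (^-+ f i j)) (≈-sym (⊗-assoc f (f ^ i) (f ^ j)))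

  order>d⇒≈0 : ∀ {f} → Order≥ (suc d) f → f ≈ const 0ℚ
  order>d⇒≈0 o .at α _ s = trans (o α (s≤s s)) (sym (const-zero (mono α)))

  -- The terms with p > d start in degree above d. The cut no longer depends on the monomial, so
  -- products and substitutions can pass through the sum; the freedom in D lets two different
  -- precisions share one cut.
  ∘ˢ-truncate : ∀ {f D} c → f 𝟏 ≡ 0ℚ → d ≤ D → c ∘ˢ f ≈ ∑≤ˢ D (λ p → c p • f ^ p)
  ∘ˢ-truncate {f} {D} c e d≤D .at α _ s = sym (∑-extend
    (s≤s (ℕ.≤-trans (ℕ.≤-reflexive (deg-mono α)) (ℕ.≤-trans s d≤D)))
    λ p deg<p _ → trans (cong (c p *_) (order-^ {f} p e α (subst (_< p) (deg-mono α) deg<p))) (*-zeroʳ (c p)))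

  ∑X-truncate : ∀ F → ∑X≥ 0 F ≈ ∑<ˢ w (λ k → X k ⊗ F k)
  ∑X-truncate F .at α l _ = sym (∑-extend
    (subst (width (mono α) ≤_) l (width-mono α))
    λ k le _ → X⊗-width k (F k) (mono α) le)

-- The coefficient of m is already visible to the congruence with w = `width m` and d = `deg m`.
≗-by-truncation : ∀ {f g} → (∀ w d → Truncated._≈_ w d f g) → f ≗ g
≗-by-truncation {f} {g} e m = subst (λ k → f k ≡ g k) (mono-exps m)
  (Truncated.at (e (width m) (deg m)) (exps m) refl ℕ.≤-refl)

-- Substitution of linear forms

_∘cons_ : FPS → ℕ → FPS
(f ∘cons n) m = f (cons n m)

tail : (ℕ → FPS) → ℕ → FPS
tail L k = L (suc k)

-- The terms of  substitute L f  with exponent lists in the box [0,d]ʷ,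
-- summed one variable at a time.
T : (w d : ℕ) → (ℕ → FPS) → FPS → FPS
T zero    d L f = const (f 𝟏)
T (suc w) d L f = ∑≤ˢ d λ n → L 0 ^ n ⊗ T w d (tail L) (f ∘cons n)

convolve-∑Box : ∀ w d β F (a : List ℕ → ℚ) (g : List ℕ → List ℕ → ℚ) →
  convolve F (λ γ → ∑Box w d λ α → a α * g α γ) β ≡ ∑Box w d (λ α → a α * convolve F (g α) β)
convolve-∑Box zero    d β F a g = convolve-*ʳ β (a []) F (g [])
convolve-∑Box (suc w) d β F a g = trans
  (convolve-∑ʳ β (suc d) F (λ n γ → ∑Box w d λ α → a (n ∷ α) * g (n ∷ α) γ))
  (∑-cong (suc d) λ n _ → convolve-∑Box w d β F (λ α → a (n ∷ α)) (λ α → g (n ∷ α)))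

T-∑Box : ∀ w d L f m → T w d L f m ≡ ∑Box w d (λ α → f (mono α) * (L ^^ α) m)
T-∑Box zero    d L f 𝟏         = sym (*-identityʳ (f 𝟏))
T-∑Box zero    d L f (top α e) = sym (*-zeroʳ (f 𝟏))
T-∑Box (suc w) d L f m = ∑-cong (suc d) λ n _ → trans
  (convolve-congʳ (exps m) ⌊ L 0 ^ n ⌋ (λ γ → T-∑Box w d (tail L) (f ∘cons n) (mono γ)))
  (convolve-∑Box w d (exps m) ⌊ L 0 ^ n ⌋ (λ α → f (mono (n ∷ α))) (λ α → ⌊ tail L ^^ α ⌋))

module _ {v e : ℕ} where
  open Truncated v e
  open ≈-Reasoning ≈-setoid

  ∑ˢ-single : ∀ {n k F} → k < n → (∀ i → i < n → i ≢ k → F i ≈ const 0ℚ) → ∑<ˢ n F ≈ F k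
  ∑ˢ-single k<n z .at α l s = ∑-single k<n λ i i<n i≢k →
    trans (at (z i i<n i≢k) α l s) (const-zero (mono α))

  ∑ˢ-head : ∀ {n F} → (∀ i → F (suc i) ≈ const 0ℚ) → ∑≤ˢ n F ≈ F 0
  ∑ˢ-head {n} z = ∑ˢ-single {suc n} (s≤s z≤n) λ where
    zero    _ i≢0 → ⊥-elim (i≢0 refl)
    (suc i) _ _   → z i

  -- The box holds lists of length w with entries at most d, hence of degree at most w * d: this is
  -- the precision required of the source. The precision (v, e) of the result is independent of the
  -- box, because the recursion strips variables from the source only.
  T-cong : ∀ w d L {f g} → Truncated._≈_ w (w ℕ.* d) f g → T w d L f ≈ T w d L g
  T-cong zero    d L e = ≗⇒≈ λ m → cong (λ c → const c m) (Truncated.at e [] refl z≤n)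
  T-cong (suc w) d L {f} {g} e = ∑ˢ-cong (suc d) λ { n (s≤s n≤d) →
    ⊗-congˡ (L 0 ^ n) (T-cong w d (tail L) (Truncated.≈-by λ α l s →
      Truncated.at e (n ∷ α) (cong suc l) (ℕ.+-mono-≤ n≤d s))) }

  T-cong-≗ : ∀ w d L {f g} → f ≗ g → T w d L f ≈ T w d L g
  T-cong-≗ w d L e = T-cong w d L (Truncated.≗⇒≈ w (w ℕ.* d) e)

  T-⊕ : ∀ w d L f g → T w d L (f ⊕ g) ≈ T w d L f ⊕ T w d L g
  T-⊕ zero    d L f g = ≗⇒≈ λ { 𝟏 → refl ; (top _ _) → refl }
  T-⊕ (suc w) d L f g = begin
    ∑≤ˢ d (λ n → L 0 ^ n ⊗ T′ ((f ⊕ g) ∘cons n))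
      ≈⟨ ∑ˢ-cong (suc d) (λ n _ → ≈-trans
           (⊗-congˡ (L 0 ^ n) (T-⊕ w d (tail L) (f ∘cons n) (g ∘cons n)))
           (⊗-distribˡ-⊕ (L 0 ^ n) (T′ (f ∘cons n)) (T′ (g ∘cons n)))) ⟩
    ∑≤ˢ d (λ n → L 0 ^ n ⊗ T′ (f ∘cons n) ⊕ L 0 ^ n ⊗ T′ (g ∘cons n))
      ≈⟨ ≗⇒≈ (λ m → ∑-+ (suc d) (λ n → (L 0 ^ n ⊗ T′ (f ∘cons n)) m) (λ n → (L 0 ^ n ⊗ T′ (g ∘cons n)) m)) ⟩
    ∑≤ˢ d (λ n → L 0 ^ n ⊗ T′ (f ∘cons n)) ⊕ ∑≤ˢ d (λ n → L 0 ^ n ⊗ T′ (g ∘cons n)) ∎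
    where
    T′ : FPS → FPS
    T′ = T w d (tail L)

  T-• : ∀ w d L c f → T w d L (c • f) ≈ c • T w d L f
  T-• zero    d L c f = ≗⇒≈ λ { 𝟏 → refl ; (top _ _) → sym (*-zeroʳ c) }
  T-• (suc w) d L c f = begin
    ∑≤ˢ d (λ n → L 0 ^ n ⊗ T w d (tail L) ((c • f) ∘cons n))
      ≈⟨ ∑ˢ-cong (suc d) (λ n _ → ≈-trans
           (⊗-congˡ (L 0 ^ n) (T-• w d (tail L) c (f ∘cons n)))
           (⊗-•ʳ c (L 0 ^ n) (T w d (tail L) (f ∘cons n)))) ⟩
    ∑≤ˢ d (λ n → c • (L 0 ^ n ⊗ T w d (tail L) (f ∘cons n)))
      ≈⟨ ≗⇒≈ (λ m → sym (∑-*ˡ (suc d) c (λ n → (L 0 ^ n ⊗ T w d (tail L) (f ∘cons n)) m))) ⟩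
    c • ∑≤ˢ d (λ n → L 0 ^ n ⊗ T w d (tail L) (f ∘cons n)) ∎

  T-const : ∀ w d L c → T w d L (const c) ≈ const c
  T-const zero    d L c = ≈-refl
  T-const (suc w) d L c = begin
    ∑≤ˢ d (λ n → L 0 ^ n ⊗ T w d (tail L) (const c ∘cons n))
      ≈⟨ ∑ˢ-head {d} (λ n → ⊗-zeroʳ (L 0 ^ suc n) (≈-trans
           (T-cong-≗ w d (tail L) λ m → trans (const-cons-suc c n m) (sym (const-zero m)))
           (T-const w d (tail L) 0ℚ))) ⟩
    const 1ℚ ⊗ T w d (tail L) (const c ∘cons 0)
      ≈⟨ ⊗-identityˡ (T w d (tail L) (const c ∘cons 0)) ⟩
    T w d (tail L) (const c ∘cons 0)
      ≈⟨ T-cong-≗ w d (tail L) (const-cons-zero c) ⟩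
    T w d (tail L) (const c)
      ≈⟨ T-const w d (tail L) c ⟩
    const c ∎

  T-zero : ∀ w d L {f} → (∀ m → f m ≡ 0ℚ) → T w d L f ≈ const 0ℚ
  T-zero w d L z = ≈-trans (T-cong-≗ w d L λ m → trans (z m) (sym (const-zero m))) (T-const w d L 0ℚ)

  T-∑ : ∀ w d L n F → T w d L (∑<ˢ n F) ≈ ∑<ˢ n (λ i → T w d L (F i))
  T-∑ w d L zero    F = ≈-trans (T-zero w d L λ _ → refl) (≗⇒≈ const-zero)
  T-∑ w d L (suc n) F = ≈-trans (T-⊕ w d L (∑<ˢ n F) (F n))
    (⊕-cong {g = T w d L (F n)} (T-∑ w d L n F) ≈-refl)

  -- For n > e the power `L 0 ^ n` has order above the precision e, so the larger box adds nothing.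
  T-degree : ∀ w d L f → (∀ k → L k 𝟏 ≡ 0ℚ) → e ≤ d → T w d L f ≈ T w e L f
  T-degree zero    d L f L0 e≤d = ≈-refl
  T-degree (suc w) d L f L0 e≤d = ≈-trans
    (∑ˢ-cong (suc d) λ n _ → ⊗-congˡ (L 0 ^ n) (T-degree w d (tail L) (f ∘cons n) (λ k → L0 (suc k)) e≤d))
    (≈-by λ α l s → ∑-extend (s≤s e≤d) λ n e<n _ → trans
      (at (⊗-zeroˡ (T w e (tail L) (f ∘cons n))
        (order>d⇒≈0 {L 0 ^ n} λ β lt → order-^ {L 0} n (L0 0) β (ℕ.<-≤-trans lt e<n))) α l s)
      (const-zero (mono α)))

  -- A variable that is replaced by 0 contributes only through its exponent 0.
  T-width : ∀ u w d L f → u ≤ w → (∀ k → u ≤ k → L k ≈ const 0ℚ) → T w d L f ≈ T u d L f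
  T-width zero    zero    d L f _ z = ≈-refl
  T-width zero    (suc w) d L f _ z = ≈-trans
    (∑ˢ-head {d} λ n → ⊗-zeroˡ (T w d (tail L) (f ∘cons suc n)) (⊗-zeroˡ (L 0 ^ n) (z 0 z≤n)))
    (≈-trans (⊗-identityˡ (T w d (tail L) (f ∘cons 0)))
      (T-width zero w d (tail L) (f ∘cons 0) z≤n λ k _ → z (suc k) z≤n))
  T-width (suc u) (suc w) d L f (s≤s u≤w) z = ∑ˢ-cong (suc d) λ n _ →
    ⊗-congˡ (L 0 ^ n) (T-width u w d (tail L) (f ∘cons n) u≤w λ k u≤k → z (suc k) (s≤s u≤k))

module _ {v d : ℕ} where
  open Truncated v d
  open ≈-Reasoning ≈-setoid

  -- On the left the total exponent i + j of the first variable is at most d, on the right i and j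
  -- are bounded separately. The surplus terms have i + j > d and contain `L 0 ^ i ⊗ L 0 ^ j`, of
  -- order above d. Multiplicativity therefore holds only modulo degrees above d, and the precision
  -- is tied to the size of the box.
  T-⊗ : ∀ w L f g → (∀ k → L k 𝟏 ≡ 0ℚ) → T w d L (f ⊗ g) ≈ T w d L f ⊗ T w d L g
  T-⊗ zero    L f g L0 = ≈-trans
    (≗⇒≈ λ { 𝟏 → refl ; (top _ _) → sym (*-zeroʳ (f 𝟏)) })
    (≈-sym (const-⊗ (f 𝟏) (const (g 𝟏))))
  T-⊗ (suc w) L f g L0 = begin
    ∑≤ˢ d (λ n → L 0 ^ n ⊗ T′ ((f ⊗ g) ∘cons n))
      ≈⟨ ∑ˢ-cong (suc d) (λ n _ → expand n) ⟩
    ∑≤ˢ d (λ n → ∑≤ˢ n λ i → h i (n ∸ i))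
      ≈⟨ ≈-by (λ α _ s → ∑-square d (λ i j → h i j (mono α)) λ i j d<i+j →
           h-order i j α (ℕ.≤-<-trans s d<i+j)) ⟩
    ∑≤ˢ d (λ i → ∑≤ˢ d λ j → A f i ⊗ A g j)
      ≈⟨ ∑ˢ-cong (suc d) (λ i _ → ⊗-∑ʳ (suc d) (A f i) (A g)) ⟨
    ∑≤ˢ d (λ i → A f i ⊗ ∑≤ˢ d (A g))
      ≈⟨ ⊗-∑ˡ (suc d) (A f) (∑≤ˢ d (A g)) ⟨
    ∑≤ˢ d (A f) ⊗ ∑≤ˢ d (A g) ∎
    where
    T′ : FPS → FPS
    T′ = T w d (tail L)
    A : FPS → ℕ → FPS
    A k n = L 0 ^ n ⊗ T′ (k ∘cons n)
    h : ℕ → ℕ → FPS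
    h i j = A f i ⊗ A g j
    A-order : ∀ k n → Order≥ n (A k n)
    A-order k n = subst (λ p → Order≥ p (A k n)) (ℕ.+-identityʳ n)
      (order-⊗ {n} {0} (L 0 ^ n) (T′ (k ∘cons n)) (order-^ {L 0} n (L0 0)) (λ _ ()))
    h-order : ∀ i j → Order≥ (i ℕ.+ j) (h i j)
    h-order i j = order-⊗ {i} {j} (A f i) (A g j) (A-order f i) (A-order g j)
    term : ∀ n i → i ≤ n → L 0 ^ n ⊗ T′ ((f ∘cons i) ⊗ (g ∘cons (n ∸ i))) ≈ h i (n ∸ i)
    term n i i≤n = begin
      L 0 ^ n ⊗ T′ ((f ∘cons i) ⊗ (g ∘cons (n ∸ i)))
        ≈⟨ ⊗-congˡ (L 0 ^ n) (T-⊗ w (tail L) (f ∘cons i) (g ∘cons (n ∸ i)) (λ k → L0 (suc k))) ⟩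
      L 0 ^ n ⊗ (T′ (f ∘cons i) ⊗ T′ (g ∘cons (n ∸ i)))
        ≡⟨ cong (λ k → L 0 ^ k ⊗ (T′ (f ∘cons i) ⊗ T′ (g ∘cons (n ∸ i)))) (ℕ.m+[n∸m]≡n i≤n) ⟨
      L 0 ^ (i ℕ.+ (n ∸ i)) ⊗ (T′ (f ∘cons i) ⊗ T′ (g ∘cons (n ∸ i)))
        ≈⟨ ⊗-congʳ (T′ (f ∘cons i) ⊗ T′ (g ∘cons (n ∸ i))) (^-+ (L 0) i (n ∸ i)) ⟩
      (L 0 ^ i ⊗ L 0 ^ (n ∸ i)) ⊗ (T′ (f ∘cons i) ⊗ T′ (g ∘cons (n ∸ i)))
        ≈⟨ ⊗-interchange (L 0 ^ i) (L 0 ^ (n ∸ i)) (T′ (f ∘cons i)) (T′ (g ∘cons (n ∸ i))) ⟩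
      h i (n ∸ i) ∎
    expand : ∀ n → L 0 ^ n ⊗ T′ ((f ⊗ g) ∘cons n) ≈ ∑≤ˢ n (λ i → h i (n ∸ i))
    expand n = begin
      L 0 ^ n ⊗ T′ ((f ⊗ g) ∘cons n)
        ≈⟨ ⊗-congˡ (L 0 ^ n) (T-cong-≗ w d (tail L) (⊗-cons f g n)) ⟩
      L 0 ^ n ⊗ T′ (∑≤ˢ n λ i → (f ∘cons i) ⊗ (g ∘cons (n ∸ i)))
        ≈⟨ ⊗-congˡ (L 0 ^ n) (T-∑ w d (tail L) (suc n) (λ i → (f ∘cons i) ⊗ (g ∘cons (n ∸ i)))) ⟩
      L 0 ^ n ⊗ ∑≤ˢ n (λ i → T′ ((f ∘cons i) ⊗ (g ∘cons (n ∸ i))))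
        ≈⟨ ⊗-∑ʳ (suc n) (L 0 ^ n) (λ i → T′ ((f ∘cons i) ⊗ (g ∘cons (n ∸ i)))) ⟩
      ∑≤ˢ n (λ i → L 0 ^ n ⊗ T′ ((f ∘cons i) ⊗ (g ∘cons (n ∸ i))))
        ≈⟨ ∑ˢ-cong (suc n) (λ { i (s≤s i≤n) → term n i i≤n }) ⟩
      ∑≤ˢ n (λ i → h i (n ∸ i)) ∎

  T-^ : ∀ w L f n → (∀ k → L k 𝟏 ≡ 0ℚ) → T w d L (f ^ n) ≈ T w d L f ^ n
  T-^ w L f zero    L0 = T-const w d L 1ℚ
  T-^ w L f (suc n) L0 = ≈-trans (T-⊗ w L f (f ^ n) L0) (⊗-congˡ (T w d L f) (T-^ w L f n L0))

module _ {v : ℕ} where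

  -- For d = 0 the box misses the exponent 1 of `X 0`. Both sides are then 0 at this precision,
  -- because `L 0` has no constant term.
  T-X-zero : ∀ w d L → (∀ k → L k 𝟏 ≡ 0ℚ) → Truncated._≈_ v d (T (suc w) d L (X 0)) (L 0)
  T-X-zero w zero L L0 = begin
    ∑≤ˢ 0 (λ n → L 0 ^ n ⊗ T w 0 (tail L) (X 0 ∘cons n))
      ≈⟨ ∑ˢ-single {n = 1} {F = λ n → L 0 ^ n ⊗ T w 0 (tail L) (X 0 ∘cons n)} (s≤s z≤n) (λ { zero _ q → ⊥-elim (q refl) ; (suc i) (s≤s ()) _ }) ⟩
    const 1ℚ ⊗ T w 0 (tail L) (X 0 ∘cons 0)
      ≈⟨ ⊗-zeroʳ (const 1ℚ) (T-zero w 0 (tail L) X-zero-cons-zero) ⟩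
    const 0ℚ
      ≈⟨ order>d⇒≈0 (order-1 {L 0} (L0 0)) ⟨
    L 0 ∎
    where
    open Truncated v 0
    open ≈-Reasoning ≈-setoid
  T-X-zero w (suc d) L L0 = begin
    ∑≤ˢ (suc d) (λ n → L 0 ^ n ⊗ T w (suc d) (tail L) (X 0 ∘cons n))
      ≈⟨ ∑ˢ-single {n = suc (suc d)} {F = λ n → L 0 ^ n ⊗ T w (suc d) (tail L) (X 0 ∘cons n)} (s≤s (s≤s z≤n)) (λ where
           zero          _ _ → ⊗-zeroʳ (const 1ℚ) (T-zero w (suc d) (tail L) X-zero-cons-zero)
           (suc zero)    _ q → ⊥-elim (q refl)
           (suc (suc n)) _ _ → ⊗-zeroʳ (L 0 ^ suc (suc n)) (T-zero w (suc d) (tail L) (X-zero-cons-2+ n))) ⟩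
    (L 0 ⊗ const 1ℚ) ⊗ T w (suc d) (tail L) (X 0 ∘cons 1)
      ≈⟨ ⊗-cong (≈-trans (⊗-const 1ℚ (L 0)) (•-identity (L 0)))
           (≈-trans (T-cong-≗ w (suc d) (tail L) X-zero-cons-one) (T-const w (suc d) (tail L) 1ℚ)) ⟩
    L 0 ⊗ const 1ℚ
      ≈⟨ ≈-trans (⊗-const 1ℚ (L 0)) (•-identity (L 0)) ⟩
    L 0 ∎
    where
    open Truncated v (suc d)
    open ≈-Reasoning ≈-setoid

  T-X : ∀ w d L k → (∀ k → L k 𝟏 ≡ 0ℚ) → k < w → Truncated._≈_ v d (T w d L (X k)) (L k)
  T-X (suc w) d L zero    L0 _         = T-X-zero w d L L0
  T-X (suc w) d L (suc k) L0 (s≤s k<w) = begin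
    ∑≤ˢ d (λ n → L 0 ^ n ⊗ T w d (tail L) (X (suc k) ∘cons n))
      ≈⟨ ∑ˢ-head {n = d} {F = λ n → L 0 ^ n ⊗ T w d (tail L) (X (suc k) ∘cons n)} (λ n →
           ⊗-zeroʳ (L 0 ^ suc n) (T-zero w d (tail L) (X-suc-cons-suc k n))) ⟩
    const 1ℚ ⊗ T w d (tail L) (X (suc k) ∘cons 0)
      ≈⟨ ⊗-identityˡ (T w d (tail L) (X (suc k) ∘cons 0)) ⟩
    T w d (tail L) (X (suc k) ∘cons 0)
      ≈⟨ T-cong-≗ w d (tail L) (X-suc-cons-zero k) ⟩
    T w d (tail L) (X k)
      ≈⟨ T-X w d (tail L) k (λ j → L0 (suc j)) k<w ⟩
    L (suc k) ∎
    where
    open Truncated v d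
    open ≈-Reasoning ≈-setoid

module Substitution (L : ℕ → FPS) (L0 : ∀ k → L k 𝟏 ≡ 0ℚ)
                    (L-triangular : ∀ w d k → w ≤ k → Truncated._≈_ w d (L k) (const 0ℚ)) where

  module _ {w d : ℕ} where
    open Truncated w d
    open ≈-Reasoning ≈-setoid

    -- `substitute` chooses its box from the monomial. By `T-degree` and `T-width` a larger box
    -- gives the same coefficient, so a single box serves all monomials at precision (w, d) and the
    -- laws of `T` carry over.
    substitute≈T : ∀ f → substitute L f ≈ T w d L f
    substitute≈T f .at α l s = trans (sym (T-∑Box u e L f m)) (sym at-m)
      where
      m : Monomial
      m = mono α
      u e : ℕ
      u = width m
      e = deg m
      open Truncated u e using () renaming (at to at′; ≈-trans to ≈-trans′)
      at-m : T w d L f m ≡ T u e L f m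
      at-m = subst (λ k → T w d L f k ≡ T u e L f k) (mono-exps m)
        (at′ (≈-trans′ (T-degree w d L f L0 (subst (_≤ d) (sym (deg-mono α)) s))
                       (T-width u w e L f (subst (u ≤_) l (width-mono α)) (L-triangular u e)))
             (exps m) refl ℕ.≤-refl)

    substitute-cong : ∀ {f g} → f ≗ g → substitute L f ≈ substitute L g
    substitute-cong {f} {g} e = ≈-trans (substitute≈T f) (≈-trans (T-cong-≗ w d L e) (≈-sym (substitute≈T g)))

    substitute-⊕ : ∀ f g → substitute L (f ⊕ g) ≈ substitute L f ⊕ substitute L g
    substitute-⊕ f g = ≈-trans (substitute≈T (f ⊕ g))
      (≈-trans (T-⊕ w d L f g) (≈-sym (⊕-cong (substitute≈T f) (substitute≈T g))))

    substitute-const : ∀ c → substitute L (const c) ≈ const c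
    substitute-const c = ≈-trans (substitute≈T (const c)) (T-const w d L c)

    substitute-∑X : ∀ F → substitute L (∑X≥ 0 F) ≈ ∑<ˢ w (λ k → L k ⊗ substitute L (F k))
    substitute-∑X F = begin
      substitute L (∑X≥ 0 F)
        ≈⟨ substitute≈T (∑X≥ 0 F) ⟩
      T w d L (∑X≥ 0 F)
        ≈⟨ T-cong w d L (Truncated.∑X-truncate w (w ℕ.* d) F) ⟩
      T w d L (∑<ˢ w λ k → X k ⊗ F k)
        ≈⟨ T-∑ w d L w (λ k → X k ⊗ F k) ⟩
      ∑<ˢ w (λ k → T w d L (X k ⊗ F k))
        ≈⟨ ∑ˢ-cong w (λ k k<w → ≈-trans (T-⊗ w L (X k) (F k) L0)
             (⊗-cong (T-X w d L k L0 k<w) (≈-sym (substitute≈T (F k))))) ⟩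
      ∑<ˢ w (λ k → L k ⊗ substitute L (F k)) ∎

    substitute-∘ˢ : ∀ c s → s 𝟏 ≡ 0ℚ → substitute L (c ∘ˢ s) ≈ c ∘ˢ substitute L s
    substitute-∘ˢ c s s0 = begin
      substitute L (c ∘ˢ s)
        ≈⟨ substitute≈T (c ∘ˢ s) ⟩
      T w d L (c ∘ˢ s)
        ≈⟨ T-cong w d L (Truncated.∘ˢ-truncate w (w ℕ.* d) c s0 (ℕ.m≤n+m (w ℕ.* d) d)) ⟩
      T w d L (∑≤ˢ D λ p → c p • s ^ p)
        ≈⟨ T-∑ w d L (suc D) (λ p → c p • s ^ p) ⟩
      ∑≤ˢ D (λ p → T w d L (c p • s ^ p))
        ≈⟨ ∑ˢ-cong (suc D) (λ p _ → ≈-trans (T-• w d L (c p) (s ^ p)) (•-cong (c p)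
             (≈-trans (T-^ w L s p L0) (^-cong p (≈-sym (substitute≈T s)))))) ⟩
      ∑≤ˢ D (λ p → c p • substitute L s ^ p)
        -- The box of the monomial 1 has width 0 and holds only the empty list; hence the constant
        -- term after substitution is `s 𝟏 * 1ℚ`.
        ≈⟨ ∘ˢ-truncate c (trans (*-identityʳ (s 𝟏)) s0) (ℕ.m≤m+n d (w ℕ.* d)) ⟨
      c ∘ˢ substitute L s ∎
      where
      D : ℕ
      -- Large enough for both cuts: `T-cong` reads the source up to degree w * d, the result is
      -- needed up to degree d.
      D = d ℕ.+ w ℕ.* d

-- Solving c(s) = ∑ X_k F_k(s)

⊗-identityʳ : ∀ f → f ⊗ const 1ℚ ≗ f
⊗-identityʳ f = ≗-by-truncation λ w d →
  let open Truncated w d in ≈-trans (⊗-const 1ℚ f) (•-identity f)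

-- The degree filtration alone, with no bound on the variables; its index measures the progress of
-- the fixed point iteration.
Agree : ℕ → FPS → FPS → Set
Agree n f g = ∀ m → deg m < n → f m ≡ g m

agree-mono : ∀ {n f g} → Agree n f g → ∀ α → sum α < n → f (mono α) ≡ g (mono α)
agree-mono {n} e α lt = e (mono α) (subst (_< n) (sym (deg-mono α)) lt)

agree-⊗ : ∀ {n f f′ g g′} → Agree n f f′ → Agree n g g′ → Agree n (f ⊗ g) (f′ ⊗ g′)
agree-⊗ {n} {f} {f′} {g} {g′} e e′ m lt = convolve-cong (exps m) λ {β} {γ} s →
  let lt′ = subst (_< n) (sym (split-sum s)) lt in
  cong₂ _*_ (agree-mono {n} {f} {f′} e β (ℕ.≤-<-trans (ℕ.m≤m+n (sum β) (sum γ)) lt′))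
            (agree-mono {n} {g} {g′} e′ γ (ℕ.≤-<-trans (ℕ.m≤n+m (sum γ) (sum β)) lt′))

-- A factor without constant term raises the precision of the other factor by one.
agree-⊗-suc : ∀ {n f f′ g g′} → f 𝟏 ≡ 0ℚ → f′ 𝟏 ≡ 0ℚ →
  (∀ β γ → sum β ℕ.+ sum γ ≤ n → 0 < sum β → f (mono β) * g (mono γ) ≡ f′ (mono β) * g′ (mono γ)) →
  Agree (suc n) (f ⊗ g) (f′ ⊗ g′)
agree-⊗-suc {n} {f} {f′} {g} {g′} f0 f′0 e m (s≤s deg≤n) = convolve-cong (exps m) step
  where
  step : ∀ {β γ} → Split β γ (exps m) → f (mono β) * g (mono γ) ≡ f′ (mono β) * g′ (mono γ)
  step {β} {γ} s with sum β in eq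
  ... | suc k = e β γ (subst (_≤ n) (sym (split-sum s)) deg≤n) (subst (0 <_) (sym eq) (s≤s z≤n))
  ... | zero  rewrite mono-zeros β eq | f0 | f′0 = trans (*-zeroˡ (g (mono γ))) (sym (*-zeroˡ (g′ (mono γ))))

agree-X⊗ : ∀ {n g g′} k → Agree n g g′ → Agree (suc n) (X k ⊗ g) (X k ⊗ g′)
agree-X⊗ {n} {g} {g′} k e = agree-⊗-suc {n} {X k} {X k} {g} {g′} refl refl λ β γ le pos →
  cong (X k (mono β) *_) (agree-mono {n} {g} {g′} e γ (ℕ.<-≤-trans (ℕ.+-monoˡ-< (sum γ) pos) le))

-- In degree at most n, both factors enter with positive degree, hence each with degree below n.
-- This gives every power with exponent at least 2 one more correct degree.
agree-⊗-nilpotent : ∀ {n f f′ g g′} → f 𝟏 ≡ 0ℚ → f′ 𝟏 ≡ 0ℚ → g 𝟏 ≡ 0ℚ → g′ 𝟏 ≡ 0ℚ →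
  Agree n f f′ → Agree n g g′ → Agree (suc n) (f ⊗ g) (f′ ⊗ g′)
agree-⊗-nilpotent {n} {f} {f′} {g} {g′} f0 f′0 g0 g′0 e e′ =
  agree-⊗-suc {n} {f} {f′} {g} {g′} f0 f′0 step
  where
  step : ∀ β γ → sum β ℕ.+ sum γ ≤ n → 0 < sum β → f (mono β) * g (mono γ) ≡ f′ (mono β) * g′ (mono γ)
  step β γ le pos with sum γ in eq
  ... | zero  rewrite mono-zeros γ eq | g0 | g′0 = trans (*-zeroʳ (f (mono β))) (sym (*-zeroʳ (f′ (mono β))))
  ... | suc k = cong₂ _*_
    (agree-mono {n} {f} {f′} e β (ℕ.<-≤-trans (ℕ.m<m+n (sum β) (s≤s z≤n)) le))
    (agree-mono {n} {g} {g′} e′ γ (ℕ.<-≤-trans (subst (_< sum β ℕ.+ suc k) (sym eq) (ℕ.+-monoˡ-< (suc k) pos)) le))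

agree-^ : ∀ {n f g} p → Agree n f g → Agree n (f ^ p) (g ^ p)
agree-^ zero    e m _ = refl
agree-^ {n} {f} {g} (suc p) e = agree-⊗ {n} {f} {g} {f ^ p} {g ^ p} e (agree-^ {n} {f} {g} p e)

^-suc-𝟏 : ∀ {f} p → f 𝟏 ≡ 0ℚ → (f ^ suc p) 𝟏 ≡ 0ℚ
^-suc-𝟏 {f} p f0 = trans (cong (_* (f ^ p) 𝟏) f0) (*-zeroˡ ((f ^ p) 𝟏))

agree-^-suc : ∀ {n f g} p → f 𝟏 ≡ 0ℚ → g 𝟏 ≡ 0ℚ → Agree n f g → Agree (suc n) (f ^ suc (suc p)) (g ^ suc (suc p))
agree-^-suc {n} {f} {g} p f0 g0 e =
  agree-⊗-nilpotent {n} {f} {g} {f ^ suc p} {g ^ suc p} f0 g0 (^-suc-𝟏 {f} p f0) (^-suc-𝟏 {g} p g0)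
    e (agree-^ {n} {f} {g} (suc p) e)

agree-∘ˢ : ∀ {n f g} c → Agree n f g → Agree n (c ∘ˢ f) (c ∘ˢ g)
agree-∘ˢ {n} {f} {g} c e m lt = ∑-cong (suc (deg m)) λ p _ → cong (c p *_) (agree-^ {n} {f} {g} p e m lt)

record Solves (c : ℕ → ℚ) (F : ℕ → ℕ → ℚ) (s : FPS) : Set where
  field
    constant-term : s 𝟏 ≡ 0ℚ
    equation      : c ∘ˢ s ≗ ∑X≥ 0 (λ k → F k ∘ˢ s)

module Solution (c : ℕ → ℚ) (c0 : c 0 ≡ 0ℚ) (c1 : c 1 ≡ 1ℚ) (F : ℕ → ℕ → ℚ) where
  open Solves
  open ≡-Reasoning

  rhs : FPS → FPS
  rhs s = ∑X≥ 0 λ k → F k ∘ˢ s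

  -- c ∘ˢ s = s + O(s²), so a solution is a fixed point of Φ and Φ is contracting.
  Φ : FPS → FPS
  Φ s = s ⊖ c ∘ˢ s ⊕ rhs s

  nonlinear : FPS → FPS
  nonlinear s m = ∑< (deg m) λ p → c (suc (suc p)) * (s ^ suc (suc p)) m

  ∘ˢ-linear-part : ∀ {s} → s 𝟏 ≡ 0ℚ → ∀ m → (c ∘ˢ s) m ≡ s m + nonlinear s m
  ∘ˢ-linear-part {s} s0 m = begin
    -- One vanishing term is appended first, so that the terms p = 0 and p = 1 can be split off even
    -- when N = 0.
    ∑≤ N t                                      ≡⟨ ∑-extend {suc N} {suc (suc N)} (ℕ.n≤1+n (suc N)) (λ p N<p _ → high p N<p) ⟨
    ∑≤ (suc N) t                                ≡⟨ ∑-first (suc N) t ⟩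
    t 0 + ∑≤ N (λ p → t (suc p))                ≡⟨ cong (λ x → t 0 + x) (∑-first N (λ p → t (suc p))) ⟩
    t 0 + (t 1 + nonlinear s m)                 ≡⟨ cong₂ (λ x y → x + (y + nonlinear s m)) t0 t1 ⟩
    0ℚ + (s m + nonlinear s m)                  ≡⟨ +-identityˡ _ ⟩
    s m + nonlinear s m                         ∎
    where
    N : ℕ
    N = deg m
    t : ℕ → ℚ
    t p = c p * (s ^ p) m
    high : ∀ p → N < p → t p ≡ 0ℚ
    high p N<p = trans (cong (c p *_) (subst (λ k → (s ^ p) k ≡ 0ℚ) (mono-exps m) (order-^ {s} p s0 (exps m) N<p)))
                       (*-zeroʳ (c p))
    t0 : t 0 ≡ 0ℚ
    t0 = trans (cong (_* (s ^ 0) m) c0) (*-zeroˡ ((s ^ 0) m))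
    t1 : t 1 ≡ s m
    t1 = trans (cong₂ _*_ c1 (⊗-identityʳ s m)) (*-identityˡ (s m))

  Φ-nonlinear : ∀ {s} → s 𝟏 ≡ 0ℚ → ∀ m → Φ s m ≡ - nonlinear s m + rhs s m
  Φ-nonlinear {s} s0 m = cong (_+ rhs s m) (trans
    (cong (λ t → s m - t) (∘ˢ-linear-part {s} s0 m))
    (solve 2 (λ x u → x :- (x :+ u) := :- u) refl (s m) (nonlinear s m)))
    where open +-*-Solver

  -- Once the linear term has cancelled, s occurs only in powers with exponent at least 2 and behind
  -- a factor X_k; either gains one degree.
  Φ-contracting : ∀ {n s t} → s 𝟏 ≡ 0ℚ → t 𝟏 ≡ 0ℚ → Agree n s t → Agree (suc n) (Φ s) (Φ t)
  Φ-contracting {n} {s} {t} s0 t0 e m lt = begin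
    Φ s m                         ≡⟨ Φ-nonlinear {s} s0 m ⟩
    - nonlinear s m + rhs s m     ≡⟨ cong₂ (λ x y → - x + y)
        (∑-cong (deg m) λ p _ → cong (c (suc (suc p)) *_) (agree-^-suc {n} {s} {t} p s0 t0 e m lt))
        (∑-cong (width m) λ k _ → agree-X⊗ {n} {F k ∘ˢ s} {F k ∘ˢ t} k (agree-∘ˢ {n} {s} {t} (F k) e) m lt) ⟩
    - nonlinear t m + rhs t m     ≡⟨ Φ-nonlinear {t} t0 m ⟨
    Φ t m                         ∎

  solves⇒fixed : ∀ {s} → Solves c F s → Φ s ≗ s
  solves⇒fixed {s} e m = trans (cong (λ t → s m - t + rhs s m) (equation e m))
    (solve 2 (λ x u → x :- u :+ u := x) refl (s m) (rhs s m))
    where open +-*-Solver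

  fixed⇒solves : ∀ {s} → s 𝟏 ≡ 0ℚ → Φ s ≗ s → Solves c F s
  fixed⇒solves s0 e .constant-term = s0
  fixed⇒solves {s} s0 e .equation m = begin
    (c ∘ˢ s) m                       ≡⟨ solve 3 (λ x u v → u := x :+ v :- (x :- u :+ v)) refl (s m) ((c ∘ˢ s) m) (rhs s m) ⟩
    s m + rhs s m - Φ s m            ≡⟨ cong (λ t → s m + rhs s m - t) (e m) ⟩
    s m + rhs s m - s m              ≡⟨ solve 2 (λ x v → x :+ v :- x := v) refl (s m) (rhs s m) ⟩
    rhs s m                          ∎
    where open +-*-Solver

  unique : ∀ {s t} → Solves c F s → Solves c F t → s ≗ t
  unique {s} {t} es et m = agree (suc (deg m)) m ℕ.≤-refl
    where
    agree : ∀ n → Agree n s t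
    agree zero    m ()
    agree (suc n) m lt = begin
      s m    ≡⟨ solves⇒fixed es m ⟨
      Φ s m  ≡⟨ Φ-contracting {n} {s} {t} (constant-term es) (constant-term et) (agree n) m lt ⟩
      Φ t m  ≡⟨ solves⇒fixed et m ⟩
      t m    ∎

  Φ-𝟏 : ∀ {s} → s 𝟏 ≡ 0ℚ → Φ s 𝟏 ≡ 0ℚ
  Φ-𝟏 {s} s0 = Φ-nonlinear {s} s0 𝟏

  approx : ℕ → FPS
  approx zero    = const 0ℚ
  approx (suc n) = Φ (approx n)

  approx-𝟏 : ∀ n → approx n 𝟏 ≡ 0ℚ
  approx-𝟏 zero    = refl
  approx-𝟏 (suc n) = Φ-𝟏 {approx n} (approx-𝟏 n)

  approx-agree : ∀ {n n′} → n ≤ n′ → Agree n (approx n) (approx n′)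
  approx-agree z≤n m ()
  approx-agree (s≤s {n} {n′} p) = Φ-contracting {n} {approx n} {approx n′} (approx-𝟏 n) (approx-𝟏 n′) (approx-agree p)

  -- The coefficients of degree d are stationary from the iterate d + 1 on, so the limit is read off
  -- along a diagonal.
  solution : FPS
  solution m = approx (suc (deg m)) m

  solution-agree : ∀ n → Agree n solution (approx n)
  solution-agree n m lt = approx-agree lt m ℕ.≤-refl

  solves : Solves c F solution
  solves = fixed⇒solves (approx-𝟏 1) λ m →
    -- The right-hand side `Φ (approx (deg m)) m` is `solution m` by definition.
    Φ-contracting {deg m} {solution} {approx (deg m)} (approx-𝟏 1) (approx-𝟏 (deg m))
      (solution-agree (deg m)) m ℕ.≤-refl

-- Composition with univariate series

∘ˢ-cong : ∀ {c c′ : ℕ → ℚ} s → c ≗ c′ → c ∘ˢ s ≗ c′ ∘ˢ s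
∘ˢ-cong s e m = ∑-cong (suc (deg m)) λ p _ → cong (_* (s ^ p) m) (e p)

∘ˢ-+ : ∀ c c′ s m → ((λ p → c p + c′ p) ∘ˢ s) m ≡ (c ∘ˢ s) m + (c′ ∘ˢ s) m
∘ˢ-+ c c′ s m = trans
  (∑-cong (suc (deg m)) λ p _ → *-distribʳ-+ ((s ^ p) m) (c p) (c′ p))
  (∑-+ (suc (deg m)) (λ p → c p * (s ^ p) m) (λ p → c′ p * (s ^ p) m))

∘ˢ-* : ∀ a c s m → ((λ p → a * c p) ∘ˢ s) m ≡ a * (c ∘ˢ s) m
∘ˢ-* a c s m = trans
  (∑-cong (suc (deg m)) λ p _ → *-assoc a (c p) ((s ^ p) m))
  (sym (∑-*ˡ (suc (deg m)) a (λ p → c p * (s ^ p) m)))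

∘ˢ-∑ : ∀ n (c : ℕ → ℕ → ℚ) s m → ((λ p → ∑< n λ i → c i p) ∘ˢ s) m ≡ ∑< n (λ i → (c i ∘ˢ s) m)
∘ˢ-∑ n c s m = trans
  (∑-cong (suc (deg m)) λ p _ → ∑-*ʳ n ((s ^ p) m) (λ i → c i p))
  (∑-swap (suc (deg m)) n (λ p i → c i p * (s ^ p) m))

-- Triangular linear changes of variables in the equation

linear-form : (ℕ → ℚ) → FPS
linear-form a = ∑X≥ 0 λ i → const (a i)

-- The substitution x_k = ∑_i A_{ik} x̂_i replaces ∑_k x_k F_k by ∑_i x̂_i ∑_k A_{ik} F_k.
module LinearSubstitution (A : ℕ → ℕ → ℚ) (A-triangular : ∀ i k → i < k → A i k ≡ 0ℚ) where

  L : ℕ → FPS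
  L k = linear-form λ i → A i k

  L-truncate : ∀ w d k → Truncated._≈_ w d (L k) (∑<ˢ w λ i → A i k • X i)
  L-truncate w d k = ≈-trans (∑X-truncate (λ i → const (A i k))) (∑ˢ-cong w λ i _ → ⊗-const (A i k) (X i))
    where open Truncated w d

  L-triangular : ∀ w d k → w ≤ k → Truncated._≈_ w d (L k) (const 0ℚ)
  L-triangular w d k w≤k = ≈-trans (L-truncate w d k) (≗⇒≈ λ m → trans
    (∑-zero w λ i i<w → trans (cong (_* X i m) (A-triangular i k (ℕ.<-≤-trans i<w w≤k))) (*-zeroˡ (X i m)))
    (sym (const-zero m)))
    where open Truncated w d

  open Substitution L (λ _ → refl) L-triangular public

  module _ {c : ℕ → ℚ} {F F′ : ℕ → ℕ → ℚ}
    -- By triangularity row i ends at k = i. The row sum is required for every w > i because the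
    -- congruence modulo X_w, X_{w+1}, ... cuts it at w.
    (F′-def : (i q w : ℕ) → i < w → ∑< w (λ k → A i k * F k q) ≡ F′ i q) where
    open Solves

    substitute-solves : ∀ {s} → Solves c F s → Solves c F′ (substitute L s)
    substitute-solves {s} e .constant-term = trans (*-identityʳ (s 𝟏)) (constant-term e)
    substitute-solves {s} e .equation = ≗-by-truncation λ w d →
      let open Truncated w d
          open ≈-Reasoning ≈-setoid
          S : FPS
          S = substitute L s
          G : ℕ → FPS
          G k = F k ∘ˢ S
          s0 = constant-term e
      in begin
      c ∘ˢ S
        ≈⟨ substitute-∘ˢ c s s0 ⟨
      substitute L (c ∘ˢ s)
        ≈⟨ substitute-cong (equation e) ⟩
      substitute L (∑X≥ 0 λ k → F k ∘ˢ s)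
        ≈⟨ substitute-∑X (λ k → F k ∘ˢ s) ⟩
      ∑<ˢ w (λ k → L k ⊗ substitute L (F k ∘ˢ s))
        ≈⟨ ∑ˢ-cong w (λ k _ → ⊗-cong (L-truncate w d k) (substitute-∘ˢ (F k) s s0)) ⟩
      ∑<ˢ w (λ k → ∑<ˢ w (λ i → A i k • X i) ⊗ G k)
        ≈⟨ ∑ˢ-cong w (λ k _ → ⊗-∑ˡ w (λ i → A i k • X i) (G k)) ⟩
      ∑<ˢ w (λ k → ∑<ˢ w λ i → (A i k • X i) ⊗ G k)
        -- Both sums are finite at this precision, which makes the exchange legitimate.
        ≈⟨ ≗⇒≈ (λ m → ∑-swap w w (λ k i → ((A i k • X i) ⊗ G k) m)) ⟩
      ∑<ˢ w (λ i → ∑<ˢ w λ k → (A i k • X i) ⊗ G k)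
        ≈⟨ ∑ˢ-cong w (λ i _ → ∑ˢ-cong w λ k _ →
             ≈-trans (⊗-•ˡ (A i k) (X i) (G k)) (≈-sym (⊗-•ʳ (A i k) (X i) (G k)))) ⟩
      ∑<ˢ w (λ i → ∑<ˢ w λ k → X i ⊗ (A i k • G k))
        ≈⟨ ∑ˢ-cong w (λ i _ → ⊗-∑ʳ w (X i) (λ k → A i k • G k)) ⟨
      ∑<ˢ w (λ i → X i ⊗ ∑<ˢ w (λ k → A i k • G k))
        ≈⟨ ∑ˢ-cong w (λ i i<w → ⊗-congˡ (X i) (≗⇒≈ λ m → trans
             (∑-cong w λ k _ → sym (∘ˢ-* (A i k) (F k) S m))
             (trans (sym (∘ˢ-∑ w (λ k p → A i k * F k p) S m))
                    (∘ˢ-cong S (λ q → F′-def i q w i<w) m)))) ⟩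
      ∑<ˢ w (λ i → X i ⊗ F′ i ∘ˢ S)
        ≈⟨ ∑X-truncate (λ i → F′ i ∘ˢ S) ⟨
      ∑X≥ 0 (λ i → F′ i ∘ˢ S) ∎

-- The integers inside the rationals

-- ⟨_⟩ under a name that does not clash with the reasoning combinators.
ι : ℤ → ℚ
ι i = ⟨ i ⟩

ι-+ : ∀ i j → ι (i ℤ.+ j) ≡ (ι i) + (ι j)
ι-+ i j = toℚᵘ-injective (begin
  toℚᵘ (ι (i ℤ.+ j))                             ≈⟨ toℚᵘ-fromℚᵘ (ℚᵘ.mkℚᵘ (i ℤ.+ j) 0) ⟩
  ℚᵘ.mkℚᵘ (i ℤ.+ j) 0                          ≈⟨ ℚᵘ.*≡* (cong (ℤ._* + 1) (cong₂ ℤ._+_ (sym (ℤ.*-identityʳ i)) (sym (ℤ.*-identityʳ j)))) ⟩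
  ℚᵘ.mkℚᵘ i 0 ℚᵘ.+ ℚᵘ.mkℚᵘ j 0                 ≈⟨ ℚᵘ.+-cong (toℚᵘ-fromℚᵘ (ℚᵘ.mkℚᵘ i 0)) (toℚᵘ-fromℚᵘ (ℚᵘ.mkℚᵘ j 0)) ⟨
  toℚᵘ (ι i) ℚᵘ.+ toℚᵘ (ι j)                   ≈⟨ toℚᵘ-homo-+ (ι i) (ι j) ⟨
  toℚᵘ ((ι i) + (ι j))                         ∎)
  where open ≈-Reasoning ℚᵘ.≃-setoid

ι-* : ∀ i j → (ι (i ℤ.* j)) ≡ (ι i) * (ι j)
ι-* i j = toℚᵘ-injective (begin
  toℚᵘ (ι (i ℤ.* j))                             ≈⟨ toℚᵘ-fromℚᵘ (ℚᵘ.mkℚᵘ (i ℤ.* j) 0) ⟩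
  ℚᵘ.mkℚᵘ i 0 ℚᵘ.* ℚᵘ.mkℚᵘ j 0                 ≈⟨ ℚᵘ.*-cong (toℚᵘ-fromℚᵘ (ℚᵘ.mkℚᵘ i 0)) (toℚᵘ-fromℚᵘ (ℚᵘ.mkℚᵘ j 0)) ⟨
  toℚᵘ (ι i) ℚᵘ.* toℚᵘ (ι j)                   ≈⟨ toℚᵘ-homo-* (ι i) (ι j) ⟨
  toℚᵘ ((ι i) * (ι j))                         ∎)
  where open ≈-Reasoning ℚᵘ.≃-setoid

ι-neg : ∀ i → (ι (ℤ.- i)) ≡ - (ι i)
ι-neg i = toℚᵘ-injective (begin
  toℚᵘ (ι (ℤ.- i))            ≈⟨ toℚᵘ-fromℚᵘ (ℚᵘ.mkℚᵘ (ℤ.- i) 0) ⟩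
  ℚᵘ.- ℚᵘ.mkℚᵘ i 0          ≈⟨ ℚᵘ.-‿cong (toℚᵘ-fromℚᵘ (ℚᵘ.mkℚᵘ i 0)) ⟨
  ℚᵘ.- toℚᵘ (ι i)           ≈⟨ toℚᵘ-homo‿- (ι i) ⟨
  toℚᵘ (- (ι i))            ∎)
  where open ≈-Reasoning ℚᵘ.≃-setoid

-- The binomial theorem for powers of 1 + s

binomial : ℕ → ℕ → ℚ
binomial n k = ι (+ (n C k))

binomial-Pascal : ∀ n k → binomial (suc n) (suc k) ≡ binomial n k + binomial n (suc k)
binomial-Pascal n k = trans (cong (λ j → ι (+ j)) (sym (nCk+nC[k+1]≡[n+1]C[k+1] n k)))
  (ι-+ (+ (n C k)) (+ (n C suc k)))

shift : (ℕ → ℚ) → ℕ → ℚ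
shift c zero    = 0ℚ
shift c (suc p) = c p

⊗-∘ˢ : ∀ c {s} → s 𝟏 ≡ 0ℚ → s ⊗ c ∘ˢ s ≗ shift c ∘ˢ s
⊗-∘ˢ c {s} s0 = ≗-by-truncation λ w d →
  let open Truncated w d
      open ≈-Reasoning ≈-setoid
  in begin
  s ⊗ c ∘ˢ s                          ≈⟨ ⊗-congˡ s (∘ˢ-truncate c s0 ℕ.≤-refl) ⟩
  s ⊗ ∑≤ˢ d (λ p → c p • s ^ p)       ≈⟨ ⊗-∑ʳ (suc d) s (λ p → c p • s ^ p) ⟩
  ∑≤ˢ d (λ p → s ⊗ (c p • s ^ p))     ≈⟨ ∑ˢ-cong (suc d) (λ p _ → ⊗-•ʳ (c p) s (s ^ p)) ⟩
  ∑≤ˢ d (λ p → c p • s ^ suc p)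
    ≈⟨ ≗⇒≈ (λ m → trans (∑-first (suc d) (λ p → shift c p * (s ^ p) m))
         (trans (cong (_+ ∑≤ d (λ p → c p * (s ^ suc p) m)) (*-zeroˡ ((s ^ 0) m))) (+-identityˡ _))) ⟨
  ∑≤ˢ (suc d) (λ p → shift c p • s ^ p) ≈⟨ ∘ˢ-truncate (shift c) s0 (ℕ.n≤1+n d) ⟨
  shift c ∘ˢ s                          ∎

δ₀ : ℕ → ℚ
δ₀ zero    = 1ℚ
δ₀ (suc p) = 0ℚ

δ₀-∘ˢ : ∀ s → δ₀ ∘ˢ s ≗ const 1ℚ
δ₀-∘ˢ s m = trans (∑-single {suc (deg m)} {0} {λ p → δ₀ p * (s ^ p) m} (s≤s z≤n) λ where
    zero    _ q → ⊥-elim (q refl)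
    (suc p) _ _ → *-zeroˡ ((s ^ suc p) m))
  (*-identityˡ (const 1ℚ m))

-- Multiplication by 1 + s adds to the coefficient sequence its own shift, which is Pascal's rule.
binomial-theorem : ∀ k {s r} → s 𝟏 ≡ 0ℚ → r ≗ const 1ℚ ⊕ s → r ^ k ≗ binomial k ∘ˢ s
binomial-theorem zero    {s} s0 e m = trans (sym (δ₀-∘ˢ s m))
  (∘ˢ-cong {δ₀} {binomial 0} s (λ { zero → refl ; (suc q) → refl }) m)
binomial-theorem (suc k) {s} {r} s0 e = ≗-by-truncation λ w d →
  let open Truncated w d
      open ≈-Reasoning ≈-setoid
      P : FPS
      P = binomial k ∘ˢ s
  in begin
  r ⊗ r ^ k                        ≈⟨ ⊗-cong (≗⇒≈ e) (≗⇒≈ (binomial-theorem k s0 e)) ⟩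
  (const 1ℚ ⊕ s) ⊗ P               ≈⟨ ⊗-distribʳ-⊕ P (const 1ℚ) s ⟩
  const 1ℚ ⊗ P ⊕ s ⊗ P             ≈⟨ ⊕-cong (⊗-identityˡ P) (≗⇒≈ (⊗-∘ˢ (binomial k) s0)) ⟩
  P ⊕ shift (binomial k) ∘ˢ s      ≈⟨ ≗⇒≈ (λ m → ∘ˢ-+ (binomial k) (shift (binomial k)) s m) ⟨
  (λ q → binomial k q + shift (binomial k) q) ∘ˢ s ≈⟨ ≗⇒≈ (∘ˢ-cong s pascal) ⟩
  binomial (suc k) ∘ˢ s            ∎
  where
  pascal : ∀ q → binomial k q + shift (binomial k) q ≡ binomial (suc k) q
  pascal zero    = refl
  pascal (suc q) = trans (+-comm (binomial k (suc q)) (binomial k q)) (sym (binomial-Pascal k q))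

open ≡-Reasoning

-- Binomial coefficients and finite differences

ν : ℕ → ℚ
ν n = ι (+ n)

ν-+ : ∀ m n → ν (m ℕ.+ n) ≡ ν m + ν n
ν-+ m n = ι-+ (+ m) (+ n)

ν-* : ∀ m n → ν (m ℕ.* n) ≡ ν m * ν n
ν-* m n = trans (cong ι (ℤ.pos-* m n)) (ι-* (+ m) (+ n))

ν-suc : ∀ n → ν (suc n) ≡ 1ℚ + ν n
ν-suc n = ν-+ 1 n

/-cancel : ∀ i n .{{_ : NonZero n}} → ν n * (i / n) ≡ ι i
/-cancel i n@(suc k) = toℚᵘ-injective
  (ℚᵘ.≃-trans (toℚᵘ-homo-* (ν n) (i / n))
  (ℚᵘ.≃-trans (ℚᵘ.*-cong (toℚᵘ-fromℚᵘ (ℚᵘ.mkℚᵘ (+ n) 0)) (toℚᵘ-fromℚᵘ (ℚᵘ.mkℚᵘ i k)))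
  (ℚᵘ.≃-trans {j = ℚᵘ.mkℚᵘ i 0}
    (ℚᵘ.*≡* (trans (ℤ.*-identityʳ (+ n ℤ.* i)) (trans (ℤ.*-comm (+ n) i)
      (cong (λ j → i ℤ.* + j) (sym (ℕ.*-identityˡ n))))))
    (ℚᵘ.≃-sym (toℚᵘ-fromℚᵘ (ℚᵘ.mkℚᵘ i 0))))))

ν-cancel : ∀ n .{{_ : NonZero n}} {x y} → ν n * x ≡ ν n * y → x ≡ y
ν-cancel n {x} {y} e = trans (sym (inv x)) (trans (cong ((+ 1 / n) *_) e) (inv y))
  where
  inv : ∀ z → (+ 1 / n) * (ν n * z) ≡ z
  inv z = begin
    (+ 1 / n) * (ν n * z)  ≡⟨ *-assoc (+ 1 / n) (ν n) z ⟨
    (+ 1 / n) * ν n * z    ≡⟨ cong (_* z) (trans (*-comm (+ 1 / n) (ν n)) (/-cancel (+ 1) n)) ⟩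
    1ℚ * z                 ≡⟨ *-identityˡ z ⟩
    z                      ∎

/-unique : ∀ i n .{{_ : NonZero n}} {x} → ν n * x ≡ ι i → i / n ≡ x
/-unique i n e = ν-cancel n (trans (/-cancel i n) (sym e))

binomial-> : ∀ {n k} → n < k → binomial n k ≡ 0ℚ
binomial-> {n} {k} lt = cong ν (k>n⇒nCk≡0 lt)

-- Stated with a signed factor n - k, so that it also holds for k > n.
binomial-absorb : ∀ n k → ν (suc k) * binomial n (suc k) ≡ (ν n - ν k) * binomial n k
binomial-absorb zero zero = refl
binomial-absorb zero (suc k) = trans (*-zeroʳ (ν (suc (suc k)))) (sym (*-zeroʳ (ν 0 - ν (suc k))))
binomial-absorb (suc n) zero = trans (cong (λ j → 1ℚ * ν j) (nC1≡n (suc n)))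
  (solve 1 (λ x → con 1ℚ :* x := (x :- con 0ℚ) :* con 1ℚ) refl (ν (suc n)))
  where open +-*-Solver
binomial-absorb (suc n) (suc k) = begin
  ν (suc (suc k)) * binomial (suc n) (suc (suc k))
    ≡⟨ cong (ν (suc (suc k)) *_) (binomial-Pascal n (suc k)) ⟩
  ν (suc (suc k)) * (B₁ + B₂)
    ≡⟨ *-distribˡ-+ (ν (suc (suc k))) B₁ B₂ ⟩
  ν (suc (suc k)) * B₁ + ν (suc (suc k)) * B₂
    ≡⟨ cong₂ (λ x y → x * B₁ + y) (ν-suc (suc k)) (binomial-absorb n (suc k)) ⟩
  (1ℚ + ν (suc k)) * B₁ + (ν n - ν (suc k)) * B₁
    ≡⟨ solve 3 (λ κ n B → (con 1ℚ :+ κ) :* B :+ (n :- κ) :* B := κ :* B :+ (con 1ℚ :+ n :- κ) :* B)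
         refl (ν (suc k)) (ν n) B₁ ⟩
  ν (suc k) * B₁ + (1ℚ + ν n - ν (suc k)) * B₁
    ≡⟨ cong₂ _+_ (binomial-absorb n k) (cong (λ x → (x - ν (suc k)) * B₁) (sym (ν-suc n))) ⟩
  (ν n - ν k) * B₀ + (ν (suc n) - ν (suc k)) * B₁
    ≡⟨ cong (λ x → x * B₀ + (ν (suc n) - ν (suc k)) * B₁) shift-both ⟩
  (ν (suc n) - ν (suc k)) * B₀ + (ν (suc n) - ν (suc k)) * B₁
    ≡⟨ *-distribˡ-+ (ν (suc n) - ν (suc k)) B₀ B₁ ⟨
  (ν (suc n) - ν (suc k)) * (B₀ + B₁)
    ≡⟨ cong ((ν (suc n) - ν (suc k)) *_) (binomial-Pascal n k) ⟨
  (ν (suc n) - ν (suc k)) * binomial (suc n) (suc k) ∎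
  where
  open +-*-Solver
  B₀ B₁ B₂ : ℚ
  B₀ = binomial n k
  B₁ = binomial n (suc k)
  B₂ = binomial n (suc (suc k))
  shift-both : ν n - ν k ≡ ν (suc n) - ν (suc k)
  shift-both = trans
    (solve 2 (λ x y → x :- y := (con 1ℚ :+ x) :- (con 1ℚ :+ y)) refl (ν n) (ν k))
    (sym (cong₂ _-_ (ν-suc n) (ν-suc k)))

binomial-absorb-suc : ∀ n k → ν (suc k) * binomial (suc n) (suc k) ≡ ν (suc n) * binomial n k
binomial-absorb-suc n k = begin
  ν (suc k) * binomial (suc n) (suc k)
    ≡⟨ cong (ν (suc k) *_) (binomial-Pascal n k) ⟩
  ν (suc k) * (binomial n k + binomial n (suc k))
    ≡⟨ *-distribˡ-+ (ν (suc k)) (binomial n k) (binomial n (suc k)) ⟩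
  ν (suc k) * binomial n k + ν (suc k) * binomial n (suc k)
    ≡⟨ cong₂ (λ x y → x * binomial n k + y) (ν-suc k) (binomial-absorb n k) ⟩
  (1ℚ + ν k) * binomial n k + (ν n - ν k) * binomial n k
    ≡⟨ solve 3 (λ k n B → (con 1ℚ :+ k) :* B :+ (n :- k) :* B := (con 1ℚ :+ n) :* B) refl (ν k) (ν n) (binomial n k) ⟩
  (1ℚ + ν n) * binomial n k
    ≡⟨ cong (_* binomial n k) (ν-suc n) ⟨
  ν (suc n) * binomial n k ∎
  where open +-*-Solver

choose-! : ∀ a b → ((a ℕ.+ b) C a) ℕ.* (a ! ℕ.* b !) ≡ (a ℕ.+ b) !
choose-! a b = subst (λ c → ((a ℕ.+ b) C a) ℕ.* (a ! ℕ.* c !) ≡ (a ℕ.+ b) !) (ℕ.m+n∸m≡n a b)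
  (trans (cong (ℕ._* (a ! ℕ.* (a ℕ.+ b ∸ a) !)) (nCk≡n!/k![n-k]! (ℕ.m≤m+n a b)))
         (m/n*n≡m (k![n∸k]!∣n! (ℕ.m≤m+n a b))))
  where instance _ = a ℕ.!* (a ℕ.+ b ∸ a) !≢0

-- The multinomial coefficient (a+b+c)! / (a! b! c!). Its symmetry and its two factorisations into
-- binomials yield the product identities used for both coefficient evaluations; parametrising by a,
-- b, c avoids truncated subtraction.
trinomial : ℕ → ℕ → ℕ → ℕ
trinomial a b c = ((a ℕ.+ (b ℕ.+ c)) C a) ℕ.* ((b ℕ.+ c) C b)

trinomial-! : ∀ a b c → trinomial a b c ℕ.* (a ! ℕ.* (b ! ℕ.* c !)) ≡ (a ℕ.+ (b ℕ.+ c)) !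
trinomial-! a b c = begin
  A ℕ.* D ℕ.* (a ! ℕ.* (b ! ℕ.* c !))   ≡⟨ rearrange A D (a !) (b ! ℕ.* c !) ⟩
  A ℕ.* (a ! ℕ.* (D ℕ.* (b ! ℕ.* c !))) ≡⟨ cong (λ x → A ℕ.* (a ! ℕ.* x)) (choose-! b c) ⟩
  A ℕ.* (a ! ℕ.* (b ℕ.+ c) !)           ≡⟨ choose-! a (b ℕ.+ c) ⟩
  (a ℕ.+ (b ℕ.+ c)) !                   ∎
  where
  A D : ℕ
  A = (a ℕ.+ (b ℕ.+ c)) C a
  D = (b ℕ.+ c) C b
  rearrange : ∀ x y u v → x ℕ.* y ℕ.* (u ℕ.* v) ≡ x ℕ.* (u ℕ.* (y ℕ.* v))
  rearrange = solve-∀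

trinomial-swap : ∀ a b c → trinomial a b c ≡ trinomial b a c
trinomial-swap a b c = ℕ.*-cancelʳ-≡ _ _ (a ! ℕ.* (b ! ℕ.* c !)) (begin
  trinomial a b c ℕ.* (a ! ℕ.* (b ! ℕ.* c !))  ≡⟨ trinomial-! a b c ⟩
  (a ℕ.+ (b ℕ.+ c)) !                          ≡⟨ cong _! (swap-+ a b c) ⟩
  (b ℕ.+ (a ℕ.+ c)) !                          ≡⟨ trinomial-! b a c ⟨
  trinomial b a c ℕ.* (b ! ℕ.* (a ! ℕ.* c !))  ≡⟨ cong (trinomial b a c ℕ.*_) (swap-* (b !) (a !) (c !)) ⟩
  trinomial b a c ℕ.* (a ! ℕ.* (b ! ℕ.* c !))  ∎)
  where
  swap-+ : ∀ x y z → x ℕ.+ (y ℕ.+ z) ≡ y ℕ.+ (x ℕ.+ z)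
  swap-+ = solve-∀
  swap-* : ∀ x y z → x ℕ.* (y ℕ.* z) ≡ y ℕ.* (x ℕ.* z)
  swap-* = solve-∀
  instance _ = ℕ.m*n≢0 (a !) (b ! ℕ.* c !) {{a ℕ.!≢0}} {{b ℕ.!* c !≢0}}

trinomial-revision : ∀ a b c → ((a ℕ.+ b ℕ.+ c) C (a ℕ.+ b)) ℕ.* ((a ℕ.+ b) C a) ≡ trinomial a b c
trinomial-revision a b c = ℕ.*-cancelʳ-≡ _ _ (a ! ℕ.* (b ! ℕ.* c !)) (begin
  A ℕ.* D ℕ.* (a ! ℕ.* (b ! ℕ.* c !))          ≡⟨ rearrange A D (a !) (b !) (c !) ⟩
  A ℕ.* (D ℕ.* (a ! ℕ.* b !) ℕ.* c !)          ≡⟨ cong (λ x → A ℕ.* (x ℕ.* c !)) (choose-! a b) ⟩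
  A ℕ.* ((a ℕ.+ b) ! ℕ.* c !)                  ≡⟨ choose-! (a ℕ.+ b) c ⟩
  (a ℕ.+ b ℕ.+ c) !                            ≡⟨ cong _! (ℕ.+-assoc a b c) ⟩
  (a ℕ.+ (b ℕ.+ c)) !                          ≡⟨ trinomial-! a b c ⟨
  trinomial a b c ℕ.* (a ! ℕ.* (b ! ℕ.* c !))  ∎)
  where
  A D : ℕ
  A = (a ℕ.+ b ℕ.+ c) C (a ℕ.+ b)
  D = (a ℕ.+ b) C a
  rearrange : ∀ x y u v w → x ℕ.* y ℕ.* (u ℕ.* (v ℕ.* w)) ≡ x ℕ.* (y ℕ.* (u ℕ.* v) ℕ.* w)
  rearrange = solve-∀
  instance _ = ℕ.m*n≢0 (a !) (b ! ℕ.* c !) {{a ℕ.!≢0}} {{b ℕ.!* c !≢0}}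

choose-sym : ∀ a b → (a ℕ.+ b) C a ≡ (a ℕ.+ b) C b
choose-sym a b = ℕ.*-cancelʳ-≡ _ _ (a ! ℕ.* b !) (begin
  ((a ℕ.+ b) C a) ℕ.* (a ! ℕ.* b !)  ≡⟨ choose-! a b ⟩
  (a ℕ.+ b) !                      ≡⟨ cong _! (ℕ.+-comm a b) ⟩
  (b ℕ.+ a) !                      ≡⟨ choose-! b a ⟨
  ((b ℕ.+ a) C b) ℕ.* (b ! ℕ.* a !)  ≡⟨ cong₂ (λ n x → (n C b) ℕ.* x) (ℕ.+-comm b a) (ℕ.*-comm (b !) (a !)) ⟩
  ((a ℕ.+ b) C b) ℕ.* (a ! ℕ.* b !)  ∎)
  where instance _ = a ℕ.!* b !≢0

-- Signs and iterated finite differences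

sgn : ℕ → ℚ
sgn n = ι (-1ℤ ℤ.^ n)

sgn-suc : ∀ n → sgn (suc n) ≡ - sgn n
sgn-suc n = trans (ι-* -1ℤ (-1ℤ ℤ.^ n))
  (solve 1 (λ x → (:- con 1ℚ) :* x := :- x) refl (sgn n))
  where open +-*-Solver

sgn-+ : ∀ m n → sgn (m ℕ.+ n) ≡ sgn m * sgn n
sgn-+ zero    n = sym (*-identityˡ (sgn n))
sgn-+ (suc m) n = begin
  sgn (suc (m ℕ.+ n))  ≡⟨ sgn-suc (m ℕ.+ n) ⟩
  - sgn (m ℕ.+ n)      ≡⟨ cong -_ (sgn-+ m n) ⟩
  - (sgn m * sgn n)    ≡⟨ neg-distribˡ-* (sgn m) (sgn n) ⟩
  - sgn m * sgn n      ≡⟨ cong (_* sgn n) (sgn-suc m) ⟨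
  sgn (suc m) * sgn n  ∎

Δ^ : ℕ → (ℕ → ℚ) → ℕ → ℚ
Δ^ zero    f x = f x
Δ^ (suc n) f x = Δ^ n f (suc x) - Δ^ n f x

-- The weight of f(x + j) in Δ^n f(x). The recursion is that of (E - 1)^n for the shift operator E.
Δ-coefficient : ℕ → ℕ → ℚ
Δ-coefficient zero    zero    = 1ℚ
Δ-coefficient zero    (suc j) = 0ℚ
Δ-coefficient (suc n) zero    = - Δ-coefficient n zero
Δ-coefficient (suc n) (suc j) = Δ-coefficient n j - Δ-coefficient n (suc j)

Δ-coefficient-closed : ∀ n j → Δ-coefficient n j ≡ sgn (n ∸ j) * binomial n j
Δ-coefficient-closed zero    zero    = refl
Δ-coefficient-closed zero    (suc j) = refl
Δ-coefficient-closed (suc n) zero    = begin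
  - Δ-coefficient n zero   ≡⟨ cong -_ (Δ-coefficient-closed n zero) ⟩
  - (sgn n * 1ℚ)           ≡⟨ neg-distribˡ-* (sgn n) 1ℚ ⟩
  - sgn n * 1ℚ             ≡⟨ cong (_* 1ℚ) (sgn-suc n) ⟨
  sgn (suc n) * 1ℚ         ∎
Δ-coefficient-closed (suc n) (suc j) = begin
  Δ-coefficient n j - Δ-coefficient n (suc j)
    ≡⟨ cong₂ _-_ (Δ-coefficient-closed n j) (Δ-coefficient-closed n (suc j)) ⟩
  sgn (n ∸ j) * binomial n j - sgn (n ∸ suc j) * binomial n (suc j)
    ≡⟨ cong (λ x → sgn (n ∸ j) * binomial n j + x) flip ⟩
  sgn (n ∸ j) * binomial n j + sgn (n ∸ j) * binomial n (suc j)
    ≡⟨ *-distribˡ-+ (sgn (n ∸ j)) (binomial n j) (binomial n (suc j)) ⟨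
  sgn (n ∸ j) * (binomial n j + binomial n (suc j))
    ≡⟨ cong (sgn (n ∸ j) *_) (binomial-Pascal n j) ⟨
  sgn (n ∸ j) * binomial (suc n) (suc j) ∎
  where
  open +-*-Solver
  -- For j < n the two exponents differ by one. For j ≥ n truncated subtraction makes both of them 0
  -- and the signs do not flip, but then the binomial vanishes.
  Flip : Set
  Flip = - (sgn (n ∸ suc j) * binomial n (suc j)) ≡ sgn (n ∸ j) * binomial n (suc j)
  below : suc j ≤ n → Flip
  below j<n = trans (neg-distribˡ-* (sgn (n ∸ suc j)) (binomial n (suc j)))
    (cong (_* binomial n (suc j)) (trans (sym (sgn-suc (n ∸ suc j))) (cong sgn (sym (ℕ.+-∸-assoc 1 j<n)))))
  above : n < suc j → Flip
  above n<1+j = trans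
    (cong (λ x → - (sgn (n ∸ suc j) * x)) (binomial-> n<1+j))
    (trans (solve 2 (λ x y → :- (x :* con 0ℚ) := y :* con 0ℚ) refl (sgn (n ∸ suc j)) (sgn (n ∸ j)))
           (cong (sgn (n ∸ j) *_) (sym (binomial-> n<1+j))))
  flip : Flip
  flip = [ below , above ]′ (ℕ.≤-<-connex (suc j) n)

Δ-coefficient-> : ∀ {n j} → n < j → Δ-coefficient n j ≡ 0ℚ
Δ-coefficient-> {n} {j} lt = trans (Δ-coefficient-closed n j)
  (trans (cong (sgn (n ∸ j) *_) (binomial-> lt)) (*-zeroʳ (sgn (n ∸ j))))

Δ^-sum : ∀ n f x → ∑≤ n (λ j → Δ-coefficient n j * f (x ℕ.+ j)) ≡ Δ^ n f x
Δ^-sum zero    f x = trans (+-identityˡ (1ℚ * f (x ℕ.+ 0))) (trans (*-identityˡ (f (x ℕ.+ 0))) (cong f (ℕ.+-identityʳ x)))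
Δ^-sum (suc n) f x = begin
  ∑≤ (suc n) (λ j → c (suc n) j * f (x ℕ.+ j))
    ≡⟨ ∑-first (suc n) (λ j → c (suc n) j * f (x ℕ.+ j)) ⟩
  - c n 0 * f (x ℕ.+ 0) + ∑≤ n (λ j → (c n j - c n (suc j)) * f (x ℕ.+ suc j))
    ≡⟨ cong (λ t → - c n 0 * f (x ℕ.+ 0) + t) (∑-cong (suc n) λ j _ → expand (c n j) (c n (suc j)) (f (x ℕ.+ suc j))) ⟩
  - c n 0 * f (x ℕ.+ 0) + ∑≤ n (λ j → c n j * f (x ℕ.+ suc j) + - 1ℚ * (c n (suc j) * f (x ℕ.+ suc j)))
    ≡⟨ cong (λ t → - c n 0 * f (x ℕ.+ 0) + t) (trans
         (∑-+ (suc n) (λ j → c n j * f (x ℕ.+ suc j)) (λ j → - 1ℚ * (c n (suc j) * f (x ℕ.+ suc j))))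
         (cong₂ _+_ (∑-cong (suc n) λ j _ → cong (λ k → c n j * f k) (ℕ.+-suc x j))
                    (sym (∑-*ˡ (suc n) (- 1ℚ) (λ j → c n (suc j) * f (x ℕ.+ suc j)))))) ⟩
  - c n 0 * f (x ℕ.+ 0) + (upper + - 1ℚ * lower)
    ≡⟨ solve 4 (λ a b u l → (:- a) :* b :+ (u :+ (:- con 1ℚ) :* l) := u :- (a :* b :+ l)) refl
         (c n 0) (f (x ℕ.+ 0)) upper lower ⟩
  upper - (c n 0 * f (x ℕ.+ 0) + lower)
    ≡⟨ cong₂ _-_ (Δ^-sum n f (suc x)) (sym (∑-first (suc n) (λ j → c n j * f (x ℕ.+ j)))) ⟩
  Δ^ n f (suc x) - ∑≤ (suc n) (λ j → c n j * f (x ℕ.+ j))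
    ≡⟨ cong (λ t → Δ^ n f (suc x) - t) (∑-extend {suc n} {suc (suc n)} (ℕ.n≤1+n (suc n)) λ j n<j _ →
         trans (cong (_* f (x ℕ.+ j)) (Δ-coefficient-> n<j)) (*-zeroˡ (f (x ℕ.+ j)))) ⟩
  Δ^ n f (suc x) - ∑≤ n (λ j → c n j * f (x ℕ.+ j))
    ≡⟨ cong (λ t → Δ^ n f (suc x) - t) (Δ^-sum n f x) ⟩
  Δ^ n f (suc x) - Δ^ n f x ∎
  where
  open +-*-Solver
  c : ℕ → ℕ → ℚ
  c = Δ-coefficient
  upper lower : ℚ
  upper = ∑≤ n (λ j → c n j * f (suc x ℕ.+ j))
  lower = ∑≤ n (λ j → c n (suc j) * f (x ℕ.+ suc j))
  expand : ∀ a b y → (a - b) * y ≡ a * y + - 1ℚ * (b * y)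
  expand = solve 3 (λ a b y → (a :- b) :* y := a :* y :+ (:- con 1ℚ) :* (b :* y)) refl

-- By Pascal's rule, one difference in y lowers the lower index by one.
Δ^-binomial : ∀ n k x → Δ^ n (λ y → binomial y (n ℕ.+ k)) x ≡ binomial x k
Δ^-binomial zero    k x = refl
Δ^-binomial (suc n) k x = begin
  Δ^ n (λ y → binomial y (suc n ℕ.+ k)) (suc x) - Δ^ n (λ y → binomial y (suc n ℕ.+ k)) x
    ≡⟨ cong (λ j → Δ^ n (λ y → binomial y j) (suc x) - Δ^ n (λ y → binomial y j) x) (ℕ.+-suc n k) ⟨
  Δ^ n (λ y → binomial y (n ℕ.+ suc k)) (suc x) - Δ^ n (λ y → binomial y (n ℕ.+ suc k)) x
    ≡⟨ cong₂ _-_ (Δ^-binomial n (suc k) (suc x)) (Δ^-binomial n (suc k) x) ⟩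
  binomial (suc x) (suc k) - binomial x (suc k)
    ≡⟨ cong (_- binomial x (suc k)) (binomial-Pascal x k) ⟩
  binomial x k + binomial x (suc k) - binomial x (suc k)
    ≡⟨ solve 2 (λ a b → a :+ b :- b := a) refl (binomial x k) (binomial x (suc k)) ⟩
  binomial x k ∎
  where open +-*-Solver

-- The n-th difference is the constant C(y, 0) = 1, and one further difference removes it.
Δ^-binomial-zero : ∀ n x → Δ^ (suc n) (λ y → binomial y n) x ≡ 0ℚ
Δ^-binomial-zero n x = cong₂ _-_ (lower (suc x)) (lower x)
  where
  lower : ∀ x → Δ^ n (λ y → binomial y n) x ≡ 1ℚ
  lower x = trans (cong (λ j → Δ^ n (λ y → binomial y j) x) (sym (ℕ.+-identityʳ n))) (Δ^-binomial n 0 x)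

-- Closed forms of I and J

ι-- : ∀ i j → ι (i ℤ.- j) ≡ ι i - ι j
ι-- i j = trans (ι-+ i (ℤ.- j)) (cong (λ t → ι i + t) (ι-neg j))

ι-² : ∀ i → ι (i ℤ.^ 2) ≡ ι i * ι i
ι-² i = trans (ι-* i (i ℤ.* 1ℤ)) (cong (λ j → ι i * ι j) (ℤ.*-identityʳ i))

∏-zero : ∀ n f → f 0 ≡ 0ℤ → ∏< (suc n) f ≡ 0ℤ
∏-zero zero    f e = trans (ℤ.*-identityˡ (f 0)) e
∏-zero (suc n) f e = trans (cong (ℤ._* f (suc n)) (∏-zero n f e)) (ℤ.*-zeroˡ (f (suc n)))

-- For ℓ = b the factor m = 0 is b² - b² = 0, so only the empty product survives.
I-diagonal : ∀ b q → I b (b ℕ.+ 0) q ≡ δ₀ q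
I-diagonal b zero    = refl
I-diagonal b (suc q) = trans
  (cong (λ i → (i / (suc q ! ℕ.* suc q !)) {{suc q ℕ.!* suc q !≢0}}) (∏-zero q f f0))
  (0/n≡0 (suc q ! ℕ.* suc q !) {{suc q ℕ.!* suc q !≢0}})
  where
  f : ℕ → ℤ
  f m = (+ (b ℕ.+ 0)) ℤ.^ 2 ℤ.- (+ b ℤ.- + m) ℤ.^ 2
  f0 : f 0 ≡ 0ℤ
  f0 = trans (cong₂ (λ x y → x ℤ.^ 2 ℤ.- y ℤ.^ 2) (cong +_ (ℕ.+-identityʳ b)) (ℤ.+-identityʳ (+ b)))
             (ℤ.+-inverseʳ ((+ b) ℤ.^ 2))

ν-! : ∀ n → ν (suc n !) ≡ ν (suc n) * ν (n !)
ν-! n = ν-* (suc n) (n !)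

-- Of the two linear factors of ℓ² - (b - q)², the factor 2b + 1 + n - q raises the lower index of
-- the first binomial and n + 1 + q raises both indices of the second. The first is a signed
-- difference, so the identity persists after it has passed through 0.
I-product : ∀ b n q →
  ν (q ! ℕ.* q !) * (binomial (suc (b ℕ.+ b) ℕ.+ n) q * binomial (n ℕ.+ q) q)
    ≡ ι (∏< q λ m → (+ (b ℕ.+ suc n)) ℤ.^ 2 ℤ.- (+ b ℤ.- + m) ℤ.^ 2)
I-product b n zero    = refl
I-product b n (suc q) = begin
  ν (suc q ! ℕ.* suc q !) * (binomial M (suc q) * binomial (n ℕ.+ suc q) (suc q))
    ≡⟨ cong₂ (λ x y → x * (binomial M (suc q) * binomial y (suc q)))
         (trans (ν-* (suc q !) (suc q !)) (cong₂ _*_ (ν-! q) (ν-! q))) (ℕ.+-suc n q) ⟩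
  (ν (suc q) * F) * (ν (suc q) * F) * (binomial M (suc q) * binomial (suc (n ℕ.+ q)) (suc q))
    ≡⟨ solve 4 (λ s F x y → (s :* F) :* (s :* F) :* (x :* y) := F :* F :* ((s :* x) :* (s :* y))) refl
         (ν (suc q)) F (binomial M (suc q)) (binomial (suc (n ℕ.+ q)) (suc q)) ⟩
  F * F * ((ν (suc q) * binomial M (suc q)) * (ν (suc q) * binomial (suc (n ℕ.+ q)) (suc q)))
    ≡⟨ cong₂ (λ x y → F * F * (x * y)) (binomial-absorb M q) (binomial-absorb-suc (n ℕ.+ q) q) ⟩
  F * F * (((ν M - ν q) * binomial M q) * (ν (suc (n ℕ.+ q)) * binomial (n ℕ.+ q) q))
    ≡⟨ solve 5 (λ F a x c y → F :* F :* ((a :* x) :* (c :* y)) := F :* F :* (x :* y) :* (a :* c)) refl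
         F (ν M - ν q) (binomial M q) (ν (suc (n ℕ.+ q))) (binomial (n ℕ.+ q) q) ⟩
  F * F * (binomial M q * binomial (n ℕ.+ q) q) * ((ν M - ν q) * ν (suc (n ℕ.+ q)))
    ≡⟨ cong₂ (λ x y → x * (binomial M q * binomial (n ℕ.+ q) q) * y) (sym (ν-* (q !) (q !))) factor ⟩
  ν (q ! ℕ.* q !) * (binomial M q * binomial (n ℕ.+ q) q) * ι (f q)
    ≡⟨ cong (_* ι (f q)) (I-product b n q) ⟩
  ι (∏< q f) * ι (f q)
    ≡⟨ ι-* (∏< q f) (f q) ⟨
  ι (∏< (suc q) f) ∎
  where
  open +-*-Solver
  M : ℕ
  M = suc (b ℕ.+ b) ℕ.+ n
  F : ℚ
  F = ν (q !)
  f : ℕ → ℤ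
  f m = (+ (b ℕ.+ suc n)) ℤ.^ 2 ℤ.- (+ b ℤ.- + m) ℤ.^ 2
  νM : ν M ≡ 1ℚ + (ν b + ν b) + ν n
  νM = trans (ν-+ (suc (b ℕ.+ b)) n) (cong (_+ ν n) (trans (ν-suc (b ℕ.+ b)) (cong (λ t → 1ℚ + t) (ν-+ b b))))
  νℓ : ν (b ℕ.+ suc n) ≡ ν b + (1ℚ + ν n)
  νℓ = trans (ν-+ b (suc n)) (cong (λ t → ν b + t) (ν-suc n))
  factor : (ν M - ν q) * ν (suc (n ℕ.+ q)) ≡ ι (f q)
  factor = begin
    (ν M - ν q) * ν (suc (n ℕ.+ q))
      ≡⟨ cong₂ (λ x y → (x - ν q) * y) νM (trans (ν-suc (n ℕ.+ q)) (cong (λ t → 1ℚ + t) (ν-+ n q))) ⟩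
    (1ℚ + (ν b + ν b) + ν n - ν q) * (1ℚ + (ν n + ν q))
      ≡⟨ solve 3 (λ b n q → (con 1ℚ :+ (b :+ b) :+ n :- q) :* (con 1ℚ :+ (n :+ q))
                          := (b :+ (con 1ℚ :+ n)) :* (b :+ (con 1ℚ :+ n)) :- (b :- q) :* (b :- q)) refl (ν b) (ν n) (ν q) ⟩
    (ν b + (1ℚ + ν n)) * (ν b + (1ℚ + ν n)) - (ν b - ν q) * (ν b - ν q)
      ≡⟨ cong₂ (λ x y → x * x - y * y) νℓ (ι-- (+ b) (+ q)) ⟨
    ν (b ℕ.+ suc n) * ν (b ℕ.+ suc n) - ι (+ b ℤ.- + q) * ι (+ b ℤ.- + q)
      ≡⟨ cong₂ _-_ (ι-² (+ (b ℕ.+ suc n))) (ι-² (+ b ℤ.- + q)) ⟨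
    ι ((+ (b ℕ.+ suc n)) ℤ.^ 2) - ι ((+ b ℤ.- + q) ℤ.^ 2)
      ≡⟨ ι-- ((+ (b ℕ.+ suc n)) ℤ.^ 2) ((+ b ℤ.- + q) ℤ.^ 2) ⟨
    ι (f q) ∎

I-closed : ∀ b n q → I b (b ℕ.+ suc n) q ≡ binomial (suc (b ℕ.+ b) ℕ.+ n) q * binomial (n ℕ.+ q) q
I-closed b n q = /-unique
  (∏< q λ m → (+ (b ℕ.+ suc n)) ℤ.^ 2 ℤ.- (+ b ℤ.- + m) ℤ.^ 2) (q ! ℕ.* q !) {{q ℕ.!* q !≢0}} (I-product b n q)

J-product : ∀ b p →
  ι (∏< p λ m → (+ suc b ℤ.- + m) ℤ.* (+ suc b ℤ.- + m ℤ.- 1ℤ))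
    ≡ (ν (p !) * binomial (suc b) p) * (ν (p !) * binomial b p)
J-product b zero    = refl
J-product b (suc p) = begin
  ι (∏< p f ℤ.* f p)
    ≡⟨ ι-* (∏< p f) (f p) ⟩
  ι (∏< p f) * ι (f p)
    ≡⟨ cong₂ _*_ (J-product b p) factor ⟩
  (F * binomial (suc b) p) * (F * binomial b p) * ((ν (suc b) - ν p) * (ν b - ν p))
    ≡⟨ solve 5 (λ F x y u v → (F :* x) :* (F :* y) :* (u :* v) := (F :* (u :* x)) :* (F :* (v :* y))) refl
         F (binomial (suc b) p) (binomial b p) (ν (suc b) - ν p) (ν b - ν p) ⟩
  (F * ((ν (suc b) - ν p) * binomial (suc b) p)) * (F * ((ν b - ν p) * binomial b p))
    ≡⟨ cong₂ (λ x y → (F * x) * (F * y)) (binomial-absorb (suc b) p) (binomial-absorb b p) ⟨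
  (F * (ν (suc p) * binomial (suc b) (suc p))) * (F * (ν (suc p) * binomial b (suc p)))
    ≡⟨ solve 4 (λ F s x y → (F :* (s :* x)) :* (F :* (s :* y)) := ((s :* F) :* x) :* ((s :* F) :* y)) refl
         F (ν (suc p)) (binomial (suc b) (suc p)) (binomial b (suc p)) ⟩
  ((ν (suc p) * F) * binomial (suc b) (suc p)) * ((ν (suc p) * F) * binomial b (suc p))
    ≡⟨ cong (λ x → (x * binomial (suc b) (suc p)) * (x * binomial b (suc p))) (ν-! p) ⟨
  (ν (suc p !) * binomial (suc b) (suc p)) * (ν (suc p !) * binomial b (suc p)) ∎
  where
  open +-*-Solver
  F : ℚ
  F = ν (p !)
  f : ℕ → ℤ
  f m = (+ suc b ℤ.- + m) ℤ.* (+ suc b ℤ.- + m ℤ.- 1ℤ)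
  factor : ι (f p) ≡ (ν (suc b) - ν p) * (ν b - ν p)
  factor = begin
    ι (f p)
      ≡⟨ ι-* (+ suc b ℤ.- + p) (+ suc b ℤ.- + p ℤ.- 1ℤ) ⟩
    ι (+ suc b ℤ.- + p) * ι (+ suc b ℤ.- + p ℤ.- 1ℤ)
      ≡⟨ cong (ι (+ suc b ℤ.- + p) *_) (ι-- (+ suc b ℤ.- + p) 1ℤ) ⟩
    ι (+ suc b ℤ.- + p) * (ι (+ suc b ℤ.- + p) - 1ℚ)
      ≡⟨ cong (λ x → x * (x - 1ℚ)) (ι-- (+ suc b) (+ p)) ⟩
    (ν (suc b) - ν p) * (ν (suc b) - ν p - 1ℚ)
      ≡⟨ cong (λ x → (ν (suc b) - ν p) * (x - ν p - 1ℚ)) (ν-suc b) ⟩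
    (ν (suc b) - ν p) * (1ℚ + ν b - ν p - 1ℚ)
      ≡⟨ cong ((ν (suc b) - ν p) *_) (solve 2 (λ b p → con 1ℚ :+ b :- p :- con 1ℚ := b :- p) refl (ν b) (ν p)) ⟩
    (ν (suc b) - ν p) * (ν b - ν p) ∎

-- The product in J consists of two falling factorials, of b + 1 and of b. The factor `suc b` turns
-- C(b, p) into (p + 1) C(b+1, p+1), and p + 1 cancels the excess of (p+1)! p! over p! p!.
J-closed : ∀ b p → ν (suc b) * J (suc b) (suc p) ≡ sgn p * (binomial (suc b) (suc p) * binomial (suc b) p)
J-closed b p = ν-cancel D {{suc p ℕ.!* p !≢0}} (begin
  ν D * (ν (suc b) * J (suc b) (suc p))
    ≡⟨ solve 3 (λ D b j → D :* (b :* j) := b :* (D :* j)) refl (ν D) (ν (suc b)) (J (suc b) (suc p)) ⟩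
  ν (suc b) * (ν D * J (suc b) (suc p))
    ≡⟨ cong (ν (suc b) *_) (/-cancel (-1ℤ ℤ.^ (suc p ℕ.+ 1) ℤ.* P) D {{suc p ℕ.!* p !≢0}}) ⟩
  ν (suc b) * ι (-1ℤ ℤ.^ (suc p ℕ.+ 1) ℤ.* P)
    ≡⟨ cong (ν (suc b) *_) (trans (ι-* (-1ℤ ℤ.^ (suc p ℕ.+ 1)) P) (cong₂ _*_ sign (J-product b p))) ⟩
  ν (suc b) * (sgn p * ((F * binomial (suc b) p) * (F * binomial b p)))
    ≡⟨ solve 5 (λ b s F x y → b :* (s :* ((F :* x) :* (F :* y))) := F :* F :* (s :* ((b :* y) :* x))) refl
         (ν (suc b)) (sgn p) F (binomial (suc b) p) (binomial b p) ⟩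
  F * F * (sgn p * ((ν (suc b) * binomial b p) * binomial (suc b) p))
    ≡⟨ cong (λ x → F * F * (sgn p * (x * binomial (suc b) p))) (binomial-absorb-suc b p) ⟨
  F * F * (sgn p * ((ν (suc p) * binomial (suc b) (suc p)) * binomial (suc b) p))
    ≡⟨ solve 5 (λ F s n x y → F :* F :* (s :* ((n :* x) :* y)) := (n :* F) :* F :* (s :* (x :* y))) refl
         F (sgn p) (ν (suc p)) (binomial (suc b) (suc p)) (binomial (suc b) p) ⟩
  (ν (suc p) * F) * F * (sgn p * (binomial (suc b) (suc p) * binomial (suc b) p))
    ≡⟨ cong (_* (sgn p * (binomial (suc b) (suc p) * binomial (suc b) p)))
         (trans (ν-* (suc p !) (p !)) (cong (_* F) (ν-! p))) ⟨
  ν D * (sgn p * (binomial (suc b) (suc p) * binomial (suc b) p)) ∎)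
  where
  open +-*-Solver
  D : ℕ
  D = suc p ! ℕ.* p !
  F : ℚ
  F = ν (p !)
  P : ℤ
  P = ∏< p λ m → (+ suc b ℤ.- + m) ℤ.* (+ suc b ℤ.- + m ℤ.- 1ℤ)
  sign : sgn (suc p ℕ.+ 1) ≡ sgn p
  sign = begin
    sgn (suc p ℕ.+ 1)  ≡⟨ cong sgn (ℕ.+-comm (suc p) 1) ⟩
    sgn (suc (suc p))  ≡⟨ sgn-suc (suc p) ⟩
    - sgn (suc p)      ≡⟨ cong -_ (sgn-suc p) ⟩
    - - sgn p          ≡⟨ solve 1 (λ x → :- (:- x) := x) refl (sgn p) ⟩
    sgn p              ∎

-- The coefficients of x̂

𝟙-yes : {P : Set} (P? : Dec P) → P → 𝟙[ P? ] ≡ 1ℤ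
𝟙-yes P? p = cong (λ t → if t then 1ℤ else 0ℤ) (dec-true P? p)

𝟙-no : {P : Set} (P? : Dec P) → ¬ P → 𝟙[ P? ] ≡ 0ℤ
𝟙-no P? ¬p = cong (λ t → if t then 1ℤ else 0ℤ) (dec-false P? ¬p)

module _ (b : ℕ) where

  Bᶜ : (p ℓ : ℕ) → ℤ
  Bᶜ p ℓ = -1ℤ ℤ.^ (p ∸ ℓ) ℤ.* + ((p ℕ.+ ℓ ∸ 1) C (p ∸ ℓ))

  B-first-column : ∀ p → B b p b ≡ 𝟙[ (p ℕ.≟ b) ×-dec (b ℕ.≟ b) ]
  B-first-column p = trans
    (cong (λ t → 𝟙[ (p ℕ.≟ b) ×-dec (b ℕ.≟ b) ] ℤ.+ Bᶜ p b ℤ.* t)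
      (𝟙-no ((b ℕ.≤? p) ×-dec (b ℕ.<? b)) (λ (_ , lt) → ℕ.<-irrefl refl lt)))
    (trans (cong (λ t → 𝟙[ (p ℕ.≟ b) ×-dec (b ℕ.≟ b) ] ℤ.+ t) (ℤ.*-zeroʳ (Bᶜ p b)))
           (ℤ.+-identityʳ _))

  B-corner : B b b b ≡ 1ℤ
  B-corner = trans (B-first-column b) (𝟙-yes ((b ℕ.≟ b) ×-dec (b ℕ.≟ b)) (refl , refl))

  B-below-corner : ∀ {p} → p ≢ b → B b p b ≡ 0ℤ
  B-below-corner {p} p≢b = trans (B-first-column p) (𝟙-no ((p ℕ.≟ b) ×-dec (b ℕ.≟ b)) (λ (eq , _) → p≢b eq))

  B-upper : ∀ {p ℓ} → p < ℓ → B b p ℓ ≡ 0ℤ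
  B-upper {p} {ℓ} p<ℓ = trans
    (cong₂ (λ s t → s ℤ.+ Bᶜ p ℓ ℤ.* t)
      (𝟙-no ((p ℕ.≟ ℓ) ×-dec (ℓ ℕ.≟ b)) (λ (eq , _) → ℕ.<⇒≢ p<ℓ eq))
      (𝟙-no ((ℓ ℕ.≤? p) ×-dec (b ℕ.<? ℓ)) (λ (le , _) → ℕ.<⇒≱ p<ℓ le)))
    (trans (ℤ.+-identityˡ _) (ℤ.*-zeroʳ (Bᶜ p ℓ)))

  B-lower : ∀ {p ℓ} → ℓ ≤ p → b < ℓ → B b p ℓ ≡ Bᶜ p ℓ
  B-lower {p} {ℓ} ℓ≤p b<ℓ = trans
    (cong₂ (λ s t → s ℤ.+ Bᶜ p ℓ ℤ.* t)
      (𝟙-no ((p ℕ.≟ ℓ) ×-dec (ℓ ℕ.≟ b)) (λ (_ , eq) → ℕ.>⇒≢ b<ℓ eq))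
      (𝟙-yes ((ℓ ℕ.≤? p) ×-dec (b ℕ.<? ℓ)) (ℓ≤p , b<ℓ)))
    (trans (ℤ.+-identityˡ _) (ℤ.*-identityʳ (Bᶜ p ℓ)))

-- The equation for R = 1 + s reads  J b ∘ˢ s = ∑_k X_k (K b k ∘ˢ s);  the
-- term k = 0 is the right-hand side x_b.
K : (b k : ℕ) → ℕ → ℚ
K b zero    q = δ₀ q
K b (suc k) q = let j = b ℕ.+ suc k in
  ⟨ + ((2 ℕ.* j ∸ 1) C (j ℕ.+ b)) ⟩ * binomial (b ℕ.+ j) q

A : (b i k : ℕ) → ℚ
A b i k = ⟨ B b (b ℕ.+ i) (b ℕ.+ k) ⟩

A-triangular : ∀ b i k → i < k → A b i k ≡ 0ℚ
A-triangular b i k i<k = cong ι (B-upper b (ℕ.+-monoʳ-< b i<k))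

A-corner : ∀ b → A b 0 0 ≡ 1ℚ
A-corner b = trans (cong (λ x → ι (B b x x)) (ℕ.+-identityʳ b)) (cong ι (B-corner b))

A-first-column : ∀ b i → A b (suc i) 0 ≡ 0ℚ
A-first-column b i = trans (cong (λ x → ι (B b (b ℕ.+ suc i) x)) (ℕ.+-identityʳ b))
  (cong ι (B-below-corner b (ℕ.>⇒≢ (ℕ.m<m+n b (s≤s z≤n)))))

-- Both sides are the multinomial coefficient with parts t, j and x + j.
choose-regroup : ∀ x j t →
  ((x ℕ.+ j ℕ.+ (j ℕ.+ t)) C t) ℕ.* ((x ℕ.+ j ℕ.+ j) C j)
    ≡ ((j ℕ.+ t) C j) ℕ.* ((x ℕ.+ j ℕ.+ (j ℕ.+ t)) C (j ℕ.+ t))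
choose-regroup x j t = begin
  ((x ℕ.+ j ℕ.+ (j ℕ.+ t)) C t) ℕ.* ((x ℕ.+ j ℕ.+ j) C j)
    ≡⟨ cong₂ (λ u v → (u C t) ℕ.* (v C j)) (e₁ x j t) (e₂ x j) ⟩
  trinomial t j (x ℕ.+ j)
    ≡⟨ trinomial-swap t j (x ℕ.+ j) ⟩
  trinomial j t (x ℕ.+ j)
    ≡⟨ trinomial-revision j t (x ℕ.+ j) ⟨
  ((j ℕ.+ t ℕ.+ (x ℕ.+ j)) C (j ℕ.+ t)) ℕ.* ((j ℕ.+ t) C j)
    ≡⟨ ℕ.*-comm ((j ℕ.+ t ℕ.+ (x ℕ.+ j)) C (j ℕ.+ t)) ((j ℕ.+ t) C j) ⟩
  ((j ℕ.+ t) C j) ℕ.* ((j ℕ.+ t ℕ.+ (x ℕ.+ j)) C (j ℕ.+ t))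
    ≡⟨ cong (λ u → ((j ℕ.+ t) C j) ℕ.* (u C (j ℕ.+ t))) (ℕ.+-comm (j ℕ.+ t) (x ℕ.+ j)) ⟩
  ((j ℕ.+ t) C j) ℕ.* ((x ℕ.+ j ℕ.+ (j ℕ.+ t)) C (j ℕ.+ t)) ∎
  where
  e₁ : ∀ x j t → x ℕ.+ j ℕ.+ (j ℕ.+ t) ≡ t ℕ.+ (j ℕ.+ (x ℕ.+ j))
  e₁ = solve-∀
  e₂ : ∀ x j → x ℕ.+ j ℕ.+ j ≡ j ℕ.+ (x ℕ.+ j)
  e₂ = solve-∀

-- Both sides are the multinomial coefficient with parts n, q and x - q; for q > x both vanish.
binomial-revision : ∀ x n q →
  binomial (x ℕ.+ n) n * binomial x q ≡ binomial (x ℕ.+ n) (n ℕ.+ q) * binomial (n ℕ.+ q) q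
binomial-revision x n q = [ small , large ]′ (ℕ.≤-<-connex q x)
  where
  large : x < q → binomial (x ℕ.+ n) n * binomial x q ≡ binomial (x ℕ.+ n) (n ℕ.+ q) * binomial (n ℕ.+ q) q
  large x<q = trans
    (trans (cong (binomial (x ℕ.+ n) n *_) (binomial-> x<q)) (*-zeroʳ (binomial (x ℕ.+ n) n)))
    (sym (trans (cong (_* binomial (n ℕ.+ q) q)
                  (binomial-> (subst (ℕ._< n ℕ.+ q) (ℕ.+-comm n x) (ℕ.+-monoʳ-< n x<q))))
                (*-zeroˡ (binomial (n ℕ.+ q) q))))
  small : q ≤ x → binomial (x ℕ.+ n) n * binomial x q ≡ binomial (x ℕ.+ n) (n ℕ.+ q) * binomial (n ℕ.+ q) q
  small q≤x = subst
    (λ x → binomial (x ℕ.+ n) n * binomial x q ≡ binomial (x ℕ.+ n) (n ℕ.+ q) * binomial (n ℕ.+ q) q)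
    (ℕ.m+[n∸m]≡n q≤x) (begin
    binomial (q ℕ.+ y ℕ.+ n) n * binomial (q ℕ.+ y) q
      ≡⟨ ν-* ((q ℕ.+ y ℕ.+ n) C n) ((q ℕ.+ y) C q) ⟨
    ν (((q ℕ.+ y ℕ.+ n) C n) ℕ.* ((q ℕ.+ y) C q))
      ≡⟨ cong (λ u → ν ((u C n) ℕ.* ((q ℕ.+ y) C q))) (ℕ.+-comm (q ℕ.+ y) n) ⟩
    ν (trinomial n q y)
      ≡⟨ cong ν (trinomial-revision n q y) ⟨
    ν (((n ℕ.+ q ℕ.+ y) C (n ℕ.+ q)) ℕ.* ((n ℕ.+ q) C n))
      ≡⟨ cong₂ (λ u v → ν ((u C (n ℕ.+ q)) ℕ.* v)) (e n q y) (choose-sym n q) ⟩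
    ν (((q ℕ.+ y ℕ.+ n) C (n ℕ.+ q)) ℕ.* ((n ℕ.+ q) C q))
      ≡⟨ ν-* ((q ℕ.+ y ℕ.+ n) C (n ℕ.+ q)) ((n ℕ.+ q) C q) ⟩
    binomial (q ℕ.+ y ℕ.+ n) (n ℕ.+ q) * binomial (n ℕ.+ q) q ∎)
    where
    y : ℕ
    y = x ∸ q
    e : ∀ n q y → n ℕ.+ q ℕ.+ y ≡ q ℕ.+ y ℕ.+ n
    e = solve-∀

-- Up to the factor C(n+q,q), the summand of an n-th finite difference of y ↦ C(y,n+q).
A*K : ∀ b n j q → j ≤ n →
  A b (suc n) (suc j) * K b (suc j) q
    ≡ binomial (n ℕ.+ q) q * (Δ-coefficient n j * binomial (suc (b ℕ.+ b) ℕ.+ n ℕ.+ j) (n ℕ.+ q))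
A*K b n j q j≤n = begin
  A b (suc n) (suc j) * (ν ((2 ℕ.* (b ℕ.+ suc j) ∸ 1) C (b ℕ.+ suc j ℕ.+ b)) * binomial (b ℕ.+ (b ℕ.+ suc j)) q)
    ≡⟨ cong₂ (λ u v → u * (ν v * binomial (b ℕ.+ (b ℕ.+ suc j)) q)) A-value K-value ⟩
  sgn t * ν ((x ℕ.+ n) C t) * (ν ((x ℕ.+ j) C j) * binomial (b ℕ.+ (b ℕ.+ suc j)) q)
    ≡⟨ cong (λ u → sgn t * ν ((x ℕ.+ n) C t) * (ν ((x ℕ.+ j) C j) * binomial u q)) (e₀ b j) ⟩
  sgn t * ν ((x ℕ.+ n) C t) * (ν ((x ℕ.+ j) C j) * binomial x q)
    ≡⟨ solve 4 (λ s u v w → s :* u :* (v :* w) := s :* (u :* v) :* w) refl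
         (sgn t) (ν ((x ℕ.+ n) C t)) (ν ((x ℕ.+ j) C j)) (binomial x q) ⟩
  sgn t * (ν ((x ℕ.+ n) C t) * ν ((x ℕ.+ j) C j)) * binomial x q
    -- This produces C(n, j), which together with the sign is the weight of an n-th difference. The
    -- remaining dependence on j, in C(x+n, n) C(x, q), is then gathered into one binomial whose
    -- lower index is free of j.
    ≡⟨ cong (λ u → sgn t * u * binomial x q) regroup ⟩
  sgn t * (binomial n j * binomial (x ℕ.+ n) n) * binomial x q
    ≡⟨ solve 4 (λ s u v w → s :* (u :* v) :* w := (s :* u) :* (v :* w)) refl
         (sgn t) (binomial n j) (binomial (x ℕ.+ n) n) (binomial x q) ⟩
  (sgn t * binomial n j) * (binomial (x ℕ.+ n) n * binomial x q)
    ≡⟨ cong₂ _*_ (sym (Δ-coefficient-closed n j)) (binomial-revision x n q) ⟩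
  Δ-coefficient n j * (binomial (x ℕ.+ n) (n ℕ.+ q) * binomial (n ℕ.+ q) q)
    ≡⟨ cong (λ u → Δ-coefficient n j * (binomial u (n ℕ.+ q) * binomial (n ℕ.+ q) q)) (e₁ b j n) ⟩
  Δ-coefficient n j * (binomial (N ℕ.+ n ℕ.+ j) (n ℕ.+ q) * binomial (n ℕ.+ q) q)
    ≡⟨ solve 3 (λ c u v → c :* (u :* v) := v :* (c :* u)) refl
         (Δ-coefficient n j) (binomial (N ℕ.+ n ℕ.+ j) (n ℕ.+ q)) (binomial (n ℕ.+ q) q) ⟩
  binomial (n ℕ.+ q) q * (Δ-coefficient n j * binomial (N ℕ.+ n ℕ.+ j) (n ℕ.+ q)) ∎
  where
  open +-*-Solver
  N x t : ℕ
  N = suc (b ℕ.+ b)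
  x = N ℕ.+ j
  t = n ∸ j
  e₀ : ∀ b j → b ℕ.+ (b ℕ.+ suc j) ≡ suc (b ℕ.+ b) ℕ.+ j
  e₀ = solve-∀
  e₁ : ∀ b j n → suc (b ℕ.+ b) ℕ.+ j ℕ.+ n ≡ suc (b ℕ.+ b) ℕ.+ n ℕ.+ j
  e₁ = solve-∀
  e₂ : ∀ b j n → b ℕ.+ suc n ℕ.+ (b ℕ.+ suc j) ≡ suc (suc (b ℕ.+ b) ℕ.+ j ℕ.+ n)
  e₂ = solve-∀
  e₃ : ∀ b j → 2 ℕ.* (b ℕ.+ suc j) ≡ suc (suc (b ℕ.+ b) ℕ.+ j ℕ.+ j)
  e₃ = solve-∀
  e₄ : ∀ b j → b ℕ.+ suc j ℕ.+ b ≡ suc (b ℕ.+ b) ℕ.+ j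
  e₄ = solve-∀
  A-value : A b (suc n) (suc j) ≡ sgn t * ν ((x ℕ.+ n) C t)
  A-value = begin
    ι (B b (b ℕ.+ suc n) (b ℕ.+ suc j))
      ≡⟨ cong ι (B-lower b (ℕ.+-monoʳ-≤ b (s≤s j≤n)) (ℕ.m<m+n b (s≤s z≤n))) ⟩
    ι (-1ℤ ℤ.^ (b ℕ.+ suc n ∸ (b ℕ.+ suc j)) ℤ.* + ((b ℕ.+ suc n ℕ.+ (b ℕ.+ suc j) ∸ 1) C (b ℕ.+ suc n ∸ (b ℕ.+ suc j))))
      ≡⟨ cong₂ (λ u v → ι (-1ℤ ℤ.^ u ℤ.* + ((v ∸ 1) C u))) (ℕ.[m+n]∸[m+o]≡n∸o b (suc n) (suc j)) (e₂ b j n) ⟩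
    ι (-1ℤ ℤ.^ t ℤ.* + ((x ℕ.+ n) C t))
      ≡⟨ ι-* (-1ℤ ℤ.^ t) (+ ((x ℕ.+ n) C t)) ⟩
    sgn t * ν ((x ℕ.+ n) C t) ∎
  K-value : (2 ℕ.* (b ℕ.+ suc j) ∸ 1) C (b ℕ.+ suc j ℕ.+ b) ≡ (x ℕ.+ j) C j
  K-value = trans (cong₂ (λ u v → (u ∸ 1) C v) (e₃ b j) (e₄ b j)) (choose-sym x j)
  regroup : ν ((x ℕ.+ n) C t) * ν ((x ℕ.+ j) C j) ≡ binomial n j * binomial (x ℕ.+ n) n
  regroup = begin
    ν ((x ℕ.+ n) C t) * ν ((x ℕ.+ j) C j)
      ≡⟨ ν-* ((x ℕ.+ n) C t) ((x ℕ.+ j) C j) ⟨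
    ν (((x ℕ.+ n) C t) ℕ.* ((x ℕ.+ j) C j))
      ≡⟨ cong ν (subst (λ n → ((x ℕ.+ n) C t) ℕ.* ((x ℕ.+ j) C j) ≡ (n C j) ℕ.* ((x ℕ.+ n) C n))
           (ℕ.m+[n∸m]≡n j≤n) (choose-regroup N j t)) ⟩
    ν ((n C j) ℕ.* ((x ℕ.+ n) C n))
      ≡⟨ ν-* (n C j) ((x ℕ.+ n) C n) ⟩
    binomial n j * binomial (x ℕ.+ n) n ∎

-- The column k = 0 meets only the row i = 0, since x_b = x̂_b. In a row n + 1 the remaining terms
-- form an n-th difference of y ↦ C(y, n+q), taken at y = 2b + 1 + n.
∑A*K≡I : ∀ b i q w → i < w → ∑< w (λ k → A b i k * K b k q) ≡ I b (b ℕ.+ i) q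
∑A*K≡I b zero q w 0<w = begin
  ∑< w (λ k → A b 0 k * K b k q)
    ≡⟨ ∑-single {w} {0} {λ k → A b 0 k * K b k q} 0<w (λ where
         zero    _ k≢0 → ⊥-elim (k≢0 refl)
         (suc k) _ _   → trans (cong (_* K b (suc k) q) (A-triangular b 0 (suc k) (s≤s z≤n))) (*-zeroˡ (K b (suc k) q))) ⟩
  A b 0 0 * δ₀ q      ≡⟨ cong (_* δ₀ q) (A-corner b) ⟩
  1ℚ * δ₀ q           ≡⟨ *-identityˡ (δ₀ q) ⟩
  δ₀ q                ≡⟨ I-diagonal b q ⟨
  I b (b ℕ.+ 0) q     ∎
∑A*K≡I b (suc n) q w n<w = begin
  ∑< w (λ k → A b (suc n) k * K b k q)
    ≡⟨ ∑-extend n<w (λ k n<k _ →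
         trans (cong (_* K b k q) (A-triangular b (suc n) k n<k)) (*-zeroˡ (K b k q))) ⟩
  ∑≤ (suc n) (λ k → A b (suc n) k * K b k q)
    ≡⟨ ∑-first (suc n) (λ k → A b (suc n) k * K b k q) ⟩
  A b (suc n) 0 * δ₀ q + ∑≤ n (λ j → A b (suc n) (suc j) * K b (suc j) q)
    ≡⟨ cong₂ _+_ (trans (cong (_* δ₀ q) (A-first-column b n)) (*-zeroˡ (δ₀ q)))
                 (∑-cong (suc n) λ { j (s≤s j≤n) → A*K b n j q j≤n }) ⟩
  0ℚ + ∑≤ n (λ j → binomial (n ℕ.+ q) q * (Δ-coefficient n j * f (N ℕ.+ n ℕ.+ j)))
    ≡⟨ +-identityˡ _ ⟩
  ∑≤ n (λ j → binomial (n ℕ.+ q) q * (Δ-coefficient n j * f (N ℕ.+ n ℕ.+ j)))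
    ≡⟨ ∑-*ˡ (suc n) (binomial (n ℕ.+ q) q) (λ j → Δ-coefficient n j * f (N ℕ.+ n ℕ.+ j)) ⟨
  binomial (n ℕ.+ q) q * ∑≤ n (λ j → Δ-coefficient n j * f (N ℕ.+ n ℕ.+ j))
    ≡⟨ cong (binomial (n ℕ.+ q) q *_) (trans (Δ^-sum n f (N ℕ.+ n)) (Δ^-binomial n q (N ℕ.+ n))) ⟩
  binomial (n ℕ.+ q) q * binomial (N ℕ.+ n) q
    ≡⟨ *-comm (binomial (n ℕ.+ q) q) (binomial (N ℕ.+ n) q) ⟩
  binomial (N ℕ.+ n) q * binomial (n ℕ.+ q) q
    ≡⟨ I-closed b n q ⟨
  I b (b ℕ.+ suc n) q ∎
  where
  N : ℕ
  N = suc (b ℕ.+ b)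
  f : ℕ → ℚ
  f y = binomial y (n ℕ.+ q)

-- The Taylor expansion of Z at r = 1

Z₀-coefficient : ℕ → ℕ → ℚ
Z₀-coefficient b ℓ = ⟨ -1ℤ ℤ.^ (b ∸ ℓ) ℤ.* + ((b ℕ.+ ℓ) C (2 ℕ.* ℓ)) ⟩ * Cat ℓ

choose-double : ∀ ℓ k → ((ℓ ℕ.+ k ℕ.+ ℓ) C (2 ℕ.* ℓ)) ℕ.* ((2 ℕ.* ℓ) C ℓ) ≡ ((ℓ ℕ.+ k ℕ.+ ℓ) C ℓ) ℕ.* ((ℓ ℕ.+ k) C ℓ)
choose-double ℓ k = begin
  ((ℓ ℕ.+ k ℕ.+ ℓ) C (2 ℕ.* ℓ)) ℕ.* ((2 ℕ.* ℓ) C ℓ)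
    ≡⟨ cong₂ (λ u v → (u C v) ℕ.* (v C ℓ)) (e ℓ k) (cong (ℓ ℕ.+_) (ℕ.+-identityʳ ℓ)) ⟩
  ((ℓ ℕ.+ ℓ ℕ.+ k) C (ℓ ℕ.+ ℓ)) ℕ.* ((ℓ ℕ.+ ℓ) C ℓ)
    ≡⟨ trinomial-revision ℓ ℓ k ⟩
  trinomial ℓ ℓ k
    ≡⟨ cong (λ u → (u C ℓ) ℕ.* ((ℓ ℕ.+ k) C ℓ)) (ℕ.+-comm ℓ (ℓ ℕ.+ k)) ⟩
  ((ℓ ℕ.+ k ℕ.+ ℓ) C ℓ) ℕ.* ((ℓ ℕ.+ k) C ℓ) ∎
  where
  e : ∀ ℓ k → ℓ ℕ.+ k ℕ.+ ℓ ≡ ℓ ℕ.+ ℓ ℕ.+ k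
  e = solve-∀

-- The denominator ℓ + 1 of the Catalan number is absorbed by (b + 1) C(b+1+ℓ, ℓ) = (ℓ + 1) C(b+1+ℓ,
-- b). What results is a difference weight C(b+1, ℓ) times a polynomial of degree b in ℓ.
ν*Cat : ∀ b ℓ → ℓ ≤ suc b →
  ν (suc b) * (binomial (suc b ℕ.+ ℓ) (2 ℕ.* ℓ) * Cat ℓ) ≡ binomial (suc b) ℓ * binomial (suc b ℕ.+ ℓ) b
ν*Cat b ℓ ℓ≤b = ν-cancel (suc ℓ) (begin
  ν (suc ℓ) * (ν (suc b) * (c * Cat ℓ))
    ≡⟨ solve 4 (λ l b c x → l :* (b :* (c :* x)) := b :* (c :* (l :* x))) refl (ν (suc ℓ)) (ν (suc b)) c (Cat ℓ) ⟩
  ν (suc b) * (c * (ν (suc ℓ) * Cat ℓ))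
    ≡⟨ cong (λ x → ν (suc b) * (c * x)) (/-cancel (+ ((2 ℕ.* ℓ) C ℓ)) (suc ℓ)) ⟩
  ν (suc b) * (c * binomial (2 ℕ.* ℓ) ℓ)
    ≡⟨ cong (ν (suc b) *_) (trans (sym (ν-* ((suc b ℕ.+ ℓ) C (2 ℕ.* ℓ)) ((2 ℕ.* ℓ) C ℓ))) (trans (cong ν double)
         (ν-* ((suc b ℕ.+ ℓ) C ℓ) (suc b C ℓ)))) ⟩
  ν (suc b) * (binomial (suc b ℕ.+ ℓ) ℓ * binomial (suc b) ℓ)
    ≡⟨ solve 3 (λ b x y → b :* (x :* y) := y :* (b :* x)) refl (ν (suc b)) (binomial (suc b ℕ.+ ℓ) ℓ) (binomial (suc b) ℓ) ⟩
  binomial (suc b) ℓ * (ν (suc b) * binomial (suc b ℕ.+ ℓ) ℓ)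
    ≡⟨ cong (λ x → binomial (suc b) ℓ * (x * binomial (suc b ℕ.+ ℓ) ℓ)) difference ⟩
  binomial (suc b) ℓ * ((ν (suc b ℕ.+ ℓ) - ν ℓ) * binomial (suc b ℕ.+ ℓ) ℓ)
    ≡⟨ cong (binomial (suc b) ℓ *_) (binomial-absorb (suc b ℕ.+ ℓ) ℓ) ⟨
  binomial (suc b) ℓ * (ν (suc ℓ) * binomial (suc b ℕ.+ ℓ) (suc ℓ))
    ≡⟨ cong (λ x → binomial (suc b) ℓ * (ν (suc ℓ) * ν x)) flip ⟩
  binomial (suc b) ℓ * (ν (suc ℓ) * binomial (suc b ℕ.+ ℓ) b)
    ≡⟨ solve 3 (λ x l y → x :* (l :* y) := l :* (x :* y)) refl (binomial (suc b) ℓ) (ν (suc ℓ)) (binomial (suc b ℕ.+ ℓ) b) ⟩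
  ν (suc ℓ) * (binomial (suc b) ℓ * binomial (suc b ℕ.+ ℓ) b) ∎)
  where
  open +-*-Solver
  c : ℚ
  c = binomial (suc b ℕ.+ ℓ) (2 ℕ.* ℓ)
  double : ((suc b ℕ.+ ℓ) C (2 ℕ.* ℓ)) ℕ.* ((2 ℕ.* ℓ) C ℓ) ≡ ((suc b ℕ.+ ℓ) C ℓ) ℕ.* (suc b C ℓ)
  double = subst (λ n → ((n ℕ.+ ℓ) C (2 ℕ.* ℓ)) ℕ.* ((2 ℕ.* ℓ) C ℓ) ≡ ((n ℕ.+ ℓ) C ℓ) ℕ.* (n C ℓ))
    (ℕ.m+[n∸m]≡n ℓ≤b) (choose-double ℓ (suc b ∸ ℓ))
  difference : ν (suc b) ≡ ν (suc b ℕ.+ ℓ) - ν ℓ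
  difference = trans (solve 2 (λ x y → x := x :+ y :- y) refl (ν (suc b)) (ν ℓ))
    (cong (_- ν ℓ) (sym (ν-+ (suc b) ℓ)))
  flip : (suc b ℕ.+ ℓ) C suc ℓ ≡ (suc b ℕ.+ ℓ) C b
  flip = subst (λ n → n C suc ℓ ≡ n C b) (ℕ.+-suc b ℓ) (sym (choose-sym b (suc ℓ)))

-- Both sides are the multinomial coefficient with parts ℓ, q and b - ℓ - q, and both vanish if ℓ +
-- q > b. The right-hand side frees one factor from ℓ and leaves the weight of a difference of order
-- b - q.
binomial-select : ∀ {b ℓ} q → ℓ ≤ b → q ≤ b →
  binomial b ℓ * binomial (b ∸ ℓ) q ≡ binomial b q * binomial (b ∸ q) ℓ
binomial-select {b} {ℓ} q ℓ≤b q≤b = [ small , large ]′ (ℕ.≤-<-connex q (b ∸ ℓ))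
  where
  large : b ∸ ℓ < q → binomial b ℓ * binomial (b ∸ ℓ) q ≡ binomial b q * binomial (b ∸ q) ℓ
  large lt = trans
    (trans (cong (binomial b ℓ *_) (binomial-> lt)) (*-zeroʳ (binomial b ℓ)))
    (sym (trans (cong (binomial b q *_) (binomial-> b∸q<ℓ)) (*-zeroʳ (binomial b q))))
    where
    b∸q<ℓ : b ∸ q < ℓ
    b∸q<ℓ = ℕ.+-cancelˡ-< q (b ∸ q) ℓ (subst₂ _<_
      (trans (ℕ.m+[n∸m]≡n ℓ≤b) (sym (ℕ.m+[n∸m]≡n q≤b))) (ℕ.+-comm ℓ q) (ℕ.+-monoʳ-< ℓ lt))
  small : q ≤ b ∸ ℓ → binomial b ℓ * binomial (b ∸ ℓ) q ≡ binomial b q * binomial (b ∸ q) ℓ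
  small q≤ = subst (λ b → binomial b ℓ * binomial (b ∸ ℓ) q ≡ binomial b q * binomial (b ∸ q) ℓ) s≡b (begin
    binomial s ℓ * binomial (s ∸ ℓ) q
      ≡⟨ cong (λ u → binomial s ℓ * binomial u q) (ℕ.m+n∸m≡n ℓ (q ℕ.+ y)) ⟩
    binomial s ℓ * binomial (q ℕ.+ y) q
      ≡⟨ ν-* (s C ℓ) ((q ℕ.+ y) C q) ⟨
    ν (trinomial ℓ q y)
      ≡⟨ cong ν (trinomial-swap ℓ q y) ⟩
    ν (trinomial q ℓ y)
      ≡⟨ ν-* ((q ℕ.+ (ℓ ℕ.+ y)) C q) ((ℓ ℕ.+ y) C ℓ) ⟩
    binomial (q ℕ.+ (ℓ ℕ.+ y)) q * binomial (ℓ ℕ.+ y) ℓ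
      ≡⟨ cong₂ (λ u v → binomial u q * binomial v ℓ) (e q ℓ y)
           (sym (trans (cong (_∸ q) (sym (e q ℓ y))) (ℕ.m+n∸m≡n q (ℓ ℕ.+ y)))) ⟩
    binomial s q * binomial (s ∸ q) ℓ ∎)
    where
    y s : ℕ
    y = b ∸ ℓ ∸ q
    s = ℓ ℕ.+ (q ℕ.+ y)
    s≡b : s ≡ b
    s≡b = trans (cong (ℓ ℕ.+_) (ℕ.m+[n∸m]≡n q≤)) (ℕ.m+[n∸m]≡n ℓ≤b)
    e : ∀ q ℓ y → q ℕ.+ (ℓ ℕ.+ y) ≡ ℓ ℕ.+ (q ℕ.+ y)
    e = solve-∀

sgn*binomial : ∀ {b q ℓ} → q ≤ b → sgn (b ∸ ℓ) * binomial (b ∸ q) ℓ ≡ sgn q * Δ-coefficient (b ∸ q) ℓ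
sgn*binomial {b} {q} {ℓ} q≤b = [ small , large ]′ (ℕ.≤-<-connex ℓ (b ∸ q))
  where
  large : b ∸ q < ℓ → sgn (b ∸ ℓ) * binomial (b ∸ q) ℓ ≡ sgn q * Δ-coefficient (b ∸ q) ℓ
  large lt = trans
    (trans (cong (sgn (b ∸ ℓ) *_) (binomial-> lt)) (*-zeroʳ (sgn (b ∸ ℓ))))
    (sym (trans (cong (sgn q *_) (Δ-coefficient-> lt)) (*-zeroʳ (sgn q))))
  small : ℓ ≤ b ∸ q → sgn (b ∸ ℓ) * binomial (b ∸ q) ℓ ≡ sgn q * Δ-coefficient (b ∸ q) ℓ
  small ℓ≤ = begin
    sgn (b ∸ ℓ) * binomial (b ∸ q) ℓ
      ≡⟨ cong (λ n → sgn n * binomial (b ∸ q) ℓ)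
           (trans (cong (_∸ ℓ) (sym (ℕ.m+[n∸m]≡n q≤b))) (ℕ.+-∸-assoc q ℓ≤)) ⟩
    sgn (q ℕ.+ (b ∸ q ∸ ℓ)) * binomial (b ∸ q) ℓ
      ≡⟨ cong (_* binomial (b ∸ q) ℓ) (sgn-+ q (b ∸ q ∸ ℓ)) ⟩
    sgn q * sgn (b ∸ q ∸ ℓ) * binomial (b ∸ q) ℓ
      ≡⟨ *-assoc (sgn q) (sgn (b ∸ q ∸ ℓ)) (binomial (b ∸ q) ℓ) ⟩
    sgn q * (sgn (b ∸ q ∸ ℓ) * binomial (b ∸ q) ℓ)
      ≡⟨ cong (sgn q *_) (Δ-coefficient-closed (b ∸ q) ℓ) ⟨
    sgn q * Δ-coefficient (b ∸ q) ℓ ∎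

ν*Z₀-coefficient : ∀ b ℓ q → ℓ ≤ suc b → q ≤ suc b →
  ν (suc b) * (Z₀-coefficient (suc b) ℓ * binomial (suc b ∸ ℓ) q)
    ≡ binomial (suc b) q * sgn q * (Δ-coefficient (suc b ∸ q) ℓ * binomial (suc b ℕ.+ ℓ) b)
ν*Z₀-coefficient b ℓ q ℓ≤ q≤ = begin
  ν (suc b) * (ι (-1ℤ ℤ.^ (suc b ∸ ℓ) ℤ.* + ((suc b ℕ.+ ℓ) C (2 ℕ.* ℓ))) * Cat ℓ * y)
    ≡⟨ cong (λ x → ν (suc b) * (x * Cat ℓ * y)) (ι-* (-1ℤ ℤ.^ (suc b ∸ ℓ)) (+ ((suc b ℕ.+ ℓ) C (2 ℕ.* ℓ)))) ⟩
  ν (suc b) * (σ * c * Cat ℓ * y)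
    ≡⟨ solve 5 (λ b s c x y → b :* (s :* c :* x :* y) := s :* (b :* (c :* x)) :* y) refl (ν (suc b)) σ c (Cat ℓ) y ⟩
  σ * (ν (suc b) * (c * Cat ℓ)) * y
    ≡⟨ cong (λ x → σ * x * y) (ν*Cat b ℓ ℓ≤) ⟩
  σ * (binomial (suc b) ℓ * z) * y
    ≡⟨ solve 4 (λ s x z y → s :* (x :* z) :* y := s :* (x :* y) :* z) refl σ (binomial (suc b) ℓ) z y ⟩
  σ * (binomial (suc b) ℓ * y) * z
    ≡⟨ cong (λ x → σ * x * z) (binomial-select q ℓ≤ q≤) ⟩
  σ * (binomial (suc b) q * binomial (suc b ∸ q) ℓ) * z
    ≡⟨ solve 4 (λ s x y z → s :* (x :* y) :* z := x :* (s :* y) :* z) refl σ (binomial (suc b) q) (binomial (suc b ∸ q) ℓ) z ⟩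
  binomial (suc b) q * (σ * binomial (suc b ∸ q) ℓ) * z
    ≡⟨ cong (λ x → binomial (suc b) q * x * z) (sgn*binomial {suc b} {q} {ℓ} q≤) ⟩
  binomial (suc b) q * (sgn q * Δ-coefficient (suc b ∸ q) ℓ) * z
    ≡⟨ solve 4 (λ x s d z → x :* (s :* d) :* z := x :* s :* (d :* z)) refl (binomial (suc b) q) (sgn q) (Δ-coefficient (suc b ∸ q) ℓ) z ⟩
  binomial (suc b) q * sgn q * (Δ-coefficient (suc b ∸ q) ℓ * z) ∎
  where
  open +-*-Solver
  σ c y z : ℚ
  σ = sgn (suc b ∸ ℓ)
  c = binomial (suc b ℕ.+ ℓ) (2 ℕ.* ℓ)
  y = binomial (suc b ∸ ℓ) q
  z = binomial (suc b ℕ.+ ℓ) b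

ν*∑Z₀ : ∀ b q → q ≤ suc b →
  ν (suc b) * ∑≤ (suc b) (λ ℓ → Z₀-coefficient (suc b) ℓ * binomial (suc b ∸ ℓ) q)
    ≡ binomial (suc b) q * sgn q * Δ^ (suc b ∸ q) (λ y → binomial y b) (suc b)
ν*∑Z₀ b q q≤ = begin
  ν (suc b) * ∑≤ (suc b) (λ ℓ → Z₀-coefficient (suc b) ℓ * binomial (suc b ∸ ℓ) q)
    ≡⟨ ∑-*ˡ (suc (suc b)) (ν (suc b)) (λ ℓ → Z₀-coefficient (suc b) ℓ * binomial (suc b ∸ ℓ) q) ⟩
  ∑≤ (suc b) (λ ℓ → ν (suc b) * (Z₀-coefficient (suc b) ℓ * binomial (suc b ∸ ℓ) q))
    ≡⟨ ∑-cong (suc (suc b)) (λ { ℓ (s≤s ℓ≤) → ν*Z₀-coefficient b ℓ q ℓ≤ q≤ }) ⟩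
  ∑≤ (suc b) (λ ℓ → c * t ℓ)
    ≡⟨ ∑-*ˡ (suc (suc b)) c t ⟨
  c * ∑≤ (suc b) t
    ≡⟨ cong (c *_) (∑-extend (s≤s (ℕ.m∸n≤m (suc b) q)) λ ℓ lt _ →
         trans (cong (_* binomial (suc b ℕ.+ ℓ) b) (Δ-coefficient-> lt)) (*-zeroˡ (binomial (suc b ℕ.+ ℓ) b))) ⟩
  c * ∑≤ (suc b ∸ q) t
    ≡⟨ cong (c *_) (Δ^-sum (suc b ∸ q) (λ y → binomial y b) (suc b)) ⟩
  c * Δ^ (suc b ∸ q) (λ y → binomial y b) (suc b) ∎
  where
  c : ℚ
  c = binomial (suc b) q * sgn q
  t : ℕ → ℚ
  t ℓ = Δ-coefficient (suc b ∸ q) ℓ * binomial (suc b ℕ.+ ℓ) b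

-- For q = 0 a difference of order b + 1 annihilates a polynomial of degree b; this says that r = 1
-- is the solution at x = 0. For q = p + 1 ≤ b + 1 the difference of order b - p of C(y, b) at y = b
-- + 1 is C(b+1, p). For larger q both sides are 0, as the powers of r do not exceed b + 1.
∑Z₀≡-J : ∀ b q → ∑≤ (suc b) (λ ℓ → Z₀-coefficient (suc b) ℓ * binomial (suc b ∸ ℓ) q) ≡ - J (suc b) q
∑Z₀≡-J b zero = ν-cancel (suc b) (begin
  ν (suc b) * ∑≤ (suc b) (λ ℓ → Z₀-coefficient (suc b) ℓ * binomial (suc b ∸ ℓ) 0)
    ≡⟨ ν*∑Z₀ b 0 z≤n ⟩
  binomial (suc b) 0 * sgn 0 * Δ^ (suc b) (λ y → binomial y b) (suc b)
    ≡⟨ cong (binomial (suc b) 0 * sgn 0 *_) (Δ^-binomial-zero b (suc b)) ⟩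
  binomial (suc b) 0 * sgn 0 * 0ℚ
    ≡⟨ *-zeroʳ (binomial (suc b) 0 * sgn 0) ⟩
  0ℚ
    ≡⟨ *-zeroʳ (ν (suc b)) ⟨
  ν (suc b) * - 0ℚ ∎)
∑Z₀≡-J b (suc p) = ν-cancel (suc b) (trans ([ small , large ]′ (ℕ.≤-<-connex p b)) (sym J-side))
  where
  open +-*-Solver
  u v lhs : ℚ
  u = binomial (suc b) (suc p)
  v = binomial (suc b) p
  lhs = ∑≤ (suc b) (λ ℓ → Z₀-coefficient (suc b) ℓ * binomial (suc b ∸ ℓ) (suc p))
  J-side : ν (suc b) * - J (suc b) (suc p) ≡ - (sgn p * (u * v))
  J-side = trans (solve 2 (λ b j → b :* (:- j) := :- (b :* j)) refl (ν (suc b)) (J (suc b) (suc p)))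
                 (cong -_ (J-closed b p))
  small : p ≤ b → ν (suc b) * lhs ≡ - (sgn p * (u * v))
  small p≤b = begin
    ν (suc b) * lhs
      ≡⟨ ν*∑Z₀ b (suc p) (s≤s p≤b) ⟩
    u * sgn (suc p) * Δ^ (b ∸ p) (λ y → binomial y b) (suc b)
      ≡⟨ cong (λ k → u * sgn (suc p) * Δ^ (b ∸ p) (λ y → binomial y k) (suc b)) (ℕ.m∸n+n≡m p≤b) ⟨
    u * sgn (suc p) * Δ^ (b ∸ p) (λ y → binomial y (b ∸ p ℕ.+ p)) (suc b)
      ≡⟨ cong₂ (λ s d → u * s * d) (sgn-suc p) (Δ^-binomial (b ∸ p) p (suc b)) ⟩
    u * - sgn p * v
      ≡⟨ solve 3 (λ u s v → u :* (:- s) :* v := :- (s :* (u :* v))) refl u (sgn p) v ⟩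
    - (sgn p * (u * v)) ∎
  large : b < p → ν (suc b) * lhs ≡ - (sgn p * (u * v))
  large b<p = trans
    (trans (cong (ν (suc b) *_) (∑-zero (suc (suc b)) λ ℓ _ →
              trans (cong (Z₀-coefficient (suc b) ℓ *_) (binomial-> (ℕ.≤-<-trans (ℕ.m∸n≤m (suc b) ℓ) (s≤s b<p))))
                    (*-zeroʳ (Z₀-coefficient (suc b) ℓ))))
           (*-zeroʳ (ν (suc b))))
    (sym (trans (cong (λ u → - (sgn p * (u * v))) (binomial-> (s≤s b<p)))
                (solve 2 (λ s v → :- (s :* (con 0ℚ :* v)) := con 0ℚ) refl (sgn p) v)))

-- For b = 0 the part of Z without x is r - 1, and J(0; s) = s because from p = 2 on the product
-- contains the factor m = 0. For b > 0 the indicator vanishes and only the Catalan sum remains.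
Z₀-Taylor : ∀ b q →
  ⟨ 𝟙[ b ℕ.≟ 0 ] ⟩ * binomial 1 q - ∑≤ b (λ ℓ → Z₀-coefficient b ℓ * binomial (b ∸ ℓ) q) ≡ J b q
Z₀-Taylor zero zero          = refl
Z₀-Taylor zero (suc zero)    = refl
Z₀-Taylor zero (suc (suc p)) = sym (trans
  (cong (λ i → (i / D) {{nz}}) (trans
    (cong (-1ℤ ℤ.^ (suc (suc p) ℕ.+ 1) ℤ.*_) (∏-zero p (λ m → (+ 0 ℤ.- + m) ℤ.* (+ 0 ℤ.- + m ℤ.- 1ℤ)) refl))
    (ℤ.*-zeroʳ (-1ℤ ℤ.^ (suc (suc p) ℕ.+ 1)))))
  (0/n≡0 D {{nz}}))
  where
  D : ℕ
  D = suc (suc p) ! ℕ.* suc p !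
  nz : NonZero D
  nz = suc (suc p) ℕ.!* suc p !≢0
Z₀-Taylor (suc b) q = trans
  (cong (λ t → 0ℚ * binomial 1 q - t) (∑Z₀≡-J b q))
  (solve 2 (λ x j → con 0ℚ :* x :- (:- j) := j) refl (binomial 1 q) (J (suc b) q))
  where open +-*-Solver

-- The equations for R and R̂

∘ˢ-congʳ : ∀ c {s t} → s ≗ t → c ∘ˢ s ≗ c ∘ˢ t
∘ˢ-congʳ c {s} {t} e m = agree-∘ˢ {suc (deg m)} {s} {t} c (λ k _ → e k) m ℕ.≤-refl

⊗-congʳ-≗ : ∀ f {g h} → g ≗ h → f ⊗ g ≗ f ⊗ h
⊗-congʳ-≗ f e m = convolve-congʳ (exps m) ⌊ f ⌋ (λ γ → e (mono γ))

∑X-cong : ∀ s {F G : ℕ → FPS} → (∀ k → F (s ℕ.+ k) ≗ G (s ℕ.+ k)) → ∑X≥ s F ≗ ∑X≥ s G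
∑X-cong s e m = ∑-cong (width m ∸ s) λ k _ → ⊗-congʳ-≗ (X (s ℕ.+ k)) (e k) m

∑X-first : ∀ F m → ∑X≥ 0 F m ≡ (X 0 ⊗ F 0) m + ∑X≥ 1 F m
∑X-first F m = go (width m) refl
  where
  t : ℕ → ℚ
  t k = (X k ⊗ F k) m
  go : ∀ w → width m ≡ w → ∑< w t ≡ t 0 + ∑< (w ∸ 1) (λ k → t (suc k))
  -- For width 0 both sums are empty, and the split-off term vanishes because X_0 does not occur in
  -- m.
  go zero    e = sym (cong (_+ 0ℚ) (X⊗-width 0 (F 0) m (ℕ.≤-reflexive e)))
  go (suc w) e = ∑-first w t

module _ {c : ℕ → ℚ} {F : ℕ → ℕ → ℚ} where
  open Solves

  solves-resp-≗ : ∀ {s t} → s ≗ t → Solves c F s → Solves c F t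
  solves-resp-≗ e h .constant-term = trans (sym (e 𝟏)) (constant-term h)
  solves-resp-≗ {s} {t} e h .equation m = begin
    (c ∘ˢ t) m                   ≡⟨ ∘ˢ-congʳ c {s} {t} e m ⟨
    (c ∘ˢ s) m                   ≡⟨ equation h m ⟩
    ∑X≥ 0 (λ k → F k ∘ˢ s) m     ≡⟨ ∑X-cong 0 {λ k → F k ∘ˢ s} {λ k → F k ∘ˢ t} (λ k → ∘ˢ-congʳ (F k) {s} {t} e) m ⟩
    ∑X≥ 0 (λ k → F k ∘ˢ t) m     ∎

decompose : ∀ R → R ≗ const 1ℚ ⊕ (R ⊖ const 1ℚ)
decompose R m = solve 2 (λ x y → x := y :+ (x :- y)) refl (R m) (const 1ℚ m)
  where open +-*-Solver

module _ (b : ℕ) where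
  open Solves

  ∑X≥1K : FPS → FPS
  ∑X≥1K s = ∑X≥ 1 λ k → K b k ∘ˢ s

  module _ {R s : FPS} (s0 : s 𝟏 ≡ 0ℚ) (R≗1+s : R ≗ const 1ℚ ⊕ s) where

    Z-expansion : ∀ m → Z b R m ≡ (J b ∘ˢ s) m - ∑X≥1K s m
    Z-expansion m = cong₂ _-_ polynomial (∑-cong (width m ∸ 1) λ k _ →
        ⊗-congʳ-≗ (X (suc k)) {g = λ n → coefficient k * (R ^ exponent k) n} (tail-term k) m)
      where
      u : ℚ
      u = ⟨ 𝟙[ b ℕ.≟ 0 ] ⟩
      exponent : ℕ → ℕ
      exponent k = b ℕ.+ (b ℕ.+ suc k)
      coefficient : ℕ → ℚ
      coefficient k = ⟨ + ((2 ℕ.* (b ℕ.+ suc k) ∸ 1) C (b ℕ.+ suc k ℕ.+ b)) ⟩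
      tail-term : ∀ k n → coefficient k * (R ^ exponent k) n ≡ (K b (suc k) ∘ˢ s) n
      tail-term k n = trans (cong (coefficient k *_) (binomial-theorem (exponent k) s0 R≗1+s n))
        (sym (∘ˢ-* (coefficient k) (binomial (exponent k)) s n))
      z : ℕ → ℕ → ℚ
      z ℓ q = Z₀-coefficient b ℓ * binomial (b ∸ ℓ) q
      -- The Taylor identity with the polynomial moved to the other side, so that only sums have to
      -- be composed with s.
      split : ∀ q → u * binomial 1 q ≡ J b q + ∑≤ b (λ ℓ → z ℓ q)
      split q = trans
        (solve 2 (λ x y → x := x :- y :+ y) refl (u * binomial 1 q) (∑≤ b λ ℓ → z ℓ q))
        (cong (_+ ∑≤ b (λ ℓ → z ℓ q)) (Z₀-Taylor b q))
        where open +-*-Solver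
      linear : u * R m ≡ (J b ∘ˢ s) m + ∑≤ b (λ ℓ → (z ℓ ∘ˢ s) m)
      linear = begin
        u * R m
          ≡⟨ cong (u *_) (trans (sym (⊗-identityʳ R m)) (binomial-theorem 1 s0 R≗1+s m)) ⟩
        u * (binomial 1 ∘ˢ s) m
          ≡⟨ ∘ˢ-* u (binomial 1) s m ⟨
        ((λ q → u * binomial 1 q) ∘ˢ s) m
          ≡⟨ ∘ˢ-cong s split m ⟩
        ((λ q → J b q + ∑≤ b (λ ℓ → z ℓ q)) ∘ˢ s) m
          ≡⟨ ∘ˢ-+ (J b) (λ q → ∑≤ b λ ℓ → z ℓ q) s m ⟩
        (J b ∘ˢ s) m + ((λ q → ∑≤ b λ ℓ → z ℓ q) ∘ˢ s) m
          ≡⟨ cong (λ t → (J b ∘ˢ s) m + t) (∘ˢ-∑ (suc b) z s m) ⟩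
        (J b ∘ˢ s) m + ∑≤ b (λ ℓ → (z ℓ ∘ˢ s) m) ∎
      powers : ∑≤ b (λ ℓ → Z₀-coefficient b ℓ * (R ^ (b ∸ ℓ)) m) ≡ ∑≤ b (λ ℓ → (z ℓ ∘ˢ s) m)
      powers = ∑-cong (suc b) λ ℓ _ → trans
        (cong (Z₀-coefficient b ℓ *_) (binomial-theorem (b ∸ ℓ) s0 R≗1+s m))
        (sym (∘ˢ-* (Z₀-coefficient b ℓ) (binomial (b ∸ ℓ)) s m))
      polynomial : u * R m - ∑≤ b (λ ℓ → Z₀-coefficient b ℓ * (R ^ (b ∸ ℓ)) m) ≡ (J b ∘ˢ s) m
      polynomial = trans (cong₂ _-_ linear powers)
        (solve 2 (λ x y → x :+ y :- y := x) refl ((J b ∘ˢ s) m) (∑≤ b (λ ℓ → (z ℓ ∘ˢ s) m)))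
        where open +-*-Solver

    ∑XK : ∀ m → ∑X≥ 0 (λ k → K b k ∘ˢ s) m ≡ X 0 m + ∑X≥1K s m
    ∑XK m = trans (∑X-first (λ k → K b k ∘ˢ s) m) (cong (_+ ∑X≥1K s m)
      (trans (⊗-congʳ-≗ (X 0) {g = K b 0 ∘ˢ s} {h = const 1ℚ} (δ₀-∘ˢ s) m) (⊗-identityʳ (X 0) m)))

    Z≗X⇒solves : Z b R ≗ X 0 → Solves (J b) (K b) s
    Z≗X⇒solves e .constant-term = s0
    Z≗X⇒solves e .equation m = begin
      (J b ∘ˢ s) m                               ≡⟨ solve 2 (λ x y → x := x :- y :+ y) refl ((J b ∘ˢ s) m) (∑X≥1K s m) ⟩
      (J b ∘ˢ s) m - ∑X≥1K s m + ∑X≥1K s m       ≡⟨ cong (_+ ∑X≥1K s m) (Z-expansion m) ⟨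
      Z b R m + ∑X≥1K s m                        ≡⟨ cong (_+ ∑X≥1K s m) (e m) ⟩
      X 0 m + ∑X≥1K s m                          ≡⟨ ∑XK m ⟨
      ∑X≥ 0 (λ k → K b k ∘ˢ s) m                 ∎
      where open +-*-Solver

    solves⇒Z≗X : Solves (J b) (K b) s → Z b R ≗ X 0
    solves⇒Z≗X h m = begin
      Z b R m                                    ≡⟨ Z-expansion m ⟩
      (J b ∘ˢ s) m - ∑X≥1K s m                   ≡⟨ cong (_- ∑X≥1K s m) (trans (equation h m) (∑XK m)) ⟩
      X 0 m + ∑X≥1K s m - ∑X≥1K s m              ≡⟨ solve 2 (λ x y → x :+ y :- y := x) refl (X 0 m) (∑X≥1K s m) ⟩
      X 0 m                                      ∎
      where open +-*-Solver

  IsR⇒solves : ∀ {R} → IsR b R → Solves (J b) (K b) (R ⊖ const 1ℚ)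
  IsR⇒solves {R} (R𝟏 , e) = Z≗X⇒solves (cong (_- 1ℚ) R𝟏) (decompose R) e

  solves⇒IsR : ∀ {s} → Solves (J b) (K b) s → IsR b (const 1ℚ ⊕ s)
  solves⇒IsR {s} h = cong (λ t → 1ℚ + t) (constant-term h) , solves⇒Z≗X (constant-term h) (λ _ → refl) h

  -- J(b; r) = r + O(r²) for every b: the product in the coefficient of r is empty.
  module R-equation = Solution (J b) refl refl (K b)
  module Ẑ-equation = Solution (J b) refl refl (λ k → I b (b ℕ.+ k))

  R-exists-uniquely : ∃! _≗_ (IsR b)
  R-exists-uniquely = const 1ℚ ⊕ R-equation.solution , solves⇒IsR R-equation.solves , λ {R} isR m → begin
    const 1ℚ m + R-equation.solution m    ≡⟨ cong (λ t → const 1ℚ m + t) (R-equation.unique R-equation.solves (IsR⇒solves isR) m) ⟩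
    const 1ℚ m + (R m - const 1ℚ m)       ≡⟨ decompose R m ⟨
    R m                                   ∎

  ẐRoot⇒solves : ∀ {S} → IsẐRoot b S → Solves (J b) (λ k → I b (b ℕ.+ k)) S
  ẐRoot⇒solves (S𝟏 , e) .constant-term = S𝟏
  ẐRoot⇒solves {S} (S𝟏 , e) .equation m = begin
    x          ≡⟨ solve 2 (λ x y → x := x :- y :+ y) refl x y ⟩
    x - y + y  ≡⟨ cong (_+ y) (trans (e m) (const-zero m)) ⟩
    0ℚ + y     ≡⟨ +-identityˡ y ⟩
    y          ∎
    where
    open +-*-Solver
    x y : ℚ
    x = (J b ∘ˢ S) m
    y = ∑X≥ 0 (λ k → I b (b ℕ.+ k) ∘ˢ S) m

  solves⇒ẐRoot : ∀ {S} → Solves (J b) (λ k → I b (b ℕ.+ k)) S → IsẐRoot b S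
  solves⇒ẐRoot {S} h = constant-term h , λ m → begin
    (J b ∘ˢ S) m - y m  ≡⟨ cong (_- y m) (equation h m) ⟩
    y m - y m           ≡⟨ solve 1 (λ x → x :- x := con 0ℚ) refl (y m) ⟩
    0ℚ                  ≡⟨ const-zero m ⟨
    const 0ℚ m          ∎
    where
    open +-*-Solver
    y : FPS
    y = ∑X≥ 0 λ k → I b (b ℕ.+ k) ∘ˢ S

  -- For this matrix the linear forms `L k` are `x-hat b k` by definition.
  open LinearSubstitution (A b) (A-triangular b) using (substitute-cong; substitute-⊕; substitute-const; substitute-solves)

  -- Substitution is additive and fixes constants, so 1 may be subtracted before it. `hat` subtracts
  -- afterwards, whereas the equation is transported for R - 1, which has no constant term.
  hat-substitute : ∀ R → substitute (x-hat b) (R ⊖ const 1ℚ) ≗ hat b R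
  hat-substitute R m = begin
    Ŝ m                              ≡⟨ solve 2 (λ x y → x := y :+ x :- y) refl (Ŝ m) (const 1ℚ m) ⟩
    const 1ℚ m + Ŝ m - const 1ℚ m    ≡⟨ cong (_- const 1ℚ m) (R̂≗1+Ŝ m) ⟨
    hat b R m                        ∎
    where
    open +-*-Solver
    Ŝ : FPS
    Ŝ = substitute (x-hat b) (R ⊖ const 1ℚ)
    R̂≗1+Ŝ : substitute (x-hat b) R ≗ const 1ℚ ⊕ Ŝ
    R̂≗1+Ŝ = ≗-by-truncation λ w d → let open Truncated w d in
      ≈-trans (substitute-cong (decompose R))
        (≈-trans (substitute-⊕ (const 1ℚ) (R ⊖ const 1ℚ))
          (⊕-cong {g = Ŝ} {g′ = Ŝ} (substitute-const 1ℚ) ≈-refl))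

  hat-solves : ∀ {R} → IsR b R → Solves (J b) (λ k → I b (b ℕ.+ k)) (hat b R)
  hat-solves {R} isR = solves-resp-≗ (hat-substitute R)
    (substitute-solves {F′ = λ k → I b (b ℕ.+ k)} (∑A*K≡I b) (IsR⇒solves isR))

proposition11 : (b : ℕ)
    → ∃! _≗_ (IsR b)
    × (∀ R → IsR b R → IsẐRoot b (hat b R) × (∀ S → IsẐRoot b S → S ≗ hat b R))
proposition11 b = R-exists-uniquely b , λ R isR →
  solves⇒ẐRoot b (hat-solves b isR) ,
  λ S root → Ẑ-equation.unique b (ẐRoot⇒solves b root) (hat-solves b isR)
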